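{- Let $T$ be a tree poset of height $k+1$ that contains a maximal element $m$ such that every chain of $k+1$ elements in $T$ contains $m$. Then for any real $\varepsilon>0$ there exists $n_0=n_0(\varepsilon)$ such that if $n\ge n_0$ and $\mathcal{F}\subseteq\tilde{B}_n$ with $|\mathcal{F}|=(k-1+\varepsilon)\binom{n}{\lfloor n/2\rfloor}$, then $\mathcal{F}$ contains a strong copy $\mathcal{G}$ of $T\setminus\{m\}$, given by a bijection $p\mapsto G_p$, such that for every $p\in T\setminus\mathcal{D}_T(m)$ the set $G_p$ is not a subset of $\bigcup_{d\in\mathcal{D}_T(m)\setminus\{m\}}G_d$.
   Context: $[n]=\{1,\dots,n\}$ and $\tilde{B}_n=\{F\subseteq[n]: ||F|-n/2|\le 2\sqrt{n\ln n}\}$. A family $\mathcal{G}$ is a strong copy of a poset $(P,\leqslant)$ if there is a bijection $f:P\to\mathcal{G}$ with $p\leqslant q\iff f(p)\subseteq f(q)$; we write $G_p=f(p)$. $T\setminus\{m\}$ carries the induced order. $\mathcal{D}_T(m)=\{q\in T: q\leqslant m\}$. The height of a poset is the maximum number of elements of a chain in it. The Hasse diagram of a poset is the graph where $p,q$ are adjacent if one covers the other; a tree poset is one whose Hasse diagram is a tree. -}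

module Defs where

open import Data.Nat using (ℕ; zero; suc; _+_; _*_; _∸_; _^_; _≤_; _<_; ∣_-_∣; _/_)
open import Data.Nat.Combinatorics using (_C_)
open import Data.Fin using (Fin; zero; suc; fromℕ; inject₁)
open import Data.Fin.Subset using (Subset; ∣_∣; _∈_; _⊆_)
open import Data.Product using (Σ; ∃; _×_; _,_; proj₁)
open import Data.Sum using (_⊎_)
open import Data.List using (List; length)
open import Data.List.Relation.Unary.All using (All)
open import Data.List.Relation.Unary.Unique.Propositional using (Unique)
open import Data.List.Membership.Propositional renaming (_∈_ to _∈ₗ_)
open import Relation.Binary using (IsPartialOrder)
open import Relation.Binary.PropositionalEquality using (_≡_; _≢_)
open import Relation.Binary.Construct.Closure.ReflexiveTransitive using (Star)
open import Relation.Nullary using (¬_)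
open import Function.Definitions using (Injective)

module FinPoset {t : ℕ} (_≼_ : Fin t → Fin t → Set) where

  _≺_ : Fin t → Fin t → Set
  p ≺ q = p ≼ q × p ≢ q

  Covers : Fin t → Fin t → Set
  Covers p q = p ≺ q × (∀ r → ¬ (p ≺ r × r ≺ q))

  HasseAdj : Fin t → Fin t → Set
  HasseAdj p q = Covers p q ⊎ Covers q p

  Connected : Set
  Connected = ∀ p q → Star HasseAdj p q

  Cycle : Set
  Cycle = Σ ℕ λ l → Σ (Fin (suc (suc (suc l))) → Fin t) λ c →
            Injective _≡_ _≡_ c
          × (∀ (i : Fin (suc (suc l))) → HasseAdj (c (inject₁ i)) (c (suc i)))
          × HasseAdj (c (fromℕ (suc (suc l)))) (c zero)

  IsTreePoset : Set
  IsTreePoset = Fin t × Connected × ¬ Cycle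

  Comparable : Fin t → Fin t → Set
  Comparable p q = p ≼ q ⊎ q ≼ p

  Chain : ℕ → Set
  Chain s = Σ (Fin s → Fin t) λ c →
              Injective _≡_ _≡_ c × (∀ i j → Comparable (c i) (c j))

  HasHeight : ℕ → Set
  HasHeight h = Chain h × ¬ Chain (suc h)

  Maximal : Fin t → Set
  Maximal m = ∀ q → m ≼ q → q ≡ m

  EveryChainContains : ℕ → Fin t → Set
  EveryChainContains s m = ∀ (ch : Chain s) → ∃ λ i → proj₁ ch i ≡ m

-- The middle layers  B̃ₙ = { F ⊆ [n] : | |F| - n/2 | ≤ 2 √(n ln n) }.
-- With d = | 2|F| - n | the condition is d² ≤ 16 n ln n, i.e.
-- e^(d²) ≤ n^(16 n) (for n ≥ 1).  Since e^x is irrational for x ≥ 1 and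
-- (m/(m-x))^m decreases strictly to e^x for m > x, this is equivalent to
-- d = 0 or ∃ m > d², m^m ≤ n^(16n) · (m - d²)^m.

InBtilde : (n : ℕ) → Subset n → Set
InBtilde n F = d ≡ 0 ⊎ (Σ ℕ λ m → (x < m) × (m ^ m ≤ (n ^ (16 * n)) * ((m ∸ x) ^ m)))
  where
  d = ∣ 2 * ∣ F ∣ - n ∣
  x = d * d

-- Strong copy of T ∖ {m} inside a family 𝓕, as a map G : Fin t → Subset n
-- whose value at m is ignored.

module _ {t : ℕ} (_≼_ : Fin t → Fin t → Set) (m : Fin t) where

  IsStrongCopyMinus : {n : ℕ} → (𝓕 : List (Subset n)) → (Fin t → Subset n) → Set
  IsStrongCopyMinus 𝓕 G =
      (∀ p → p ≢ m → G p ∈ₗ 𝓕)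
    × (∀ p q → p ≢ m → q ≢ m → G p ≡ G q → p ≡ q)
    × (∀ p q → p ≢ m → q ≢ m → (p ≼ q → G p ⊆ G q) × (G p ⊆ G q → p ≼ q))

  AvoidsDownUnion : {n : ℕ} → (Fin t → Subset n) → Set
  AvoidsDownUnion G =
    ∀ p → ¬ (p ≼ m) →
      ¬ (∀ x → x ∈ G p → ∃ λ d → d ≼ m × d ≢ m × x ∈ G d)

{-# OPTIONS --safe #-}
module Submission where

-- Add a layer of sets of size H, two layers above the family, on which m may be placed. On a random
-- full chain, look at k consecutive members of 𝓕 (a window) together with the set of size H; by
-- |𝓕| = (k - 1 + ε) C(n, n/2) the expected number of windows is at least ε. Give every p ≠ m a
-- level below k and m the level k. A window that runs through a set A at a given level is harmful if the
-- chain takes prescribed steps, which would create unwanted inclusions with a bounded number of other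
-- sets; for fixed A this has probability o(1), since all sets differ by o(n) elements. So whenever all
-- windows through some (A, level) are harmful with respect to the same sets they can be discarded, and
-- in total only o(1) windows per chain are lost. In what remains, T can be embedded vertex by vertex
-- along its Hasse diagram, starting with m. The image M of m contains G_d for all d ≼ m but no G_p with
-- p ⋠ m, which is stronger than the assertion about the union.

open import Defs
open import Data.Nat using (ℕ; zero; suc; _+_; _*_; _∸_; _^_; _≤_; _<_; _/_; _!; z≤n; s≤s; pred; _≤?_; _<?_; ∣_-_∣; NonZero; >-nonZero; ⌊_/2⌋)
open import Data.Nat.Combinatorics using (_C_; k![n∸k]!∣n!)
open import Data.Nat.Combinatorics.Specification using (nCk≡n!/k![n-k]!)
open import Data.Nat.Properties
open import Data.Fin using (Fin; zero; suc; toℕ; fromℕ; fromℕ<; inject₁)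
open import Data.Nat.Tactic.RingSolver using (solve-∀)
open import Data.Nat.DivMod using (m/n*n≤m; m/n≤m; m/n*n≡m; m≡m%n+[m/n]*n; m%n<n)
import Data.Fin.Properties as Fin
open import Data.Fin.Induction using (po-noetherian; po-wellFounded; Acc; acc)
open import Data.Fin.Subset using (Subset; ∣_∣; _∈_; _⊆_; inside; outside)
open import Data.Vec using ([]; _∷_; here; there)
open import Data.Vec.Properties using (≡-dec; ∷-injectiveˡ; ∷-injectiveʳ; []=⇒lookup; lookup⇒[]=)
import Data.Bool as Bool
open import Data.Product using (Σ; ∃; _×_; _,_; proj₁; proj₂)
open import Data.Sum using (_⊎_; inj₁; inj₂)
open import Data.Empty using (⊥; ⊥-elim)
open import Data.Unit using (⊤; tt)
open import Data.List using (List; []; _∷_; length; map; _++_; filter; concatMap; allFin; upTo; lookup)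
open import Data.List.Relation.Unary.All as All using (All; []; _∷_)
open import Data.List.Relation.Unary.Any as Any using (here; there)
open import Data.List.Relation.Unary.AllPairs using (AllPairs; []; _∷_)
open import Data.List.Relation.Unary.Unique.Propositional using (Unique)
open import Data.List.Membership.Propositional renaming (_∈_ to _∈ₗ_; _∉_ to _∉ₗ_) using (lose)
open import Data.List.Membership.Propositional.Properties
open import Relation.Binary using (IsPartialOrder; module IsPartialOrder; tri<; tri≈; tri>)
open import Relation.Binary.PropositionalEquality hiding ([_])
open import Relation.Binary.Construct.Closure.ReflexiveTransitive using (Star; ε; _◅_)
open import Relation.Nullary using (¬_; Dec; yes; no)
open import Relation.Nullary.Decidable using (¬?; _×-dec_; map′; decidable-stable; does; dec-true; dec-false; ¬¬-excluded-middle)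
open import Function using (_∘_; id; flip; case_of_)

-- Tree posets

-- Let s be the number of layers and q, of order n, a lower bound for the sizes of all sets and
-- complements in play. A chain has at most one window through a set of the family at a given level,
-- and O(s) harmful steps of probability at most 1/q each lose a share of order s/q. A set of size H
-- lies on up to s windows of each chain, and the same count would give s²/q, which is unbounded
-- since s grows faster than √n. This is why the extra layer lies two layers up: a harmful event
-- then fixes two steps, and the share is of order s · s²/q², which vanishes for s about n^(3/5).
--
-- These are shares of the number of chains through the family. Away from the middle a set lies on
-- more chains, so the size of the family does not bound that number, and the family is first
-- thinned until it is O(n!).
--
-- A new vertex adjacent to p takes its set from any window that shares the set of p at the level of
-- p. This freedom is what makes harmful windows avoidable.
--
-- The order on T is not assumed decidable. Comparisons are decided as the tree is built up, and
-- those with vertices not yet reached are handled under double negation.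

data Path {t : ℕ} (_~_ : Fin t → Fin t → Set) : Fin t → Fin t → List (Fin t) → Set where
  stop : ∀ {x} → Path _~_ x x (x ∷ [])
  step : ∀ {x y z ys} → x ~ y → Path _~_ y z ys → Path _~_ x z (x ∷ ys)

path-last : ∀ {t} {_~_ : Fin t → Fin t → Set} {x z y ys} → Path _~_ x z (y ∷ ys) →
            lookup (y ∷ ys) (fromℕ (length ys)) ≡ z
path-last stop = refl
path-last (step _ stop) = refl
path-last (step _ P@(step _ _)) = path-last P

path-adjacent : ∀ {t} {_~_ : Fin t → Fin t → Set} {x z y ys} → Path _~_ x z (y ∷ ys) →
                (i : Fin (length ys)) → lookup (y ∷ ys) (inject₁ i) ~ lookup ys i
path-adjacent (step e stop) zero = e
path-adjacent (step e (step _ _)) zero = e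
path-adjacent (step _ P@(step _ _)) (suc i) = path-adjacent P i

path-snoc : ∀ {t} {_~_ : Fin t → Fin t → Set} {x y z ys} → Path _~_ x y ys → y ~ z →
            Path _~_ x z (ys ++ z ∷ [])
path-snoc stop e = step e stop
path-snoc (step f P) e = step f (path-snoc P e)

unique-lookup : ∀ {A : Set} {xs : List A} → Unique xs → ∀ i j → lookup xs i ≡ lookup xs j → i ≡ j
unique-lookup (_ ∷ _) zero zero _ = refl
unique-lookup (x∉ ∷ _) zero (suc j) eq = ⊥-elim (All.lookup x∉ (∈-lookup j) eq)
unique-lookup (x∉ ∷ _) (suc i) zero eq = ⊥-elim (All.lookup x∉ (∈-lookup i) (sym eq))
unique-lookup (_ ∷ u) (suc i) (suc j) eq = cong suc (unique-lookup u i j eq)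

-- Lets decidability of the whole order be assumed, all of its finitely many instances at once,
-- wherever the aim is negative or decidable.
¬¬-∀ : ∀ {n} {P : Fin n → Set} → (∀ i → ¬ ¬ P i) → ¬ ¬ (∀ i → P i)
¬¬-∀ {zero} _ k = k λ ()
¬¬-∀ {suc n} h k =
  h zero λ p₀ → ¬¬-∀ (h ∘ suc) λ ps → k λ { zero → p₀ ; (suc i) → ps i }

PathsWithin : {t : ℕ} → (Fin t → Fin t → Set) → List (Fin t) → Set
PathsWithin _~_ D = ∀ {r r'} → r ∈ₗ D → r' ∈ₗ D →
  ∃ λ xs → Path _~_ r r' xs × Unique xs × All (_∈ₗ D) xs

NoCycle : {t : ℕ} → (Fin t → Fin t → Set) → Set
NoCycle _~_ = ∀ {x z xs} → Path _~_ x z xs → Unique xs → 3 ≤ length xs → ¬ (z ~ x)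

-- Stated for an abstract order and adjacency so that it serves both `≼` and its reverse; the Hasse
-- graph is the same for both.
module Descent {t : ℕ} (_≼_ : Fin t → Fin t → Set) (po : IsPartialOrder _≡_ _≼_)
  (_~_ : Fin t → Fin t → Set)
  (cover⇒~ : ∀ {x y} → x ≼ y × x ≢ y → (∀ z → ¬ ((x ≼ z × x ≢ z) × (z ≼ y × z ≢ y))) → y ~ x)
  (noCycle : NoCycle _~_) where

  open IsPartialOrder po using () renaming (refl to ≼-refl; trans to ≼-trans; antisym to ≼-antisym)

  -- Climb from r as long as something lies strictly between the current element and x. Finiteness
  -- stops the climb, at a lower cover of x that is still above r.
  lower-cover : (∀ x y → Dec (x ≼ y)) → ∀ {r x} → r ≼ x → r ≢ x →
                ∃ λ e → r ≼ e × (e ≼ x × e ≢ x) × x ~ e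
  lower-cover _≼?_ {r} {x} r≼x r≢x = climb r (po-noetherian po r) ≼-refl r≼x r≢x
    where
    between? : ∀ e z → Dec ((e ≼ z × e ≢ z) × (z ≼ x × z ≢ x))
    between? e z = ((e ≼? z) ×-dec ¬? (e Fin.≟ z)) ×-dec ((z ≼? x) ×-dec ¬? (z Fin.≟ x))
    climb : ∀ e → Acc (λ y z → z ≼ y × z ≢ y) e → r ≼ e → e ≼ x → e ≢ x →
            ∃ λ e → r ≼ e × (e ≼ x × e ≢ x) × x ~ e
    climb e (acc rec) r≼e e≼x e≢x with Fin.any? (between? e)
    ... | yes (z , e≺z , z≼x , z≢x) = climb z (rec e≺z) (≼-trans r≼e (proj₁ e≺z)) z≼x z≢x
    ... | no none = e , r≼e , (e≼x , e≢x) , cover⇒~ (e≼x , e≢x) λ z b → none (z , b)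

  -- Walking down from q to r along covers, the first vertex of D that is met
  -- must be p: otherwise the walk, closed up inside D and through p ~ q, is a cycle.
  through-neighbour : (∀ x y → Dec (x ≼ y)) → ∀ {D p q r} → PathsWithin _~_ D →
                      p ∈ₗ D → q ∉ₗ D → r ∈ₗ D → p ~ q → r ≼ q → r ≼ p × p ≼ q
  through-neighbour _≼?_ {D} {p} {q} {r} paths p∈ q∉ r∈ p~q r≼q with r ≼? p ×-dec p ≼? q
  ... | yes done = done
  ... | no ¬done = ⊥-elim (closed (descend q (po-wellFounded po q) q∉ r≼q ≼-refl))
    where
    -- The last component keeps the path simple when it is prolonged: a vertex outside D and
    -- strictly above x is neither in D nor below x, hence new.
    Escape : Fin t → Set
    Escape x = ∃ λ xs → Path _~_ x p (x ∷ xs) × Unique (x ∷ xs) × 2 ≤ length xs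
             × All (λ z → z ∈ₗ D ⊎ (z ≼ x)) (x ∷ xs)
    closed : Escape q → ⊥
    closed (xs , P , u , l , _) = noCycle P u (s≤s l) p~q
    descend : ∀ x → Acc (λ y z → y ≼ z × y ≢ z) x → x ∉ₗ D → r ≼ x → x ≼ q → Escape x
    descend x (acc rec) x∉ r≼x x≼q
      with lower-cover _≼?_ r≼x (λ { refl → x∉ r∈ })
    ... | e , r≼e , (e≼x , e≢x) , x~e with e ∈? D
      where open import Data.List.Membership.DecPropositional Fin._≟_ using (_∈?_)
    ... | no e∉ = let (xs , P , u , l , b) = descend e (rec (e≼x , e≢x)) e∉ r≼e (≼-trans e≼x x≼q) in
      e ∷ xs , step x~e P
      , All.map (λ { (inj₁ z∈) refl → x∉ z∈ ; (inj₂ z≼e) refl → e≢x (≼-antisym e≼x z≼e) }) b ∷ u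
      , m≤n⇒m≤1+n l
      , inj₂ ≼-refl ∷ All.map (λ { (inj₁ z∈) → inj₁ z∈ ; (inj₂ z≼e) → inj₂ (≼-trans z≼e e≼x) }) b
    ... | yes e∈ with paths e∈ p∈
    ... | _ , stop , _ , _ = ⊥-elim (¬done (r≼e , ≼-trans e≼x x≼q))
    ... | _ , P@(step _ P') , u , all∈ =
      _ , step x~e P , All.map (λ z∈ → λ { refl → x∉ z∈ }) all∈ ∷ u
      , s≤s (nonempty P') , inj₂ ≼-refl ∷ All.map inj₁ all∈
      where
      nonempty : ∀ {y z ys} → Path _~_ y z ys → 1 ≤ length ys
      nonempty stop = s≤s z≤n
      nonempty (step _ _) = s≤s z≤n

module TreeOrder {t : ℕ} (_≼_ : Fin t → Fin t → Set) (po : IsPartialOrder _≡_ _≼_)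
  (noCyc : ¬ FinPoset.Cycle _≼_) (m : Fin t) where

  open FinPoset _≼_
  open IsPartialOrder po using () renaming (refl to ≼-refl; trans to ≼-trans; antisym to ≼-antisym)
  open import Data.List.Membership.DecPropositional (Fin._≟_ {t}) using (_∈?_)

  Adj-sym : ∀ {p q} → HasseAdj p q → HasseAdj q p
  Adj-sym (inj₁ c) = inj₂ c
  Adj-sym (inj₂ c) = inj₁ c

  noCycle : NoCycle HasseAdj
  noCycle {xs = x ∷ y ∷ z ∷ zs} P u _ closing =
    noCyc (length zs , lookup (x ∷ y ∷ z ∷ zs) , (λ {i} {j} → unique-lookup u i j)
    , path-adjacent P , adj)
    where
    start : ∀ {x z y ys} → Path HasseAdj x z (y ∷ ys) → x ≡ y
    start stop = refl
    start (step _ _) = refl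
    adj : HasseAdj (lookup (x ∷ y ∷ z ∷ zs) (fromℕ (suc (suc (length zs))))) x
    adj = subst₂ HasseAdj (sym (path-last P)) (start P) closing
  noCycle {xs = _ ∷ []} _ _ (s≤s ())
  noCycle {xs = _ ∷ _ ∷ []} _ _ (s≤s (s≤s ()))

  flip-po : IsPartialOrder _≡_ (flip _≼_)
  flip-po = record
    { isPreorder = record
      { isEquivalence = isEquivalence
      ; reflexive = λ { refl → ≼-refl }
      ; trans = λ x≽y y≽z → ≼-trans y≽z x≽y }
    ; antisym = λ x≽y y≽x → ≼-antisym y≽x x≽y }

  covered : ∀ {x y} → x ≺ y → (∀ z → ¬ (x ≺ z × z ≺ y)) → HasseAdj y x
  covered x≺y none = inj₂ (x≺y , none)

  covering : ∀ {x y} → y ≼ x × x ≢ y → (∀ z → ¬ ((z ≼ x × x ≢ z) × (y ≼ z × z ≢ y))) → HasseAdj y x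
  covering (y≼x , x≢y) none = inj₁ ((y≼x , x≢y ∘ sym) ,
    λ { z ((y≼z , y≢z) , (z≼x , z≢x)) → none z ((z≼x , z≢x ∘ sym) , (y≼z , y≢z ∘ sym)) })

  module Down = Descent _≼_ po HasseAdj covered noCycle
  module Up = Descent (flip _≼_) flip-po HasseAdj covering noCycle

  -- Every comparison of q with D passes through its neighbour p, and on the other side of q there
  -- is none. Comparisons with q thus reduce to comparisons with p, which is how both decidability
  -- and the embedding are extended to q.
  Attach : List (Fin t) → Fin t → Fin t → Set
  Attach D p q =
      (p ≺ q × (∀ {r} → r ∈ₗ D → r ≼ q → r ≼ p) × (∀ {r} → r ∈ₗ D → ¬ q ≼ r))
    ⊎ (q ≺ p × (∀ {r} → r ∈ₗ D → q ≼ r → p ≼ r) × (∀ {r} → r ∈ₗ D → ¬ r ≼ q))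

  DecWithin : List (Fin t) → Set
  DecWithin D = ∀ {r r'} → r ∈ₗ D → r' ∈ₗ D → Dec (r ≼ r')

  data Build : List (Fin t) → Set where
    root : Build (m ∷ [])
    grow : ∀ {D p q} → Build D → DecWithin D → p ∈ₗ D → q ∉ₗ D → Attach D p q → Build (q ∷ D)

  -- `through-neighbour` needs a decidable order and is therefore applied under double negation. Its
  -- conclusion about r and p survives because the order is decidable within D; everything else to
  -- be shown is a negation.
  attach : ∀ {D p q} → PathsWithin HasseAdj D → DecWithin D → p ∈ₗ D → q ∉ₗ D → HasseAdj p q → Attach D p q
  attach {D} {p} {q} paths dec p∈ q∉ p~q = go p~q
    where
    ¬¬dec : ¬ ¬ (∀ x y → Dec (x ≼ y))
    ¬¬dec = ¬¬-∀ λ x → ¬¬-∀ λ y → ¬¬-excluded-middle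
    below : ∀ {r} → r ∈ₗ D → r ≼ q → ¬ ¬ (r ≼ p × p ≼ q)
    below r∈ r≼q k = ¬¬dec λ _≼?_ → k (Down.through-neighbour _≼?_ paths p∈ q∉ r∈ p~q r≼q)
    above : ∀ {r} → r ∈ₗ D → q ≼ r → ¬ ¬ (p ≼ r × q ≼ p)
    above r∈ q≼r k = ¬¬dec λ _≼?_ → k (Up.through-neighbour (λ x y → y ≼? x) paths p∈ q∉ r∈ p~q q≼r)
    go : HasseAdj p q → Attach D p q
    go (inj₁ ((p≼q , p≢q) , _)) = inj₁ ((p≼q , p≢q)
      , (λ r∈ r≼q → decidable-stable (dec r∈ p∈) λ k → below r∈ r≼q (k ∘ proj₁))
      , (λ r∈ q≼r → above r∈ q≼r λ (_ , q≼p) → p≢q (≼-antisym p≼q q≼p)))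
    go (inj₂ ((q≼p , q≢p) , _)) = inj₂ ((q≼p , q≢p)
      , (λ r∈ q≼r → decidable-stable (dec p∈ r∈) λ k → above r∈ q≼r (k ∘ proj₁))
      , (λ r∈ r≼q → below r∈ r≼q λ (_ , p≼q) → q≢p (≼-antisym q≼p p≼q)))

  record State (D : List (Fin t)) : Set where
    field
      build : Build D
      paths : PathsWithin HasseAdj D
      dec   : DecWithin D

  state-root : State (m ∷ [])
  state-root = record
    { build = root
    ; paths = λ { (here refl) (here refl) → m ∷ [] , stop , [] ∷ [] , here refl ∷ [] }
    ; dec = λ { (here refl) (here refl) → yes ≼-refl } }

  state-grow : ∀ {D p q} → State D → p ∈ₗ D → q ∉ₗ D → HasseAdj p q → State (q ∷ D)
  state-grow {D} {p} {q} S p∈ q∉ p~q = record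
    { build = grow build dec p∈ q∉ att
    ; paths = paths'
    ; dec = dec' att }
    where
    open State S
    open import Data.List.Relation.Unary.Unique.Propositional.Properties using (++⁺)
    att : Attach D p q
    att = attach paths dec p∈ q∉ p~q
    paths' : PathsWithin HasseAdj (q ∷ D)
    paths' (here refl) (here refl) = q ∷ [] , stop , [] ∷ [] , here refl ∷ []
    paths' (here refl) (there r'∈) with paths p∈ r'∈
    ... | xs , P , u , all∈ = q ∷ xs , step (Adj-sym p~q) P
      , All.map (λ z∈ → λ { refl → q∉ z∈ }) all∈ ∷ u , here refl ∷ All.map there all∈
    paths' (there r∈) (here refl) with paths r∈ p∈
    ... | xs , P , u , all∈ = xs ++ q ∷ [] , path-snoc P p~q
      , ++⁺ u ([] ∷ []) (λ { (q∈ , here refl) → q∉ (All.lookup all∈ q∈) })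
      , All.tabulate (λ z∈ → case ∈-++⁻ xs z∈ of λ
          { (inj₁ z∈xs) → there (All.lookup all∈ z∈xs) ; (inj₂ (here refl)) → here refl })
    paths' (there r∈) (there r'∈) with paths r∈ r'∈
    ... | xs , P , u , all∈ = xs , P , u , All.map there all∈
    dec' : Attach D p q → DecWithin (q ∷ D)
    dec' _ (here refl) (here refl) = yes ≼-refl
    dec' _ (there r∈) (there r'∈) = dec r∈ r'∈
    dec' (inj₁ (_ , _ , no≼)) (here refl) (there r'∈) = no (no≼ r'∈)
    dec' (inj₁ ((p≼q , _) , f , _)) (there r∈) (here refl) =
      map′ (λ r≼p → ≼-trans r≼p p≼q) (f r∈) (dec r∈ p∈)
    dec' (inj₂ ((q≼p , _) , f , _)) (here refl) (there r'∈) =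
      map′ (≼-trans q≼p) (f r'∈) (dec p∈ r'∈)
    dec' (inj₂ (_ , _ , no≼)) (there r∈) (here refl) = no (no≼ r∈)

  Extension : List (Fin t) → (List (Fin t) → Set) → Set
  Extension D P = ∃ λ D' → State D' × (∀ {x} → x ∈ₗ D → x ∈ₗ D') × P D'

  -- Along a walk that starts in D, vertices already present are passed over and every other one is
  -- attached to its predecessor.
  reach : ∀ {D r p} → State D → r ∈ₗ D → Star HasseAdj r p → Extension D (p ∈ₗ_)
  reach S r∈ ε = _ , S , id , r∈
  reach {D} S r∈ (_◅_ {j = s} r~s rest) with s ∈? D
  ... | yes s∈ = reach S s∈ rest
  ... | no s∉ with reach (state-grow S r∈ s∉ r~s) (here refl) rest
  ... | D' , S' , ⊆' , p∈ = D' , S' , ⊆' ∘ there , p∈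

  reach-all : Connected → ∀ {D} → State D → m ∈ₗ D → (ps : List (Fin t)) →
              Extension D λ D' → ∀ {p} → p ∈ₗ ps → p ∈ₗ D'
  reach-all conn S m∈ [] = _ , S , id , λ ()
  reach-all conn S m∈ (p ∷ ps) with reach S m∈ (conn m p)
  ... | D₁ , S₁ , ⊆₁ , p∈ with reach-all conn S₁ (⊆₁ m∈) ps
  ... | D₂ , S₂ , ⊆₂ , ps∈ = D₂ , S₂ , ⊆₂ ∘ ⊆₁ , λ { (here refl) → ⊆₂ p∈ ; (there q∈) → ps∈ q∈ }

  build-order : Connected → ∃ λ D → Build D × DecWithin D × (∀ p → p ∈ₗ D)
  build-order conn with reach-all conn state-root (here refl) (allFin t)
  ... | D , S , _ , all∈ = D , State.build S , State.dec S , λ p → all∈ (∈-allFin p)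

-- Levels

module Levels {t : ℕ} (_≼_ : Fin t → Fin t → Set) (po : IsPartialOrder _≡_ _≼_)
  (_≼?_ : ∀ x y → Dec (x ≼ y)) where

  open FinPoset _≼_
  open IsPartialOrder po using () renaming (refl to ≼-refl; trans to ≼-trans; antisym to ≼-antisym)

  -- A strictly descending chain of s + 1 elements with top p; the level of p ≠ m will be the
  -- largest such s.
  data Below : ℕ → Fin t → Set where
    bottom : ∀ {p} → Below zero p
    above  : ∀ {s p q} → q ≺ p → Below s q → Below (suc s) p

  ≺? : ∀ p q → Dec (p ≺ q)
  ≺? p q = (p ≼? q) ×-dec ¬? (p Fin.≟ q)

  below? : ∀ s p → Dec (Below s p)
  below? zero p = yes bottom
  below? (suc s) p = map′ (λ (_ , q≺p , b) → above q≺p b) (λ { (above q≺p b) → _ , q≺p , b })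
    (Fin.any? λ q → ≺? q p ×-dec below? s q)

  below-mono : ∀ {s r p} → r ≤ s → Below s p → Below r p
  below-mono z≤n _ = bottom
  below-mono (s≤s r≤s) (above q≺p b) = above q≺p (below-mono r≤s b)

  elements : ∀ {s p} → Below s p → Fin (suc s) → Fin t
  elements {p = p} _ zero = p
  elements (above _ b) (suc i) = elements b i

  elements-≼ : ∀ {s p} (b : Below s p) i → elements b i ≼ p
  elements-≼ _ zero = ≼-refl
  elements-≼ (above (q≼p , _) b) (suc i) = ≼-trans (elements-≼ b i) q≼p

  elements-comparable : ∀ {s p} (b : Below s p) i j → Comparable (elements b i) (elements b j)
  elements-comparable b zero j = inj₂ (elements-≼ b j)
  elements-comparable b (suc i) zero = inj₁ (elements-≼ b (suc i))
  elements-comparable (above _ b) (suc i) (suc j) = elements-comparable b i j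

  elements-injective : ∀ {s p} (b : Below s p) {i j} → elements b i ≡ elements b j → i ≡ j
  elements-injective b {zero} {zero} _ = refl
  elements-injective (above (q≼p , q≢p) b) {zero} {suc j} refl =
    ⊥-elim (q≢p (≼-antisym q≼p (elements-≼ b j)))
  elements-injective (above (q≼p , q≢p) b) {suc i} {zero} refl =
    ⊥-elim (q≢p (≼-antisym q≼p (elements-≼ b i)))
  elements-injective (above _ b) {suc i} {suc j} eq = cong suc (elements-injective b eq)

  height : ∀ k p → ¬ Below k p → ∃ λ l → l < k × Below l p × ¬ Below (suc l) p
  height zero p ¬b = ⊥-elim (¬b bottom)
  height (suc k) p ¬b with below? k p
  ... | yes b = k , ≤-refl , b , ¬b
  ... | no ¬b' with height k p ¬b'
  ... | l , l<k , rest = l , m≤n⇒m≤1+n l<k , rest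

  IsLevel : ℕ → Fin t → (Fin t → ℕ) → Set
  IsLevel k m ℓ = ℓ m ≡ k × (∀ p → p ≢ m → ℓ p < k) × (∀ p q → p ≺ q → ℓ p < ℓ q)

  -- For p ≠ m the level is the height of p. It stays below k: a chain of k + 1 elements with top p
  -- would contain m, and then m ≼ p forces p ≡ m by maximality. Giving m the level k, possibly more
  -- than its height, keeps the levels strictly increasing.
  levels : ∀ k m → Maximal m → EveryChainContains (suc k) m → ∃ (IsLevel k m)
  levels k m max every = ℓ , ℓ-m , ℓ-< , ℓ-mono
    where
    ¬below : ∀ p → p ≢ m → ¬ Below k p
    ¬below p p≢m b with every (elements b , elements-injective b , elements-comparable b)
    ... | i , refl = p≢m (max p (elements-≼ b i))
    ht : ∀ p → p ≢ m → ∃ λ l → l < k × Below l p × ¬ Below (suc l) p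
    ht p p≢m = height k p (¬below p p≢m)
    ℓ : Fin t → ℕ
    ℓ p with p Fin.≟ m
    ... | yes _ = k
    ... | no p≢m = proj₁ (ht p p≢m)
    ℓ-m : ℓ m ≡ k
    ℓ-m with m Fin.≟ m
    ... | yes _ = refl
    ... | no m≢m = ⊥-elim (m≢m refl)
    ℓ-< : ∀ p → p ≢ m → ℓ p < k
    ℓ-< p p≢m with p Fin.≟ m
    ... | yes p≡m = ⊥-elim (p≢m p≡m)
    ... | no p≢m' = proj₁ (proj₂ (ht p p≢m'))
    ℓ-mono : ∀ p q → p ≺ q → ℓ p < ℓ q
    ℓ-mono p q (p≼q , p≢q) with p Fin.≟ m | q Fin.≟ m
    ... | yes refl | _ = ⊥-elim (p≢q (sym (max q p≼q)))
    ... | no p≢m | yes _ = proj₁ (proj₂ (ht p p≢m))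
    ... | no p≢m | no q≢m with ht p p≢m | ht q q≢m
    ... | l , _ , b , _ | l' , _ , _ , ¬b' =
      ≰⇒> λ l'≤l → ¬b' (below-mono (s≤s l'≤l) (above (p≼q , p≢q) b))

-- Counting full chains

infix 9 [_]

[_] : {P : Set} → Dec P → ℕ
[ yes _ ] = 1
[ no _ ] = 0

[]-mono : ∀ {P Q : Set} (P? : Dec P) (Q? : Dec Q) → (P → Q) → [ P? ] ≤ [ Q? ]
[]-mono (no _) _ _ = z≤n
[]-mono (yes p) (yes _) _ = s≤s z≤n
[]-mono (yes p) (no ¬q) f = ⊥-elim (¬q (f p))

[]≤1 : ∀ {P : Set} (P? : Dec P) → [ P? ] ≤ 1
[]≤1 (yes _) = s≤s z≤n
[]≤1 (no _) = z≤n

[]-yes : ∀ {P : Set} (P? : Dec P) → P → [ P? ] ≡ 1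
[]-yes (yes _) _ = refl
[]-yes (no ¬p) p = ⊥-elim (¬p p)

[]-no : ∀ {P : Set} (P? : Dec P) → ¬ P → [ P? ] ≡ 0
[]-no (yes p) ¬p = ⊥-elim (¬p p)
[]-no (no _) _ = refl

[]-≤ : ∀ {P : Set} (P? : Dec P) {c} → (P → 1 ≤ c) → [ P? ] ≤ c
[]-≤ (yes p) f = f p
[]-≤ (no _) _ = z≤n

∑ : {A : Set} → List A → (A → ℕ) → ℕ
∑ [] f = 0
∑ (x ∷ xs) f = f x + ∑ xs f

∑-mono : ∀ {A : Set} (xs : List A) {f g : A → ℕ} → (∀ x → f x ≤ g x) → ∑ xs f ≤ ∑ xs g
∑-mono [] _ = z≤n
∑-mono (x ∷ xs) f≤g = +-mono-≤ (f≤g x) (∑-mono xs f≤g)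

∑-mono-∈ : ∀ {A : Set} (xs : List A) {f g : A → ℕ} → (∀ {x} → x ∈ₗ xs → f x ≤ g x) → ∑ xs f ≤ ∑ xs g
∑-mono-∈ [] _ = z≤n
∑-mono-∈ (x ∷ xs) f≤g = +-mono-≤ (f≤g (here refl)) (∑-mono-∈ xs (f≤g ∘ there))

∑-cong : ∀ {A : Set} (xs : List A) {f g : A → ℕ} → (∀ x → f x ≡ g x) → ∑ xs f ≡ ∑ xs g
∑-cong [] _ = refl
∑-cong (x ∷ xs) f≡g = cong₂ _+_ (f≡g x) (∑-cong xs f≡g)

∑-++ : ∀ {A : Set} (xs ys : List A) (f : A → ℕ) → ∑ (xs ++ ys) f ≡ ∑ xs f + ∑ ys f
∑-++ [] ys f = refl
∑-++ (x ∷ xs) ys f = trans (cong (f x +_) (∑-++ xs ys f)) (sym (+-assoc (f x) _ _))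

∑-map : ∀ {A B : Set} (g : A → B) (xs : List A) (f : B → ℕ) → ∑ (map g xs) f ≡ ∑ xs (f ∘ g)
∑-map g [] f = refl
∑-map g (x ∷ xs) f = cong (f (g x) +_) (∑-map g xs f)

∑-concatMap : ∀ {A B : Set} (g : A → List B) (xs : List A) (f : B → ℕ) →
              ∑ (concatMap g xs) f ≡ ∑ xs (λ x → ∑ (g x) f)
∑-concatMap g [] f = refl
∑-concatMap g (x ∷ xs) f = trans (∑-++ (g x) _ f) (cong (∑ (g x) f +_) (∑-concatMap g xs f))

∑-const : ∀ {A : Set} (xs : List A) c → ∑ xs (λ _ → c) ≡ length xs * c
∑-const [] c = refl
∑-const (x ∷ xs) c = cong (c +_) (∑-const xs c)

∑-zero : ∀ {A : Set} (xs : List A) → ∑ xs (λ _ → 0) ≡ 0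
∑-zero xs = trans (∑-const xs 0) (*-zeroʳ (length xs))

∑-length : ∀ {A : Set} (xs : List A) → ∑ xs (λ _ → 1) ≡ length xs
∑-length xs = trans (∑-const xs 1) (*-identityʳ _)

∑-*ʳ : ∀ {A : Set} (xs : List A) (f : A → ℕ) c → ∑ xs (λ x → f x * c) ≡ ∑ xs f * c
∑-*ʳ [] f c = refl
∑-*ʳ (x ∷ xs) f c = trans (cong (f x * c +_) (∑-*ʳ xs f c)) (sym (*-distribʳ-+ c (f x) _))

∑-*ˡ : ∀ {A : Set} (xs : List A) (f : A → ℕ) c → ∑ xs (λ x → c * f x) ≡ c * ∑ xs f
∑-*ˡ xs f c = trans (∑-cong xs λ x → *-comm c (f x)) (trans (∑-*ʳ xs f c) (*-comm _ c))

∑-+ : ∀ {A : Set} (xs : List A) (f g : A → ℕ) → ∑ xs (λ x → f x + g x) ≡ ∑ xs f + ∑ xs g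
∑-+ [] f g = refl
∑-+ (x ∷ xs) f g = trans (cong (f x + g x +_) (∑-+ xs f g)) (interchange (f x) (g x) _ _)
  where open import Algebra.Properties.CommutativeSemigroup +-commutativeSemigroup using (interchange)

∑-swap : ∀ {A B : Set} (xs : List A) (ys : List B) (f : A → B → ℕ) →
         ∑ xs (λ x → ∑ ys (f x)) ≡ ∑ ys (λ y → ∑ xs (λ x → f x y))
∑-swap [] ys f = sym (∑-zero ys)
∑-swap (x ∷ xs) ys f = trans (cong (∑ ys (f x) +_) (∑-swap xs ys f)) (sym (∑-+ ys _ _))

∑-∈ : ∀ {A : Set} {xs : List A} {x} (f : A → ℕ) → x ∈ₗ xs → f x ≤ ∑ xs f
∑-∈ f (here refl) = m≤m+n _ _
∑-∈ f (there x∈) = ≤-trans (∑-∈ f x∈) (m≤n+m _ _)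

∑-allFin : ∀ n (f : Fin (suc n) → ℕ) → ∑ (allFin (suc n)) f ≡ f zero + ∑ (allFin n) (f ∘ suc)
∑-allFin n f = cong (f zero +_) (trans (cong (λ js → ∑ js f) (sym (map-tabulate id suc))) (∑-map suc (allFin n) f))
  where open import Data.List.Properties using (map-tabulate)

-- A chain ∅ = S₀ ⊂ S₁ ⊂ … ⊂ Sₙ = [n] is coded by the step at which the first
-- element enters, together with the chain induced on the remaining elements.
Perm : ℕ → Set
Perm zero = ⊤
Perm (suc n) = Fin (suc n) × Perm n

perms : ∀ n → List (Perm n)
perms zero = tt ∷ []
perms (suc n) = concatMap (λ j → map (j ,_) (perms n)) (allFin (suc n))

-- The increasing map that omits the value j: it makes room for the first element to enter at step
-- j.
bump : ℕ → ℕ → ℕ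
bump zero y = suc y
bump (suc j) zero = zero
bump (suc j) (suc y) = suc (bump j y)

-- The number of y with `bump j y < i`, that is, how many of the remaining elements have entered
-- after i steps of the full chain.
unbump : ℕ → ℕ → ℕ
unbump zero i = pred i
unbump (suc j) zero = zero
unbump (suc j) (suc i) = suc (unbump j i)

unbump-bump : ∀ j y → unbump j (bump j y) ≡ y
unbump-bump zero y = refl
unbump-bump (suc j) zero = refl
unbump-bump (suc j) (suc y) = cong suc (unbump-bump j y)

bump-unbump : ∀ j i → j ≢ i → bump j (unbump j i) ≡ i
bump-unbump zero zero j≢i = ⊥-elim (j≢i refl)
bump-unbump zero (suc i) _ = refl
bump-unbump (suc j) zero _ = refl
bump-unbump (suc j) (suc i) j≢i = cong suc (bump-unbump j i (j≢i ∘ cong suc))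

bump-≢ : ∀ j y → j ≢ bump j y
bump-≢ zero y ()
bump-≢ (suc j) zero ()
bump-≢ (suc j) (suc y) eq = bump-≢ j y (suc-injective eq)

unbump-< : ∀ {j i} → j < i → unbump j i ≡ pred i
unbump-< {zero} _ = refl
unbump-< {suc j} {suc (suc i)} (s≤s j<i) = cong suc (unbump-< j<i)

unbump-≥ : ∀ {j i} → i ≤ j → unbump j i ≡ i
unbump-≥ {zero} z≤n = refl
unbump-≥ {suc j} {zero} _ = refl
unbump-≥ {suc j} {suc i} (s≤s i≤j) = cong suc (unbump-≥ i≤j)

bump-<⇒ : ∀ j {y i} → bump j y < i → y < unbump j i
bump-<⇒ zero (s≤s lt) = lt
bump-<⇒ (suc j) {zero} {suc i} _ = s≤s z≤n
bump-<⇒ (suc j) {suc y} {suc i} (s≤s lt) = s≤s (bump-<⇒ j lt)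

bump-<⇐ : ∀ j {y i} → y < unbump j i → bump j y < i
bump-<⇐ zero {y} {suc i} lt = s≤s lt
bump-<⇐ (suc j) {zero} {suc i} _ = s≤s z≤n
bump-<⇐ (suc j) {suc y} {suc i} (s≤s lt) = s≤s (bump-<⇐ j lt)

pos : ∀ {n} → Perm n → Fin n → ℕ
pos (j , π) zero = toℕ j
pos (j , π) (suc x) = bump (toℕ j) (pos π x)

at : ∀ {n} → Perm n → ℕ → Subset n
at {zero} _ _ = []
at {suc n} (j , π) i = does (toℕ j <? i) ∷ at π (unbump (toℕ j) i)

∈-at⇒ : ∀ {n} (π : Perm n) {i x} → x ∈ at π i → pos π x < i
∈-at⇒ {suc n} (j , π) {i} {zero} x∈ with toℕ j <? i
... | yes j<i = j<i
... | no j≮i = case trans (sym (dec-false (toℕ j <? i) j≮i)) ([]=⇒lookup x∈) of λ ()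
∈-at⇒ {suc n} (j , π) {i} {suc x} (there x∈) = bump-<⇐ (toℕ j) (∈-at⇒ π x∈)

∈-at⇐ : ∀ {n} (π : Perm n) {i x} → pos π x < i → x ∈ at π i
∈-at⇐ {suc n} (j , π) {i} {zero} lt = lookup⇒[]= zero _ (dec-true (toℕ j <? i) lt)
∈-at⇐ {suc n} (j , π) {i} {suc x} lt = there (∈-at⇐ π (bump-<⇒ (toℕ j) lt))

at-mono : ∀ {n} (π : Perm n) {i i'} → i ≤ i' → at π i ⊆ at π i'
at-mono π i≤i' x∈ = ∈-at⇐ π (<-≤-trans (∈-at⇒ π x∈) i≤i')

∣at∣ : ∀ {n} (π : Perm n) {i} → i ≤ n → ∣ at π i ∣ ≡ i
∣at∣ {zero} _ z≤n = refl
∣at∣ {suc n} (j , π) {i} i≤n with toℕ j <? i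
∣at∣ {suc n} (j , π) {suc i} (s≤s i≤n) | yes j<i rewrite dec-true (toℕ j <? suc i) j<i =
  cong suc (trans (cong (∣_∣ ∘ at π) (unbump-< j<i)) (∣at∣ π i≤n))
∣at∣ {suc n} (j , π) {i} _ | no j≮i rewrite dec-false (toℕ j <? i) j≮i =
  trans (cong (∣_∣ ∘ at π) (unbump-≥ (≮⇒≥ j≮i)))
        (∣at∣ π (≤-trans (≮⇒≥ j≮i) (Fin.toℕ≤pred[n] j)))

_≟ₛ_ : ∀ {n} (A B : Subset n) → Dec (A ≡ B)
_≟ₛ_ = ≡-dec Bool._≟_

Through : ∀ {n} → Subset n → Perm n → Set
Through A π = at π ∣ A ∣ ≡ A

through? : ∀ {n} (A : Subset n) (π : Perm n) → Dec (Through A π)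
through? A π = at π ∣ A ∣ ≟ₛ A

through-in⇒ : ∀ {n} {A : Subset n} {j π} → Through (inside ∷ A) (j , π) → toℕ j < suc ∣ A ∣ × Through A π
through-in⇒ {A = A} {j} {π} eq with toℕ j <? suc ∣ A ∣
... | yes j<a = j<a , trans (cong (at π) (sym (unbump-< j<a))) (∷-injectiveʳ eq)
... | no j≮a = case trans (sym (dec-false (toℕ j <? suc ∣ A ∣) j≮a)) (∷-injectiveˡ eq) of λ ()

through-in⇐ : ∀ {n} {A : Subset n} {j π} → toℕ j < suc ∣ A ∣ → Through A π → Through (inside ∷ A) (j , π)
through-in⇐ {A = A} {j} {π} j<a eq =
  cong₂ _∷_ (dec-true (toℕ j <? suc ∣ A ∣) j<a) (trans (cong (at π) (unbump-< j<a)) eq)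

through-out⇒ : ∀ {n} {A : Subset n} {j π} → Through (outside ∷ A) (j , π) → ∣ A ∣ ≤ toℕ j × Through A π
through-out⇒ {A = A} {j} {π} eq with toℕ j <? ∣ A ∣
... | no j≮a = ≮⇒≥ j≮a , trans (cong (at π) (sym (unbump-≥ (≮⇒≥ j≮a)))) (∷-injectiveʳ eq)
... | yes j<a = case trans (sym (dec-true (toℕ j <? ∣ A ∣) j<a)) (∷-injectiveˡ eq) of λ ()

through-out⇐ : ∀ {n} {A : Subset n} {j π} → ∣ A ∣ ≤ toℕ j → Through A π → Through (outside ∷ A) (j , π)
through-out⇐ {A = A} {j} {π} a≤j eq =
  cong₂ _∷_ (dec-false (toℕ j <? ∣ A ∣) (≤⇒≯ a≤j)) (trans (cong (at π) (unbump-≥ a≤j)) eq)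

cnt : ∀ {n} {P : Perm n → Set} → (∀ π → Dec (P π)) → ℕ
cnt {n} P? = ∑ (perms n) (λ π → [ P? π ])

∑-perms : ∀ n (f : Perm (suc n) → ℕ) →
          ∑ (perms (suc n)) f ≡ ∑ (allFin (suc n)) (λ j → ∑ (perms n) (λ π → f (j , π)))
∑-perms n f = trans (∑-concatMap (λ j → map (j ,_) (perms n)) (allFin (suc n)) f)
                    (∑-cong (allFin (suc n)) λ j → ∑-map (j ,_) (perms n) f)

length-perms : ∀ n → length (perms n) ≡ n !
length-perms zero = refl
length-perms (suc n) = begin
  length (perms (suc n))                          ≡⟨ ∑-length (perms (suc n)) ⟨
  ∑ (perms (suc n)) (λ _ → 1)                     ≡⟨ ∑-perms n _ ⟩
  ∑ (allFin (suc n)) (λ _ → ∑ (perms n) λ _ → 1)  ≡⟨ ∑-const (allFin (suc n)) _ ⟩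
  length (allFin (suc n)) * ∑ (perms n) (λ _ → 1) ≡⟨ cong₂ _*_ (length-tabulate {n = suc n} id)
        (trans (∑-length (perms n)) (length-perms n)) ⟩
  suc n !                                         ∎
  where
  open ≡-Reasoning
  open import Data.List.Properties using (length-tabulate)

-- Conditioning on the step j at which the first element enters: at most s values of j are
-- admissible, each with at most c continuations. All counts below are inductions of this kind.
cnt-split : ∀ {n} {P : Perm (suc n) → Set} (P? : ∀ π → Dec (P π))
            {S : Fin (suc n) → Set} (S? : ∀ j → Dec (S j))
            {Q : Fin (suc n) → Perm n → Set} (Q? : ∀ j π → Dec (Q j π)) s c →
            (∀ {j π} → P (j , π) → S j × Q j π) → (∀ j → S j → cnt (Q? j) ≤ c) →
            ∑ (allFin (suc n)) (λ j → [ S? j ]) ≤ s → cnt P? ≤ s * c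
cnt-split {n} P? {S} S? Q? s c P⇒ Q≤ S≤ = begin
  cnt P?                                                      ≡⟨ ∑-perms n _ ⟩
  ∑ (allFin (suc n)) (λ j → ∑ (perms n) λ π → [ P? (j , π) ]) ≤⟨ ∑-mono (allFin (suc n)) slice ⟩
  ∑ (allFin (suc n)) (λ j → [ S? j ] * c)                     ≡⟨ ∑-*ʳ (allFin (suc n)) (λ j → [ S? j ]) c ⟩
  ∑ (allFin (suc n)) (λ j → [ S? j ]) * c                     ≤⟨ *-monoˡ-≤ c S≤ ⟩
  s * c                                                       ∎
  where
  open ≤-Reasoning
  slice : ∀ j → ∑ (perms n) (λ π → [ P? (j , π) ]) ≤ [ S? j ] * c
  slice j with S? j
  ... | yes sj = ≤-trans (∑-mono (perms n) λ π → []-mono (P? (j , π)) (Q? j π) (proj₂ ∘ P⇒))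
                         (≤-trans (Q≤ j sj) (≤-reflexive (sym (*-identityˡ c))))
  ... | no ¬sj = ≤-reflexive (trans (∑-cong (perms n) λ π → []-no (P? (j , π)) (¬sj ∘ proj₁ ∘ P⇒))
                                    (∑-zero (perms n)))

#< : ∀ n a → a ≤ n → ∑ (allFin n) (λ j → [ toℕ j <? a ]) ≡ a
#< zero zero _ = refl
#< (suc n) zero _ = trans (∑-cong (allFin (suc n)) λ j → []-no (toℕ j <? 0) λ ())
                          (∑-zero (allFin (suc n)))
#< (suc n) (suc a) (s≤s a≤n) = trans (∑-allFin n λ j → [ toℕ j <? suc a ]) (cong suc (trans
  (∑-cong (allFin n) λ j → ≤-antisym ([]-mono (suc (toℕ j) <? suc a) (toℕ j <? a) ≤-pred)
                                     ([]-mono (toℕ j <? a) (suc (toℕ j) <? suc a) s≤s))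
  (#< n a a≤n)))

#≥ : ∀ n a → ∑ (allFin n) (λ j → [ a ≤? toℕ j ]) ≡ n ∸ a
#≥ zero a = sym (0∸n≡0 a)
#≥ (suc n) zero = trans (∑-cong (allFin (suc n)) λ j → []-yes (0 ≤? toℕ j) z≤n)
                        (trans (∑-length (allFin (suc n))) (length-tabulate {n = suc n} id))
  where open import Data.List.Properties using (length-tabulate)
#≥ (suc n) (suc a) = trans (∑-allFin n λ j → [ suc a ≤? toℕ j ]) (trans
  (∑-cong (allFin n) λ j → ≤-antisym ([]-mono (suc a ≤? suc (toℕ j)) (a ≤? toℕ j) ≤-pred)
                                     ([]-mono (a ≤? toℕ j) (suc a ≤? suc (toℕ j)) s≤s))
  (#≥ n a))

-- P and the single index i are disjoint parts of Q.
#exclude : ∀ {n i} {P Q : Fin n → Set} (P? : ∀ j → Dec (P j)) (Q? : ∀ j → Dec (Q j)) →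
           i < n → (∀ {j} → P j → Q j × toℕ j ≢ i) → (∀ {j} → toℕ j ≡ i → Q j) →
           ∑ (allFin n) (λ j → [ P? j ]) ≤ ∑ (allFin n) (λ j → [ Q? j ]) ∸ 1
#exclude {n} {i} P? Q? i<n P⇒ Q∋ = begin
  ∑ (allFin n) (λ j → [ P? j ])                     ≡⟨ m+n∸n≡m _ 1 ⟨
  ∑ (allFin n) (λ j → [ P? j ]) + 1 ∸ 1             ≤⟨ ∸-monoˡ-≤ 1 (+-monoʳ-≤ (∑ (allFin n) λ j → [ P? j ]) one) ⟩
  ∑ (allFin n) (λ j → [ P? j ]) + ∑ (allFin n) (λ j → [ toℕ j ≟ i ]) ∸ 1
                                                    ≡⟨ cong (_∸ 1) (∑-+ (allFin n) _ _) ⟨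
  ∑ (allFin n) (λ j → [ P? j ] + [ toℕ j ≟ i ]) ∸ 1 ≤⟨ ∸-monoˡ-≤ 1 (∑-mono (allFin n) both) ⟩
  ∑ (allFin n) (λ j → [ Q? j ]) ∸ 1                 ∎
  where
  open ≤-Reasoning
  one : 1 ≤ ∑ (allFin n) (λ j → [ toℕ j ≟ i ])
  one = ≤-trans (≤-reflexive (sym ([]-yes (toℕ (fromℕ< i<n) ≟ i) (Fin.toℕ-fromℕ< i<n))))
                (∑-∈ (λ j → [ toℕ j ≟ i ]) (∈-allFin (fromℕ< i<n)))
  both : ∀ j → [ P? j ] + [ toℕ j ≟ i ] ≤ [ Q? j ]
  both j with P? j | toℕ j ≟ i
  ... | yes p | yes eq = ⊥-elim (proj₂ (P⇒ p) eq)
  ... | yes p | no _ = ≤-reflexive (sym ([]-yes (Q? j) (proj₁ (P⇒ p))))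
  ... | no _ | yes eq = ≤-reflexive (sym ([]-yes (Q? j) (Q∋ eq)))
  ... | no _ | no _ = z≤n

#≡ : ∀ n i → ∑ (allFin n) (λ j → [ toℕ j ≟ i ]) ≤ 1
#≡ zero i = z≤n
#≡ (suc n) i = ≤-trans (≤-reflexive (∑-allFin n _)) (go i)
  where
  go : ∀ i → [ 0 ≟ i ] + ∑ (allFin n) (λ j → [ suc (toℕ j) ≟ i ]) ≤ 1
  go zero = ≤-reflexive (cong suc (trans (∑-cong (allFin n) λ j → []-no (suc (toℕ j) ≟ 0) λ ())
              (∑-zero (allFin n))))
  go (suc i) = ≤-trans (∑-mono (allFin n) λ j → []-mono (suc (toℕ j) ≟ suc i) (toℕ j ≟ i) suc-injective) (#≡ n i)

m*[m∸1]!≤m! : ∀ m → m * (m ∸ 1) ! ≤ m !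
m*[m∸1]!≤m! zero = z≤n
m*[m∸1]!≤m! (suc m) = ≤-refl

chains : ∀ {n} → Subset n → ℕ
chains A = cnt (through? A)

-- The steps open to the first element are those below the size of the set if it belongs to the set,
-- and those from that size on otherwise. Either way their number does not depend on the rest of the
-- chain.
chains-count : ∀ {n} (A : Subset n) → chains A ≡ ∣ A ∣ ! * (n ∸ ∣ A ∣) !
chains-count [] = refl
chains-count {suc n} (inside ∷ A) = begin
  chains (inside ∷ A)                                    ≡⟨ ∑-perms n _ ⟩
  ∑ (allFin (suc n)) (λ j → cnt λ π → through? (inside ∷ A) (j , π))
                                                         ≡⟨ ∑-cong (allFin (suc n)) slice ⟩
  ∑ (allFin (suc n)) (λ j → [ toℕ j <? suc a ] * chains A) ≡⟨ ∑-*ʳ (allFin (suc n)) (λ j → [ toℕ j <? suc a ]) (chains A) ⟩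
  ∑ (allFin (suc n)) (λ j → [ toℕ j <? suc a ]) * chains A ≡⟨ cong₂ _*_ (#< (suc n) (suc a) (s≤s (∣p∣≤n A)))
        (chains-count A) ⟩
  suc a * (a ! * (n ∸ a) !)                              ≡⟨ *-assoc (suc a) (a !) _ ⟨
  suc a ! * (n ∸ a) !                                    ∎
  where
  open ≡-Reasoning
  open import Data.Fin.Subset.Properties using (∣p∣≤n)
  a = ∣ A ∣
  slice : ∀ j → cnt (λ π → through? (inside ∷ A) (j , π)) ≡ [ toℕ j <? suc a ] * chains A
  slice j with toℕ j <? suc a
  ... | yes j<a = trans (∑-cong (perms n) λ π → ≤-antisym
      ([]-mono (through? (inside ∷ A) (j , π)) (through? A π) (proj₂ ∘ through-in⇒ {A = A} {j}))
      ([]-mono (through? A π) (through? (inside ∷ A) (j , π)) (through-in⇐ {A = A} {j} j<a)))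
    (sym (*-identityˡ _))
  ... | no j≮a = trans (∑-cong (perms n) λ π → []-no (through? (inside ∷ A) (j , π))
      (j≮a ∘ proj₁ ∘ through-in⇒ {A = A} {j}))
    (∑-zero (perms n))
chains-count {suc n} (outside ∷ A) = begin
  chains (outside ∷ A)                                   ≡⟨ ∑-perms n _ ⟩
  ∑ (allFin (suc n)) (λ j → cnt λ π → through? (outside ∷ A) (j , π))
                                                         ≡⟨ ∑-cong (allFin (suc n)) slice ⟩
  ∑ (allFin (suc n)) (λ j → [ a ≤? toℕ j ] * chains A)   ≡⟨ ∑-*ʳ (allFin (suc n)) (λ j → [ a ≤? toℕ j ]) (chains A) ⟩
  ∑ (allFin (suc n)) (λ j → [ a ≤? toℕ j ]) * chains A   ≡⟨ cong₂ _*_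
        (trans (#≥ (suc n) a) (+-∸-assoc 1 (∣p∣≤n A))) (chains-count A) ⟩
  suc (n ∸ a) * (a ! * (n ∸ a) !)                        ≡⟨ x∙yz≈y∙xz (suc (n ∸ a)) (a !) _ ⟩
  a ! * suc (n ∸ a) !                                    ≡⟨ cong (λ r → a ! * r !) (+-∸-assoc 1 (∣p∣≤n A)) ⟨
  a ! * (suc n ∸ a) !                                    ∎
  where
  open ≡-Reasoning
  open import Data.Fin.Subset.Properties using (∣p∣≤n)
  open import Algebra.Properties.CommutativeSemigroup *-commutativeSemigroup using (x∙yz≈y∙xz)
  a = ∣ A ∣
  slice : ∀ j → cnt (λ π → through? (outside ∷ A) (j , π)) ≡ [ a ≤? toℕ j ] * chains A
  slice j with a ≤? toℕ j
  ... | yes a≤j = trans (∑-cong (perms n) λ π → ≤-antisym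
      ([]-mono (through? (outside ∷ A) (j , π)) (through? A π) (proj₂ ∘ through-out⇒ {A = A} {j}))
      ([]-mono (through? A π) (through? (outside ∷ A) (j , π)) (through-out⇐ {A = A} {j} a≤j)))
    (sym (*-identityˡ _))
  ... | no a≰j = trans (∑-cong (perms n) λ π → []-no (through? (outside ∷ A) (j , π))
      (a≰j ∘ proj₁ ∘ through-out⇒ {A = A} {j}))
    (∑-zero (perms n))

-- Chains through a set with one or two prescribed steps

step? : ∀ {n} (x : Fin n) i (π : Perm n) → Dec (pos π x ≡ i)
step? x i π = pos π x ≟ i

pos-suc : ∀ {n} {j : Fin (suc n)} {π : Perm n} {x i} → pos (j , π) (suc x) ≡ i →
          toℕ j ≢ i × pos π x ≡ unbump (toℕ j) i
pos-suc {j = j} {π} {x} refl = bump-≢ (toℕ j) (pos π x) , sym (unbump-bump (toℕ j) (pos π x))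

unbump-inside : ∀ {j i a} → j < suc a → j ≢ i → i < suc a → unbump j i < a
unbump-inside {j} {i} {a} j<a j≢i i<a = subst (unbump j i <_) (unbump-< j<a)
  (bump-<⇒ j (subst (_< suc a) (sym (bump-unbump j i j≢i)) i<a))

unbump-outside : ∀ {j i a} → j < suc a → suc a ≤ i → unbump j i ≡ pred i
unbump-outside j<a a<i = unbump-< (<-≤-trans j<a a<i)

unbump-injective : ∀ {j i i'} → j ≢ i → j ≢ i' → unbump j i ≡ unbump j i' → i ≡ i'
unbump-injective {j} {i} {i'} j≢i j≢i' eq =
  trans (sym (bump-unbump j i j≢i)) (trans (cong (bump j) eq) (bump-unbump j i' j≢i'))

chains≤ : ∀ {n} (A : Subset n) → chains A ≤ ∣ A ∣ ! * (n ∸ ∣ A ∣) !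
chains≤ A = ≤-reflexive (chains-count A)

outside-factor : ∀ {n} (A : Subset n) c → (suc n ∸ ∣ A ∣) * (c * (n ∸ ∣ A ∣) !) ≡ c * (suc n ∸ ∣ A ∣) !
outside-factor {n} A c = begin
  (suc n ∸ a) * (c * (n ∸ a) !)    ≡⟨ x∙yz≈y∙xz (suc n ∸ a) c _ ⟩
  c * ((suc n ∸ a) * (n ∸ a) !)    ≡⟨ cong (λ r → c * (r * (n ∸ a) !)) (+-∸-assoc 1 (∣p∣≤n A)) ⟩
  c * suc (n ∸ a) !                ≡⟨ cong (λ r → c * r !) (+-∸-assoc 1 (∣p∣≤n A)) ⟨
  c * (suc n ∸ a) !                ∎
  where
  open ≡-Reasoning
  open import Data.Fin.Subset.Properties using (∣p∣≤n)
  open import Algebra.Properties.CommutativeSemigroup *-commutativeSemigroup using (x∙yz≈y∙xz)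
  a = ∣ A ∣

-- One of the `∣ A ∣` steps that fill A is taken by x; the other elements of A are free to share the
-- remaining ones.
cnt-inside : ∀ {n} (A : Subset n) {x i} → x ∈ A → i < ∣ A ∣ →
             cnt (λ π → through? A π ×-dec step? x i π) ≤ (∣ A ∣ ∸ 1) ! * (n ∸ ∣ A ∣) !
cnt-inside {suc n} (inside ∷ A) {zero} {i} here i<a = ≤-trans
  (cnt-split _ (λ j → toℕ j ≟ i) (λ _ → through? A) 1 _
    (λ {j} {π} (th , eq) → eq , proj₂ (through-in⇒ {A = A} {j} {π} th))
    (λ _ _ → chains≤ A) (#≡ (suc n) i))
  (≤-reflexive (*-identityˡ _))
cnt-inside {suc n} (inside ∷ A) {suc x} {i} (there x∈) i<a = ≤-trans
  (cnt-split _ (λ j → (toℕ j <? suc a) ×-dec ¬? (toℕ j ≟ i))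
    (λ j π → through? A π ×-dec step? x (unbump (toℕ j) i) π) a ((a ∸ 1) ! * (n ∸ a) !)
    (λ {j} {π} (th , eq) → let (j<a , th') = through-in⇒ {A = A} {j} {π} th
                               (j≢i , eq') = pos-suc {j = j} {π} {x} eq in (j<a , j≢i) , th' , eq')
    (λ j (j<a , j≢i) → cnt-inside A x∈ (unbump-inside j<a j≢i i<a))
    (≤-trans (#exclude _ (λ j → toℕ j <? suc a) (<-≤-trans i<a (s≤s (∣p∣≤n A))) id (λ { refl → i<a }))
             (≤-reflexive (cong (_∸ 1) (#< (suc n) (suc a) (s≤s (∣p∣≤n A)))))))
  (≤-trans (≤-reflexive (sym (*-assoc a ((a ∸ 1) !) _))) (*-monoˡ-≤ ((n ∸ a) !) (m*[m∸1]!≤m! a)))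
  where
  open import Data.Fin.Subset.Properties using (∣p∣≤n)
  a = ∣ A ∣
cnt-inside {suc n} (outside ∷ A) {suc x} {i} (there x∈) i<a = ≤-trans
  (cnt-split _ (λ j → a ≤? toℕ j) (λ j π → through? A π ×-dec step? x i π)
    (suc n ∸ a) ((a ∸ 1) ! * (n ∸ a) !)
    (λ {j} {π} (th , eq) → let (a≤j , th') = through-out⇒ {A = A} {j} {π} th in
      a≤j , th' , trans (proj₂ (pos-suc {j = j} {π} {x} eq)) (unbump-≥ (≤-trans (<⇒≤ i<a) a≤j)))
    (λ j _ → cnt-inside A x∈ i<a)
    (≤-reflexive (#≥ (suc n) a)))
  (≤-reflexive (outside-factor A ((a ∸ 1) !)))
  where a = ∣ A ∣

cnt-outside : ∀ {n} (A : Subset n) {x i} → ¬ x ∈ A → ∣ A ∣ ≤ i → i < n →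
              cnt (λ π → through? A π ×-dec step? x i π) ≤ ∣ A ∣ ! * (n ∸ ∣ A ∣ ∸ 1) !
cnt-outside {suc n} (inside ∷ A) {zero} x∉ = ⊥-elim (x∉ here)
cnt-outside {suc n} (outside ∷ A) {zero} {i} x∉ a≤i i<n = ≤-trans
  (cnt-split _ (λ j → toℕ j ≟ i) (λ _ → through? A) 1 _
    (λ {j} {π} (th , eq) → eq , proj₂ (through-out⇒ {A = A} {j} {π} th))
    (λ _ _ → chains≤ A) (#≡ (suc n) i))
  (≤-reflexive (trans (*-identityˡ _)
    (cong (λ r → ∣ A ∣ ! * (r ∸ 1) !) (sym (+-∸-assoc 1 (∣p∣≤n A))))))
  where open import Data.Fin.Subset.Properties using (∣p∣≤n)
cnt-outside {suc n} (inside ∷ A) {suc x} {suc i} x∉ (s≤s a≤i) (s≤s i<n) = ≤-trans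
  (cnt-split _ (λ j → toℕ j <? suc a) (λ j π → through? A π ×-dec step? x i π)
    (suc a) (a ! * (n ∸ a ∸ 1) !)
    (λ {j} {π} (th , eq) → let (j<a , th') = through-in⇒ {A = A} {j} {π} th in
      j<a , th' , trans (proj₂ (pos-suc {j = j} {π} {x} eq)) (unbump-outside j<a (s≤s a≤i)))
    (λ j _ → cnt-outside A (x∉ ∘ there) a≤i i<n)
    (≤-reflexive (#< (suc n) (suc a) (s≤s (∣p∣≤n A)))))
  (≤-reflexive (sym (*-assoc (suc a) (a !) _)))
  where
  open import Data.Fin.Subset.Properties using (∣p∣≤n)
  a = ∣ A ∣
cnt-outside {suc n} (outside ∷ A) {suc x} {i} x∉ a≤i i<n = ≤-trans
  (cnt-split _ (λ j → (a ≤? toℕ j) ×-dec ¬? (toℕ j ≟ i))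
    (λ j π → through? A π ×-dec step? x (unbump (toℕ j) i) π)
    (n ∸ a) (a ! * (n ∸ a ∸ 1) !)
    (λ {j} {π} (th , eq) → let (a≤j , th') = through-out⇒ {A = A} {j} {π} th
                               (j≢i , eq') = pos-suc {j = j} {π} {x} eq in (a≤j , j≢i) , th' , eq')
    (λ j (a≤j , j≢i) → cnt-outside A (x∉ ∘ there) (lower a≤j j≢i) (upper j j≢i))
    (≤-trans (#exclude _ (λ j → a ≤? toℕ j) i<n id (λ { refl → a≤i }))
             (≤-reflexive (trans (cong (_∸ 1) (#≥ (suc n) a)) (cong (_∸ 1) (+-∸-assoc 1 (∣p∣≤n A)))))))
  (≤-trans (≤-reflexive (x∙yz≈y∙xz (n ∸ a) (a !) _))
    (≤-trans (*-monoʳ-≤ (a !) (m*[m∸1]!≤m! (n ∸ a)))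
      (≤-reflexive (cong (λ r → a ! * (r ∸ 1) !) (sym (+-∸-assoc 1 (∣p∣≤n A)))))))
  where
  open import Data.Fin.Subset.Properties using (∣p∣≤n)
  open import Algebra.Properties.CommutativeSemigroup *-commutativeSemigroup using (x∙yz≈y∙xz)
  a = ∣ A ∣
  lower : ∀ {j} → a ≤ j → j ≢ i → a ≤ unbump j i
  lower {j} a≤j j≢i = ≮⇒≥ λ lt → <⇒≱ (subst (_< a) (bump-unbump j i j≢i)
    (bump-<⇐ j (subst (unbump j i <_) (sym (unbump-≥ a≤j)) lt))) a≤i
  upper : ∀ (j : Fin (suc n)) → toℕ j ≢ i → unbump (toℕ j) i < n
  upper j j≢i = unbump-inside (Fin.toℕ<n j) j≢i i<n

cnt-inside₂ : ∀ {n} (A : Subset n) {x x' i i'} → x ∈ A → x' ∈ A → x ≢ x' → i < ∣ A ∣ → i' < ∣ A ∣ → i ≢ i' →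
              cnt (λ π → through? A π ×-dec (step? x i π ×-dec step? x' i' π)) ≤ (∣ A ∣ ∸ 2) ! * (n ∸ ∣ A ∣) !
cnt-inside₂ {suc n} (_ ∷ A) {zero} {zero} _ _ x≢x' = ⊥-elim (x≢x' refl)
cnt-inside₂ {suc n} (inside ∷ A) {zero} {suc x'} {i} {i'} here (there x'∈) _ i<a i'<a i≢i' = ≤-trans
  (cnt-split _ (λ j → toℕ j ≟ i) (λ j π → through? A π ×-dec step? x' (unbump (toℕ j) i') π) 1
    ((∣ A ∣ ∸ 1) ! * (n ∸ ∣ A ∣) !)
    (λ {j} {π} (th , eq , eq') → eq , proj₂ (through-in⇒ {A = A} {j} {π} th) , proj₂ (pos-suc {j = j} {π} {x'} eq'))
    (λ { j refl → cnt-inside A x'∈ (unbump-inside i<a i≢i' i'<a) }) (#≡ (suc n) i))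
  (≤-reflexive (*-identityˡ _))
cnt-inside₂ {suc n} A@(inside ∷ _) {suc x} {zero} {i} {i'} (there x∈) here x≢x' i<a i'<a i≢i' = ≤-trans
  (∑-mono (perms (suc n)) λ π → []-mono (through? A π ×-dec (step? (suc x) i π ×-dec step? zero i' π))
    (through? A π ×-dec (step? zero i' π ×-dec step? (suc x) i π)) (λ (th , eq , eq') → th , eq' , eq))
  (cnt-inside₂ A here (there x∈) (x≢x' ∘ sym) i'<a i<a (i≢i' ∘ sym))
cnt-inside₂ {suc n} (inside ∷ A) {suc x} {suc x'} {i} {i'} (there x∈) (there x'∈) x≢x' i<a i'<a i≢i' = ≤-trans
  (cnt-split _ (λ j → ((toℕ j <? suc a) ×-dec ¬? (toℕ j ≟ i)) ×-dec ¬? (toℕ j ≟ i'))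
    (λ j π → through? A π ×-dec (step? x (unbump (toℕ j) i) π ×-dec step? x' (unbump (toℕ j) i') π))
    -- Of the a + 1 steps open to the first element, i and i' are already taken.
    (a ∸ 1) ((a ∸ 2) ! * (n ∸ a) !)
    (λ {j} {π} (th , eq , eq') →
      let (j<a , th') = through-in⇒ {A = A} {j} {π} th
          (j≢i , e) = pos-suc {j = j} {π} {x} eq
          (j≢i' , e') = pos-suc {j = j} {π} {x'} eq' in ((j<a , j≢i) , j≢i') , th' , e , e')
    (λ j ((j<a , j≢i) , j≢i') → cnt-inside₂ A x∈ x'∈ (x≢x' ∘ cong suc)
      (unbump-inside j<a j≢i i<a) (unbump-inside j<a j≢i' i'<a) (i≢i' ∘ unbump-injective j≢i j≢i'))
    (≤-trans (#exclude _ (λ j → (toℕ j <? suc a) ×-dec ¬? (toℕ j ≟ i)) (<-≤-trans i'<a (s≤s (∣p∣≤n A))) id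
                (λ { refl → i'<a , i≢i' ∘ sym }))
      (∸-monoˡ-≤ 1 (≤-trans (#exclude (λ j → (toℕ j <? suc a) ×-dec ¬? (toℕ j ≟ i)) (λ j → toℕ j <? suc a)
            (<-≤-trans i<a (s≤s (∣p∣≤n A))) id (λ { refl → i<a }))
             (≤-reflexive (cong (_∸ 1) (#< (suc n) (suc a) (s≤s (∣p∣≤n A)))))))))
  (≤-trans (≤-reflexive (sym (*-assoc (a ∸ 1) ((a ∸ 2) !) _)))
    (*-monoˡ-≤ ((n ∸ a) !) (subst (λ r → (a ∸ 1) * r ! ≤ (a ∸ 1) !) (∸-+-assoc a 1 1) (m*[m∸1]!≤m! (a ∸ 1)))))
  where
  open import Data.Fin.Subset.Properties using (∣p∣≤n)
  a = ∣ A ∣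
cnt-inside₂ {suc n} (outside ∷ A) {suc x} {suc x'} {i} {i'} (there x∈) (there x'∈) x≢x' i<a i'<a i≢i' = ≤-trans
  (cnt-split _ (λ j → a ≤? toℕ j) (λ j π → through? A π ×-dec (step? x i π ×-dec step? x' i' π))
    (suc n ∸ a) ((a ∸ 2) ! * (n ∸ a) !)
    (λ {j} {π} (th , eq , eq') → let (a≤j , th') = through-out⇒ {A = A} {j} {π} th in
      a≤j , th' , trans (proj₂ (pos-suc {j = j} {π} {x} eq)) (unbump-≥ (≤-trans (<⇒≤ i<a) a≤j))
               , trans (proj₂ (pos-suc {j = j} {π} {x'} eq')) (unbump-≥ (≤-trans (<⇒≤ i'<a) a≤j)))
    (λ j _ → cnt-inside₂ A x∈ x'∈ (x≢x' ∘ cong suc) i<a i'<a i≢i')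
    (≤-reflexive (#≥ (suc n) a)))
  (≤-reflexive (outside-factor A ((a ∸ 2) !)))
  where a = ∣ A ∣

-- On a random chain through A, x takes a given step below A with probability at most 1 / `∣ A ∣`,
-- hence at most 1 / q. The multiplied-out form avoids fractions.
step-inside : ∀ {n} (A : Subset n) {x i} q → x ∈ A → i < ∣ A ∣ → q ≤ ∣ A ∣ →
              q * cnt (λ π → through? A π ×-dec step? x i π) ≤ chains A
step-inside {n} A {x} {i} q x∈ i<a q≤a = begin
  q * cnt (λ π → through? A π ×-dec step? x i π)   ≤⟨ *-mono-≤ q≤a (cnt-inside A x∈ i<a) ⟩
  ∣ A ∣ * ((∣ A ∣ ∸ 1) ! * (n ∸ ∣ A ∣) !)          ≡⟨ *-assoc ∣ A ∣ _ _ ⟨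
  ∣ A ∣ * (∣ A ∣ ∸ 1) ! * (n ∸ ∣ A ∣) !            ≤⟨ *-monoˡ-≤ ((n ∸ ∣ A ∣) !) (m*[m∸1]!≤m! ∣ A ∣) ⟩
  ∣ A ∣ ! * (n ∸ ∣ A ∣) !                          ≡⟨ chains-count A ⟨
  chains A                                         ∎
  where open ≤-Reasoning

step-outside : ∀ {n} (A : Subset n) {x i} q → ¬ x ∈ A → ∣ A ∣ ≤ i → i < n → q ≤ n ∸ ∣ A ∣ →
               q * cnt (λ π → through? A π ×-dec step? x i π) ≤ chains A
step-outside {n} A {x} {i} q x∉ a≤i i<n q≤ = begin
  q * cnt (λ π → through? A π ×-dec step? x i π)   ≤⟨ *-mono-≤ q≤ (cnt-outside A x∉ a≤i i<n) ⟩
  (n ∸ ∣ A ∣) * (∣ A ∣ ! * (n ∸ ∣ A ∣ ∸ 1) !)      ≡⟨ x∙yz≈y∙xz (n ∸ ∣ A ∣) (∣ A ∣ !) _ ⟩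
  ∣ A ∣ ! * ((n ∸ ∣ A ∣) * (n ∸ ∣ A ∣ ∸ 1) !)      ≤⟨ *-monoʳ-≤ (∣ A ∣ !) (m*[m∸1]!≤m! (n ∸ ∣ A ∣)) ⟩
  ∣ A ∣ ! * (n ∸ ∣ A ∣) !                          ≡⟨ chains-count A ⟨
  chains A                                         ∎
  where
  open ≤-Reasoning
  open import Algebra.Properties.CommutativeSemigroup *-commutativeSemigroup using (x∙yz≈y∙xz)

step-inside₂ : ∀ {n} (A : Subset n) {x x' i i'} q → x ∈ A → x' ∈ A → x ≢ x' → i < ∣ A ∣ → i' < ∣ A ∣ → i ≢ i' →
               q < ∣ A ∣ →
               q * q * cnt (λ π → through? A π ×-dec (step? x i π ×-dec step? x' i' π)) ≤ chains A
step-inside₂ {n} A {x} {x'} {i} {i'} q x∈ x'∈ x≢x' i<a i'<a i≢i' q<a = begin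
  q * q * cnt (λ π → through? A π ×-dec (step? x i π ×-dec step? x' i' π))
                                                   -- The strict inequality yields q ≤ a for the
                                                   -- first step and q ≤ a - 1 for the second.
                                                   ≤⟨ *-mono-≤ (*-mono-≤ (<⇒≤ q<a) (∸-monoˡ-≤ 1 q<a))
                                                         (cnt-inside₂ A x∈ x'∈ x≢x' i<a i'<a i≢i') ⟩
  a * (a ∸ 1) * ((a ∸ 2) ! * r !)                  ≡⟨ *-assoc (a * (a ∸ 1)) ((a ∸ 2) !) (r !) ⟨
  a * (a ∸ 1) * (a ∸ 2) ! * r !                    ≡⟨ cong (_* r !) (*-assoc a (a ∸ 1) ((a ∸ 2) !)) ⟩
  a * ((a ∸ 1) * (a ∸ 2) !) * r !                  ≤⟨ *-monoˡ-≤ (r !)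
        (*-monoʳ-≤ a (subst (λ b → (a ∸ 1) * b ! ≤ (a ∸ 1) !) (∸-+-assoc a 1 1) (m*[m∸1]!≤m! (a ∸ 1)))) ⟩
  a * (a ∸ 1) ! * r !                              ≤⟨ *-monoˡ-≤ (r !) (m*[m∸1]!≤m! a) ⟩
  a ! * r !                                        ≡⟨ chains-count A ⟨
  chains A                                         ∎
  where
  open ≤-Reasoning
  a = ∣ A ∣
  r = n ∸ ∣ A ∣

-- The width of the middle layers

m<2^m : ∀ m → m < 2 ^ m
m<2^m zero = s≤s z≤n
m<2^m (suc m) = ≤-trans (+-mono-≤ (≤-trans (s≤s z≤n) (m<2^m m)) (m<2^m m))
                        (≤-reflexive (cong (2 ^ m +_) (sym (+-identityʳ (2 ^ m)))))

-- Bernoulli's inequality (1 + 1/w)^k ≥ 1 + k/w with denominators cleared.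
bernoulli : ∀ w k → w ^ k * (w + k) ≤ w * suc w ^ k
bernoulli w zero = ≤-reflexive (trans (+-identityʳ (w + 0)) (trans (+-identityʳ w) (sym (*-identityʳ w))))
bernoulli w (suc k) = begin
  w * w ^ k * (w + suc k)      ≤⟨ m≤m+n _ (k * w ^ k) ⟩
  w * w ^ k * (w + suc k) + k * w ^ k ≡⟨ expand w k (w ^ k) ⟩
  suc w * (w ^ k * (w + k))    ≤⟨ *-monoʳ-≤ (suc w) (bernoulli w k) ⟩
  suc w * (w * suc w ^ k)      ≡⟨ swap (suc w) w (suc w ^ k) ⟩
  w * (suc w * suc w ^ k)      ∎
  where
  open ≤-Reasoning
  expand : ∀ w k p → w * p * (w + suc k) + k * p ≡ suc w * (p * (w + k))
  expand = solve-∀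
  swap : ∀ a b c → a * (b * c) ≡ b * (a * c)
  swap = solve-∀

-- (1 + 1/w)^w ≥ 2 by Bernoulli, and the surplus exponent e - w only helps.
doubling : ∀ {w e} → 1 ≤ w → w ≤ e → 2 * w ^ e ≤ suc w ^ e
doubling {w@(suc _)} {e} _ w≤e = begin
  2 * w ^ e                   ≡⟨ cong (λ r → 2 * w ^ r) (m+[n∸m]≡n w≤e) ⟨
  2 * w ^ (w + (e ∸ w))       ≡⟨ cong (2 *_) (^-distribˡ-+-* w w (e ∸ w)) ⟩
  2 * (w ^ w * w ^ (e ∸ w))   ≡⟨ *-assoc 2 (w ^ w) _ ⟨
  2 * w ^ w * w ^ (e ∸ w)     ≤⟨ *-mono-≤ twice (^-monoˡ-≤ (e ∸ w) (n≤1+n w)) ⟩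
  suc w ^ w * suc w ^ (e ∸ w) ≡⟨ ^-distribˡ-+-* (suc w) w (e ∸ w) ⟨
  suc w ^ (w + (e ∸ w))       ≡⟨ cong (suc w ^_) (m+[n∸m]≡n w≤e) ⟩
  suc w ^ e                   ∎
  where
  open ≤-Reasoning
  rearrange : ∀ w p → w * (2 * p) ≡ p * (w + w)
  rearrange = solve-∀
  twice : 2 * w ^ w ≤ suc w ^ w
  twice = *-cancelˡ-≤ w (≤-trans (≤-reflexive (rearrange w (w ^ w))) (bernoulli w w))

-- Raising the base from r to r + x in unit steps doubles the e-th power each time, since every
-- intermediate base is at most e.
power-gap : ∀ r x e → 1 ≤ r → r + x ≤ e → 2 ^ x * r ^ e ≤ (r + x) ^ e
power-gap r zero e _ _ = ≤-reflexive (trans (*-identityˡ (r ^ e)) (cong (_^ e) (sym (+-identityʳ r))))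
power-gap r (suc x) e 1≤r r+x≤e = begin
  2 * 2 ^ x * r ^ e    ≡⟨ *-assoc 2 (2 ^ x) _ ⟩
  2 * (2 ^ x * r ^ e)  ≤⟨ *-monoʳ-≤ 2 (power-gap r x e 1≤r (<⇒≤ r+x<e)) ⟩
  2 * (r + x) ^ e      ≤⟨ doubling (≤-trans 1≤r (m≤m+n r x)) (<⇒≤ r+x<e) ⟩
  suc (r + x) ^ e      ≡⟨ cong (_^ e) (+-suc r x) ⟨
  (r + suc x) ^ e      ∎
  where
  open ≤-Reasoning
  r+x<e : r + x < e
  r+x<e = subst (_≤ e) (+-suc r x) r+x≤e

-- In the encoding of the middle layers (m/(m - x))^m plays the part of e^x. By `power-gap` it is at
-- least 2^x, and comparing exponents of 2 bounds x; passing from e to 2 costs a harmless constant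
-- factor.
btilde-square : ∀ {n} (F : Subset n) L → n ≤ 2 ^ L → InBtilde n F →
                ∣ 2 * ∣ F ∣ - n ∣ * ∣ 2 * ∣ F ∣ - n ∣ ≤ L * (16 * n)
btilde-square F L _ (inj₁ d≡0) rewrite d≡0 = z≤n
btilde-square {n} F L n≤2^L (inj₂ (m , x<m , le)) = ≮⇒≥ λ lt → <⇒≱ (^-monoʳ-< 2 (s≤s (s≤s z≤n)) lt) bound
  where
  open ≤-Reasoning
  x = ∣ 2 * ∣ F ∣ - n ∣ * ∣ 2 * ∣ F ∣ - n ∣
  r = m ∸ x
  1≤r : 1 ≤ r
  1≤r = m<n⇒0<n∸m x<m
  r+x≡m : r + x ≡ m
  r+x≡m = m∸n+n≡m (<⇒≤ x<m)
  instance
    nz : NonZero (r ^ m)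
    nz = >-nonZero (m^n>0 r {{>-nonZero 1≤r}} m)
  bound : 2 ^ x ≤ 2 ^ (L * (16 * n))
  bound = *-cancelʳ-≤ (2 ^ x) (2 ^ (L * (16 * n))) (r ^ m) (begin
    2 ^ x * r ^ m              ≤⟨ power-gap r x m 1≤r (≤-reflexive r+x≡m) ⟩
    (r + x) ^ m                ≡⟨ cong (_^ m) r+x≡m ⟩
    m ^ m                      ≤⟨ le ⟩
    n ^ (16 * n) * r ^ m       ≤⟨ *-monoˡ-≤ (r ^ m) (^-monoˡ-≤ (16 * n) n≤2^L) ⟩
    (2 ^ L) ^ (16 * n) * r ^ m ≡⟨ cong (_* r ^ m) (^-*-assoc 2 L (16 * n)) ⟩
    2 ^ (L * (16 * n)) * r ^ m ∎)

find-crossing : ∀ (f : ℕ → ℕ) v w n → f v ≤ n → n < f (suc (v + w)) → ∃ λ u → v ≤ u × f u ≤ n × n < f (suc u)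
find-crossing f v zero n lower upper = v , ≤-refl , lower , subst (λ u → n < f (suc u)) (+-identityʳ v) upper
find-crossing f v (suc w) n lower upper with n <? f (suc (v + w))
... | yes upper' = find-crossing f v w n lower upper'
... | no ¬upper = v + suc w , m≤m+n v _ , subst (λ u → f u ≤ n) (sym (+-suc v w)) (≮⇒≥ ¬upper) , upper

linear≤power : ∀ a c j → (3 + a) * c ≤ 2 ^ a → (3 + (a + j)) * c ≤ 2 ^ (a + j)
linear≤power a c zero base = subst (λ b → (3 + b) * c ≤ 2 ^ b) (sym (+-identityʳ a)) base
linear≤power a c (suc j) base = begin
  (3 + (a + suc j)) * c          ≡⟨ cong (λ b → (3 + b) * c) (+-suc a j) ⟩
  suc (3 + b) * c                ≤⟨ *-monoˡ-≤ c (s≤s (m≤n+m (3 + b) (2 + b))) ⟩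
  (3 + b + (3 + b)) * c          ≡⟨ *-distribʳ-+ c (3 + b) (3 + b) ⟩
  (3 + b) * c + (3 + b) * c      ≤⟨ +-mono-≤ (linear≤power a c j base) (linear≤power a c j base) ⟩
  2 ^ b + 2 ^ b                  ≡⟨ cong (2 ^ b +_) (+-identityʳ (2 ^ b)) ⟨
  2 ^ suc b                      ≡⟨ cong (2 ^_) (+-suc a j) ⟨
  2 ^ (a + suc j)                ∎
  where
  open ≤-Reasoning
  b = a + j

shift-exponent : ∀ x y a b → x + a ≡ y + b → 2 ^ x * 2 ^ a ≡ 2 ^ y * 2 ^ b
shift-exponent x y a b eq = trans (sym (^-distribˡ-+-* 2 x a)) (trans (cong (2 ^_) eq) (^-distribˡ-+-* 2 y b))

-- Used with p = 2^u, N = 2^(5(u + 3)), W = 2^(5u + 12) and S = (4 · 2^u)^3. After cancellation of W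
-- only 640 (u + 3) ≤ 2^u is left to check, where 640 = 5 · 2^7.
rescale : ∀ b p N W S → 2 ^ 4 * N ≡ 2 ^ 7 * W → p * W ≡ S * S → b * 640 ≤ p → b * 5 * (16 * N) ≤ S * S
rescale b p N W S eq₁ eq₂ le = begin
  b * 5 * (16 * N)   ≡⟨ cong (b * 5 *_) eq₁ ⟩
  b * 5 * (128 * W)  ≡⟨ *-assoc (b * 5) 128 W ⟨
  b * 5 * 128 * W    ≡⟨ cong (_* W) (*-assoc b 5 128) ⟩
  b * 640 * W        ≤⟨ *-monoˡ-≤ W le ⟩
  p * W              ≡⟨ eq₂ ⟩
  S * S              ∎
  where open ≤-Reasoning

four-fold : ∀ u → 2 ^ (2 + u) ≡ 4 * 2 ^ u
four-fold u = ^-distribˡ-+-* 2 2 u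

exponent₁ : ∀ u → 4 + (3 + u) * 5 ≡ 7 + (12 + u * 5)
exponent₁ = solve-∀

exponent₂ : ∀ u → u + (12 + u * 5) ≡ (2 + u) * 3 + (2 + u) * 3
exponent₂ = solve-∀

-- At scale z the family lives on layers within (4z)³ of the middle one, while n ≥ (4z)⁵:
-- 16 n log₂ n < 16 · (8z)⁵ · 5(u + 3) ≤ (4z)⁶ for z = 2 ^ u.
scaled : ∀ K u n → K ≤ u → (3 + u) * 640 ≤ 2 ^ u → 2 ^ ((2 + u) * 5) ≤ n → n < 2 ^ ((3 + u) * 5) →
         ∃ λ z → K ≤ z × (4 * z) ^ 5 ≤ n ×
         (∀ (F : Subset n) → InBtilde n F → ∣ 2 * ∣ F ∣ - n ∣ ≤ (4 * z) ^ 3)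
scaled K u n K≤u linear lower upper = 2 ^ u
    , ≤-trans (<⇒≤ (m<2^m K)) (^-monoʳ-≤ 2 K≤u)
    , subst (_≤ n) (trans (sym (^-*-assoc 2 (2 + u) 5)) (cong (_^ 5) (four-fold u))) lower
    , λ F F∈ → ≮⇒≥ λ lt → <⇒≱ (*-mono-< lt lt) (≤-trans (btilde-square F ((3 + u) * 5) (<⇒≤ upper) F∈) square)
    where
    quadruple : 2 ^ ((2 + u) * 3) ≡ (4 * 2 ^ u) ^ 3
    quadruple = trans (sym (^-*-assoc 2 (2 + u) 3)) (cong (_^ 3) (four-fold u))
    square : (3 + u) * 5 * (16 * n) ≤ (4 * 2 ^ u) ^ 3 * (4 * 2 ^ u) ^ 3
    square = ≤-trans (*-monoʳ-≤ ((3 + u) * 5) (*-monoʳ-≤ 16 (<⇒≤ upper)))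
      (rescale (3 + u) (2 ^ u) (2 ^ ((3 + u) * 5)) (2 ^ (12 + u * 5)) ((4 * 2 ^ u) ^ 3)
        (shift-exponent 4 7 ((3 + u) * 5) (12 + u * 5) (exponent₁ u))
        (trans (shift-exponent u ((2 + u) * 3) (12 + u * 5) ((2 + u) * 3) (exponent₂ u)) (cong₂ _*_ quadruple quadruple))
        linear)

threshold : ℕ → ℕ
threshold u = 2 ^ ((2 + u) * 5)

<threshold : ∀ v n → n < threshold (suc (v + n))
<threshold v n = <-≤-trans (m<2^m n) (^-monoʳ-≤ 2 (≤-trans (m≤n+m n (3 + v)) (m≤m*n (3 + v + n) 5)))

scale : ∀ K → Σ ℕ λ n₀ → ∀ n → n₀ ≤ n → ∃ λ z → K ≤ z × (4 * z) ^ 5 ≤ n ×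
        (∀ (F : Subset n) → InBtilde n F → ∣ 2 * ∣ F ∣ - n ∣ ≤ (4 * z) ^ 3)
-- 14 is the first u with 640 (u + 3) ≤ 2^u: there it reads 10880 ≤ 16384.
scale K = threshold (14 + K) , λ n n₀≤n → at-crossing n (find-crossing threshold (14 + K) n n n₀≤n (<threshold (14 + K) n))
  where
  at-crossing : ∀ n → (∃ λ u → 14 + K ≤ u × threshold u ≤ n × n < threshold (suc u)) →
                ∃ λ z → K ≤ z × (4 * z) ^ 5 ≤ n ×
                (∀ (F : Subset n) → InBtilde n F → ∣ 2 * ∣ F ∣ - n ∣ ≤ (4 * z) ^ 3)
  at-crossing n (u , v≤u , lower , upper) = scaled K u n (≤-trans (m≤n+m K 14) v≤u)
    (subst (λ w → (3 + w) * 640 ≤ 2 ^ w) (m+[n∸m]≡n (≤-trans (m≤m+n 14 K) v≤u))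
          (linear≤power 14 640 (u ∸ 14) (≤ᵇ⇒≤ 10880 16384 tt)))
    lower upper

-- s bounds the distance from lo to H, and 1 / q will bound the probability of a prescribed step.
-- Divided by q², `sparse` says that the loss s/q at sets of the family and the loss s³/q² at sets
-- of size H together stay below 1 / K.
record Layers (n K : ℕ) : Set where
  field
    lo H s q : ℕ
    sizes : ∀ (F : Subset n) → InBtilde n F → lo ≤ ∣ F ∣ × 2 + ∣ F ∣ ≤ H
    lo≤H : lo ≤ H
    H≤lo+s : H ≤ lo + s
    q≤lo : q ≤ lo
    q+H≤n : q + H ≤ n
    sparse : K * (q * s + s * (s * s)) < q * q

half-cancel : ∀ {a b} → a + a ≤ b → a ≤ ⌊ b /2⌋
half-cancel {a} {b} le = subst (_≤ ⌊ b /2⌋) (sym (n≡⌊n+n/2⌋ a)) (⌊n/2⌋-mono le)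

half-+ : ∀ m d → ⌊ m + (d + d) /2⌋ ≡ ⌊ m /2⌋ + d
half-+ m zero = trans (cong ⌊_/2⌋ (+-identityʳ m)) (sym (+-identityʳ _))
half-+ m (suc d) = trans (cong ⌊_/2⌋ (shift m d)) (trans (cong suc (half-+ m d)) (sym (+-suc _ d)))
  where
  shift : ∀ m d → m + (suc d + suc d) ≡ suc (suc (m + (d + d)))
  shift = solve-∀

halves≤ : ∀ m → ⌊ m /2⌋ + ⌊ m /2⌋ ≤ m
halves≤ m = ≤-trans (+-monoʳ-≤ ⌊ m /2⌋ (⌊n/2⌋≤⌈n/2⌉ m)) (≤-reflexive (⌊n/2⌋+⌈n/2⌉≡n m))

-- With y = 4z, the half-width is D = y³ and q = z y⁴ is a quarter of y⁵ ≤ n. As s = D + 2 ≤ 2D, the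
-- products q s and s³ are at most z y⁸ and 32 z y⁸, while q² is z times z y⁸; hence the demand z >
-- 33 K.
layers : ∀ {n K z} → 1 + 33 * K ≤ z → (4 * z) ^ 5 ≤ n →
         (∀ (F : Subset n) → InBtilde n F → ∣ 2 * ∣ F ∣ - n ∣ ≤ (4 * z) ^ 3) → Layers n K
layers {n} {K} {z} K<z y⁵≤n near = record
  { lo = lo ; H = H ; s = D + 2 ; q = q
  ; sizes = λ F F∈ → lo≤ F (near F F∈) , s≤s (s≤s (half-cancel (a≤ F (near F F∈))))
  ; lo≤H = ≤-trans (⌊n/2⌋-mono (≤-trans (m∸n≤m n D) (m≤m+n n D))) (m≤n+m ⌊ n + D /2⌋ 2)
  ; H≤lo+s = H≤
  ; q≤lo = half-cancel q≤
  ; q+H≤n = half (begin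
      (q + H) + (q + H)                 ≡⟨ sum₁ q ⌊ n + D /2⌋ ⟩
      (q + q + 4) + (⌊ n + D /2⌋ + ⌊ n + D /2⌋) ≤⟨ +-monoʳ-≤ (q + q + 4) (halves≤ (n + D)) ⟩
      (q + q + 4) + (n + D)             ≡⟨ sum₂ q n D ⟩
      (q + q + (D + 4)) + n             ≤⟨ +-monoˡ-≤ n q+q+D+4≤n ⟩
      n + n                             ∎)
  ; sparse = sparse }
  where
  open ≤-Reasoning
  y D q lo H : ℕ
  y = 4 * z
  D = y ^ 3
  q = z * y ^ 4
  lo = ⌊ n ∸ D /2⌋
  H = 2 + ⌊ n + D /2⌋
  1≤z : 1 ≤ z
  1≤z = ≤-trans (s≤s z≤n) K<z
  4≤y : 4 ≤ y
  4≤y = *-monoʳ-≤ 4 1≤z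
  1≤D : 1 ≤ D
  1≤D = ^-monoˡ-≤ 3 (≤-trans (s≤s z≤n) 4≤y)
  sum₁ : ∀ q h → (q + (2 + h)) + (q + (2 + h)) ≡ (q + q + 4) + (h + h)
  sum₁ = solve-∀
  sum₂ : ∀ q n D → (q + q + 4) + (n + D) ≡ (q + q + (D + 4)) + n
  sum₂ = solve-∀
  half : ∀ {a b} → a + a ≤ b + b → a ≤ b
  half {a} {b} le = subst (a ≤_) (sym (n≡⌊n+n/2⌋ b)) (half-cancel le)
  D+4≤q+q : D + 4 ≤ q + q
  D+4≤q+q = begin
    D + 4             ≤⟨ +-monoʳ-≤ D (≤-trans 4≤y (m≤m*n y D {{>-nonZero 1≤D}})) ⟩
    D + y * D         ≤⟨ +-monoˡ-≤ (y * D) (m≤n*m D y {{>-nonZero (≤-trans (s≤s z≤n) 4≤y)}}) ⟩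
    y ^ 4 + y ^ 4     ≤⟨ +-mono-≤ (m≤n*m (y ^ 4) z {{>-nonZero 1≤z}}) (m≤n*m (y ^ 4) z {{>-nonZero 1≤z}}) ⟩
    q + q             ∎
  four-q : ∀ z Y → (z * Y + z * Y) + (z * Y + z * Y) ≡ 4 * z * Y
  four-q = solve-∀
  q+q+D+4≤n : q + q + (D + 4) ≤ n
  q+q+D+4≤n = ≤-trans (+-monoʳ-≤ (q + q) D+4≤q+q) (≤-trans (≤-reflexive (four-q z (y ^ 4))) y⁵≤n)
  q≤ : q + q ≤ n ∸ D
  q≤ = m+n≤o⇒m≤o∸n (q + q) (≤-trans (+-monoʳ-≤ (q + q) (m≤m+n D 4)) q+q+D+4≤n)
  twice : ∀ a → 2 * a ≡ a + a
  twice = solve-∀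
  a≤ : ∀ F → ∣ 2 * ∣ F ∣ - n ∣ ≤ D → ∣ F ∣ + ∣ F ∣ ≤ n + D
  a≤ F le = subst (_≤ n + D) (twice ∣ F ∣) (≤-trans (m≤n+∣m-n∣ (2 * ∣ F ∣) n) (+-monoʳ-≤ n le))
  lo≤ : ∀ F → ∣ 2 * ∣ F ∣ - n ∣ ≤ D → lo ≤ ∣ F ∣
  lo≤ F le = half (≤-trans (halves≤ (n ∸ D)) (≤-trans (∸-monoˡ-≤ D
    (≤-trans (m≤n+∣m-n∣ n (2 * ∣ F ∣)) (+-mono-≤ (≤-reflexive (twice ∣ F ∣))
      (subst (_≤ D) (∣-∣-comm (2 * ∣ F ∣) n) le)))) (≤-reflexive (m+n∸n≡m _ D))))
  H≤ : H ≤ lo + (D + 2)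
  H≤ = begin
    2 + ⌊ n + D /2⌋              ≤⟨ +-monoʳ-≤ 2 (⌊n/2⌋-mono (+-monoˡ-≤ D (m≤n+m∸n n D))) ⟩
    2 + ⌊ (D + (n ∸ D)) + D /2⌋  ≡⟨ cong (λ r → 2 + ⌊ r /2⌋) (rotate D (n ∸ D)) ⟩
    2 + ⌊ (n ∸ D) + (D + D) /2⌋  ≡⟨ cong (2 +_) (half-+ (n ∸ D) D) ⟩
    2 + (lo + D)                 ≡⟨ last lo D ⟩
    lo + (D + 2)                 ∎
    where
    rotate : ∀ D m → (D + m) + D ≡ m + (D + D)
    rotate = solve-∀
    last : ∀ l D → 2 + (l + D) ≡ l + (D + 2)
    last = solve-∀
  sparse : K * (q * (D + 2) + (D + 2) * ((D + 2) * (D + 2))) < q * q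
  sparse = begin-strict
    K * (q * (D + 2) + (D + 2) * ((D + 2) * (D + 2)))
                               ≤⟨ *-monoʳ-≤ K (+-mono-≤ (*-monoʳ-≤ q D+2≤) (*-mono-≤ D+2≤ (*-mono-≤ D+2≤ D+2≤))) ⟩
    K * (q * (2 * D) + 2 * D * (2 * D * (2 * D)))
                               ≤⟨ *-monoʳ-≤ K (+-mono-≤ first second) ⟩
    K * (E + 32 * E)           ≡⟨ collect K E ⟩
    33 * K * E                 <⟨ *-monoˡ-< E {{>-nonZero 1≤E}} K<z ⟩
    z * E                      ≡⟨ square z y D ⟩
    q * q                      ∎
    where
    E : ℕ
    E = z * (y * y * (D * D))
    1≤y : 1 ≤ y
    1≤y = ≤-trans (s≤s z≤n) 4≤y
    1≤E : 1 ≤ E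
    1≤E = *-mono-≤ 1≤z (*-mono-≤ (*-mono-≤ 1≤y 1≤y) (*-mono-≤ 1≤D 1≤D))
    D+2≤ : D + 2 ≤ 2 * D
    D+2≤ = ≤-trans (+-monoʳ-≤ D (≤-trans (≤-trans (s≤s (s≤s z≤n)) 4≤y)
          (m≤m*n y (y * (y * 1)) {{>-nonZero (*-mono-≤ 1≤y (*-mono-≤ 1≤y (≤-refl {1})))}})))
                   (≤-reflexive (sym (twice D)))
    collect : ∀ K E → K * (E + 32 * E) ≡ 33 * K * E
    collect = solve-∀
    square : ∀ z y D → z * (z * (y * y * (D * D))) ≡ z * (y * D) * (z * (y * D))
    square = solve-∀
    first : q * (2 * D) ≤ E
    first = ≤-trans (≤-reflexive (shuffle z y D))
          (*-monoʳ-≤ z (*-monoˡ-≤ (D * D) (*-monoˡ-≤ y (≤-trans (s≤s (s≤s z≤n)) 4≤y))))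
      where
      shuffle : ∀ z y D → z * (y * D) * (2 * D) ≡ z * (2 * y * (D * D))
      shuffle = solve-∀
    second : 2 * D * (2 * D * (2 * D)) ≤ 32 * E
    second = ≤-reflexive (shuffle z y D)
      where
      shuffle : ∀ z y D → 2 * (4 * z * (y * (y * 1))) * (2 * D * (2 * D)) ≡ 32 * (z * (y * y * (D * D)))
      shuffle = solve-∀

-- Binomial coefficients, pruning and thinning

binomial-product : ∀ {n k} → k ≤ n → (n C k) * (k ! * (n ∸ k) !) ≡ n !
binomial-product {n} {k} k≤n = trans (cong (_* (k ! * (n ∸ k) !)) (nCk≡n!/k![n-k]! k≤n))
  (m/n*n≡m {{k !* (n ∸ k) !≢0}} (k![n∸k]!∣n! k≤n))

-- Compares (a + d)! / a! with (b + d)! / b! factor by factor.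
balance : ∀ a b d → a ≤ b → (a + d) ! * b ! ≤ a ! * (b + d) !
balance a b zero _ = ≤-reflexive (cong₂ (λ x y → x ! * y !) (+-identityʳ a) (sym (+-identityʳ b)))
balance a b (suc d) a≤b = begin
  (a + suc d) ! * b !            ≡⟨ cong (λ x → x ! * b !) (+-suc a d) ⟩
  suc (a + d) * (a + d) ! * b !  ≡⟨ *-assoc (suc (a + d)) ((a + d) !) (b !) ⟩
  suc (a + d) * ((a + d) ! * b !) ≤⟨ *-mono-≤ (s≤s (+-monoˡ-≤ d a≤b)) (balance a b d a≤b) ⟩
  suc (b + d) * (a ! * (b + d) !) ≡⟨ x∙yz≈y∙xz (suc (b + d)) (a !) _ ⟩
  a ! * suc (b + d) !            ≡⟨ cong (λ x → a ! * x !) (+-suc b d) ⟨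
  a ! * (b + suc d) !            ∎
  where
  open ≤-Reasoning
  open import Algebra.Properties.CommutativeSemigroup *-commutativeSemigroup using (x∙yz≈y∙xz)

-- `balance` moves a towards the middle; above the middle it is applied with a and n - a exchanged.
-- In terms of chains, sets of middle size lie on the fewest.
middle-layer : ∀ {n a} → a ≤ n → (n / 2) ! * (n ∸ n / 2) ! ≤ a ! * (n ∸ a) !
middle-layer {n} {a} a≤n with a ≤? n / 2
... | yes a≤h = subst₂ (λ x y → x ! * (n ∸ h) ! ≤ a ! * y !) (m+[n∸m]≡n a≤h) rest
                  (balance a (n ∸ h) (h ∸ a) (≤-trans a≤h h≤n∸h))
  where
  h = n / 2
  h+h≤n : h + h ≤ n
  h+h≤n = subst (_≤ n) (trans (*-comm h 2) (cong (h +_) (+-identityʳ h))) (m/n*n≤m n 2)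
  h≤n∸h : h ≤ n ∸ h
  h≤n∸h = m+n≤o⇒m≤o∸n h h+h≤n
  rest : n ∸ h + (h ∸ a) ≡ n ∸ a
  rest = trans (sym (+-∸-assoc (n ∸ h) a≤h)) (cong (_∸ a) (m∸n+n≡m (m+n≤o⇒m≤o h h+h≤n)))
... | no a≰h = subst₂ _≤_ (trans (cong (λ x → x ! * h !) lower) (*-comm ((n ∸ h) !) (h !)))
                          (trans (cong (λ x → (n ∸ a) ! * x !) (m+[n∸m]≡n (<⇒≤ h<a))) (*-comm ((n ∸ a) !) (a !)))
                          (balance (n ∸ a) h (a ∸ h) n∸a≤h)
  where
  h = n / 2
  h<a : h < a
  h<a = ≰⇒> a≰h
  n<[1+h]*2 : n < suc h * 2
  n<[1+h]*2 = subst (_< suc h * 2) (sym (m≡m%n+[m/n]*n n 2)) (+-monoˡ-< (h * 2) (m%n<n n 2))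
  n<2+2h : n < suc h + suc h
  n<2+2h = subst (n <_) (cong (suc h +_) (+-identityʳ (suc h))) (subst (n <_) (*-comm (suc h) 2) n<[1+h]*2)
  n∸a≤h : n ∸ a ≤ h
  n∸a≤h = ≤-trans (∸-monoʳ-≤ n h<a) (≤-trans (∸-monoˡ-≤ (suc h) (≤-pred n<2+2h)) (≤-reflexive (m+n∸n≡m h (suc h))))
  lower : n ∸ a + (a ∸ h) ≡ n ∸ h
  lower = trans (sym (+-∸-assoc (n ∸ a) (<⇒≤ h<a))) (cong (_∸ h) (m∸n+n≡m a≤n))

middle≤chains : ∀ {n} (A : Subset n) → (n / 2) ! * (n ∸ n / 2) ! ≤ chains A
middle≤chains {n} A = subst ((n / 2) ! * (n ∸ n / 2) ! ≤_) (sym (chains-count A)) (middle-layer (∣p∣≤n A))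
  where open import Data.Fin.Subset.Properties using (∣p∣≤n)

chains≤n! : ∀ {n} (A : Subset n) → chains A ≤ n !
chains≤n! {n} A = ≤-trans (∑-mono (perms n) λ π → []≤1 (through? A π))
                          (≤-reflexive (trans (∑-length (perms n)) (length-perms n)))

∑-filter≤ : ∀ {A : Set} {P : A → Set} (P? : ∀ x → Dec (P x)) (xs : List A) f → ∑ (filter P? xs) f ≤ ∑ xs f
∑-filter≤ P? [] f = z≤n
∑-filter≤ P? (x ∷ xs) f with P? x
... | yes _ = +-monoʳ-≤ (f x) (∑-filter≤ P? xs f)
... | no _ = ≤-trans (∑-filter≤ P? xs f) (m≤n+m _ (f x))

length-filter : ∀ {A : Set} {P : A → Set} (P? : ∀ x → Dec (P x)) (xs : List A) →
                length (filter P? xs) ≡ ∑ xs (λ x → [ P? x ])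
length-filter P? [] = refl
length-filter P? (x ∷ xs) with P? x
... | yes _ = cong suc (length-filter P? xs)
... | no _ = length-filter P? xs

length-split : ∀ {A : Set} {P : A → Set} (P? : ∀ x → Dec (P x)) (xs : List A) →
               length xs ≡ ∑ xs (λ x → [ P? x ]) + length (filter (¬? ∘ P?) xs)
length-split P? [] = refl
length-split P? (x ∷ xs) with P? x
... | yes _ = cong suc (length-split P? xs)
... | no _ = trans (cong suc (length-split P? xs)) (sym (+-suc _ _))

∑-unique : ∀ {A : Set} {P : A → Set} (P? : ∀ x → Dec (P x)) {Q : Set} (Q? : Dec Q) {xs : List A} →
           Unique xs → (∀ {x y} → x ∈ₗ xs → y ∈ₗ xs → P x → P y → x ≡ y) → (∀ {x} → x ∈ₗ xs → P x → Q) →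
           ∑ xs (λ x → [ P? x ]) ≤ [ Q? ]
∑-unique P? Q? {[]} _ _ _ = z≤n
∑-unique P? Q? {x ∷ xs} (x∉ ∷ u) det P⇒Q with P? x
... | no _ = ∑-unique P? Q? u (λ y∈ z∈ → det (there y∈) (there z∈)) (P⇒Q ∘ there)
... | yes p = ≤-trans (≤-reflexive (cong suc (trans (none xs others) refl)))
      (≤-reflexive (sym ([]-yes Q? (P⇒Q (here refl) p))))
  where
  others : ∀ {y} → y ∈ₗ xs → ¬ _
  others y∈ py = All.lookup x∉ y∈ (det (here refl) (there y∈) p py)
  none : ∀ ys → (∀ {y} → y ∈ₗ ys → ¬ _) → ∑ ys (λ y → [ P? y ]) ≡ 0
  none [] _ = refl
  none (y ∷ ys) ¬p = cong₂ _+_ ([]-no (P? y) (¬p (here refl))) (none ys (¬p ∘ there))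

-- Vertices whose incident items are all to be discarded are paid for by their cost,
-- so the total weight of the items always exceeds the cost of the vertices still alive.
prune : ∀ {I V Goal : Set} (items : List I) {inc : I → V → Set} (inc? : ∀ w v → Dec (inc w v))
        (cost : V → ℕ) (Q : ℕ) →
        (∀ 𝒞 → (∀ {w} → w ∈ₗ 𝒞 → w ∈ₗ items) → (∀ f → ∑ 𝒞 f ≤ ∑ items f) → (∃ λ w → w ∈ₗ 𝒞) →
           Goal ⊎ ∃ λ v → (∃ λ w → w ∈ₗ 𝒞 × inc w v) × Q * ∑ 𝒞 (λ w → [ inc? w v ]) ≤ cost v) →
        ∀ Live → (∀ {w v} → w ∈ₗ items → inc w v → v ∈ₗ Live) → ∑ Live cost < Q * length items → Goal
prune {I} {V} {Goal} items {inc} inc? cost Q attempt Live₀ live₀ initial =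
  loop (length Live₀) Live₀ items ≤-refl id (λ _ → ≤-refl) live₀ initial
  where
  open ≤-Reasoning
  loop : ∀ N Live 𝒞 → length Live ≤ N → (∀ {w} → w ∈ₗ 𝒞 → w ∈ₗ items) → (∀ f → ∑ 𝒞 f ≤ ∑ items f) →
         (∀ {w v} → w ∈ₗ 𝒞 → inc w v → v ∈ₗ Live) → ∑ Live cost < Q * length 𝒞 → Goal
  loop N Live [] _ _ _ _ pot = ⊥-elim (<⇒≱ pot (≤-trans (≤-reflexive (*-zeroʳ Q)) z≤n))
  loop N Live 𝒞@(w₀ ∷ _) len ⊆items sums live pot with attempt 𝒞 ⊆items sums (w₀ , here refl)
  ... | inj₁ goal = goal
  ... | inj₂ (v , (w , w∈ , w∼v) , cheap) with ∈-∃++ (live w∈ w∼v)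
  ... | xs , ys , refl = next N len
    where
    𝒞' : List I
    𝒞' = filter (λ w → ¬? (inc? w v)) 𝒞
    live' : ∀ {w v'} → w ∈ₗ 𝒞' → inc w v' → v' ∈ₗ xs ++ ys
    live' {w} {v'} w∈' w∼v' with ∈-filter⁻ (λ w → ¬? (inc? w v)) {xs = 𝒞} w∈'
    ... | w∈𝒞 , w≁v with ∈-++⁻ xs (live w∈𝒞 w∼v')
    ... | inj₁ v'∈ = ∈-++⁺ˡ v'∈
    ... | inj₂ (here refl) = ⊥-elim (w≁v w∼v')
    ... | inj₂ (there v'∈) = ∈-++⁺ʳ xs v'∈
    shorter : length (xs ++ ys) < length (xs ++ v ∷ ys)
    shorter = ≤-reflexive (trans (cong suc (length-++ xs))
          (trans (sym (+-suc (length xs) (length ys))) (sym (length-++ xs))))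
      where open import Data.List.Properties using (length-++)
    costs : ∑ (xs ++ v ∷ ys) cost ≡ cost v + ∑ (xs ++ ys) cost
    costs = trans (∑-++ xs (v ∷ ys) cost) (trans (x∙yz≈y∙xz (∑ xs cost) (cost v) _)
          (cong (cost v +_) (sym (∑-++ xs ys cost))))
      where open import Algebra.Properties.CommutativeSemigroup +-commutativeSemigroup using (x∙yz≈y∙xz)
    pot' : ∑ (xs ++ ys) cost < Q * length 𝒞'
    pot' = +-cancelˡ-< (cost v) _ _ (begin-strict
      cost v + ∑ (xs ++ ys) cost    ≡⟨ costs ⟨
      ∑ (xs ++ v ∷ ys) cost         <⟨ pot ⟩
      Q * length 𝒞                  ≡⟨ cong (Q *_) (length-split (λ w → inc? w v) 𝒞) ⟩
      Q * (∑ 𝒞 (λ w → [ inc? w v ]) + length 𝒞') ≡⟨ *-distribˡ-+ Q _ (length 𝒞') ⟩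
      Q * ∑ 𝒞 (λ w → [ inc? w v ]) + Q * length 𝒞' ≤⟨ +-monoˡ-≤ (Q * length 𝒞') cheap ⟩
      cost v + Q * length 𝒞'        ∎)
    next : ∀ N → length (xs ++ v ∷ ys) ≤ N → Goal
    next zero le = ⊥-elim (<⇒≱ (≤-trans (s≤s z≤n) shorter) le)
    next (suc N) le = loop N (xs ++ ys) 𝒞' (≤-pred (≤-trans shorter le))
      (⊆items ∘ proj₁ ∘ ∈-filter⁻ (λ w → ¬? (inc? w v)) {xs = 𝒞})
      (λ f → ≤-trans (∑-filter≤ (λ w → ¬? (inc? w v)) 𝒞 f) (sums f)) live' pot'

-- Members are dropped from the front as long as the rest suffices, so the total overshoots by at
-- most the weight of one member. The upper bound is what keeps the costs of pruning, which are
-- proportional to the number of chains through the family, of order n!.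
thin : ∀ {A : Set} (f : A → ℕ) b c target W → (∀ x → f x ≤ W) → (F : List A) → target ≤ b * ∑ F f + c →
       ∃ λ F' → (∀ {x} → x ∈ₗ F' → x ∈ₗ F) × (Unique F → Unique F') ×
                target ≤ b * ∑ F' f + c × b * ∑ F' f ≤ target + b * W
thin f b c target W f≤W [] enough = [] , id , id , enough , subst (_≤ target + b * W) (sym (*-zeroʳ b)) z≤n
thin f b c target W f≤W (x ∷ F) enough with target ≤? b * ∑ F f + c
... | yes enough' = let (F' , ⊆F , u , e , l) = thin f b c target W f≤W F enough' in
  F' , there ∘ ⊆F , (λ { (_ ∷ uF) → u uF }) , e , l
... | no few = x ∷ F , id , id , enough , (begin
  b * (f x + ∑ F f)     ≡⟨ *-distribˡ-+ b (f x) _ ⟩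
  b * f x + b * ∑ F f   ≡⟨ +-comm (b * f x) _ ⟩
  b * ∑ F f + b * f x   ≤⟨ +-mono-≤ (≤-trans (m≤m+n _ c) (<⇒≤ (≰⇒> few))) (*-monoʳ-≤ b (f≤W x)) ⟩
  target + b * W        ∎)
  where open ≤-Reasoning

-- Windows on full chains

data Event (n : ℕ) : Set where
  single : Fin n → ℕ → Event n
  pair   : Fin n → ℕ → Fin n → ℕ → Event n

Happens : ∀ {n} → Event n → Perm n → Set
Happens (single x i) π = pos π x ≡ i
Happens (pair x i x' i') π = pos π x ≡ i × pos π x' ≡ i'

happens? : ∀ {n} (e : Event n) π → Dec (Happens e π)
happens? (single x i) π = step? x i π
happens? (pair x i x' i') π = step? x i π ×-dec step? x' i' π

Hits : ∀ {n} → List (Event n) → Perm n → Set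
Hits o π = Any.Any (λ e → Happens e π) o

hits? : ∀ {n} (o : List (Event n)) π → Dec (Hits o π)
hits? o π = Any.any? (λ e → happens? e π) o

-- On a random chain through A the event has probability at most 1 / c.
record Rare {n : ℕ} (c : ℕ) (A : Subset n) (e : Event n) : Set where
  constructor at-most
  field bound : c * cnt (λ π → through? A π ×-dec happens? e π) ≤ chains A

-- The union bound over the events of the list.
hits-count : ∀ {n} c (A : Subset n) (o : List (Event n)) → All (Rare c A) o →
             c * cnt (λ π → through? A π ×-dec hits? o π) ≤ length o * chains A
hits-count {n} c A [] [] = ≤-reflexive (trans (cong (c *_) (trans
  (∑-cong (perms n) λ π → []-no (through? A π ×-dec hits? [] π) λ ()) (∑-zero (perms n)))) (*-zeroʳ c))
hits-count {n} c A (e ∷ o) (at-most rare ∷ rares) = begin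
  c * cnt (λ π → through? A π ×-dec hits? (e ∷ o) π)
    ≤⟨ *-monoʳ-≤ c (∑-mono (perms n) λ π → union π) ⟩
  c * ∑ (perms n) (λ π → [ through? A π ×-dec happens? e π ] + [ through? A π ×-dec hits? o π ])
    ≡⟨ cong (c *_) (∑-+ (perms n) _ _) ⟩
  c * (cnt (λ π → through? A π ×-dec happens? e π) + cnt (λ π → through? A π ×-dec hits? o π))
    ≡⟨ *-distribˡ-+ c _ _ ⟩
  c * cnt (λ π → through? A π ×-dec happens? e π) + c * cnt (λ π → through? A π ×-dec hits? o π)
    ≤⟨ +-mono-≤ rare (hits-count c A o rares) ⟩
  chains A + length o * chains A ∎
  where
  open ≤-Reasoning
  union : ∀ π → [ through? A π ×-dec hits? (e ∷ o) π ] ≤ [ through? A π ×-dec happens? e π ] + [ through? A π ×-dec hits? o π ]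
  union π = []-≤ (through? A π ×-dec hits? (e ∷ o) π) λ
    { (th , here h) → ≤-trans (≤-reflexive (sym ([]-yes (through? A π ×-dec happens? e π) (th , h)))) (m≤m+n _ _)
    ; (th , there h) → ≤-trans (≤-reflexive (sym ([]-yes (through? A π ×-dec hits? o π) (th , h))))
          (m≤n+m _ [ through? A π ×-dec happens? e π ]) }

nth : List ℕ → ℕ → ℕ
nth [] _ = 0
nth (x ∷ xs) zero = x
nth (x ∷ xs) (suc i) = nth xs i

nth-∈ : ∀ xs {i} → i < length xs → nth xs i ∈ₗ xs
nth-∈ (x ∷ xs) {zero} _ = here refl
nth-∈ (x ∷ xs) {suc i} (s≤s i<) = there (nth-∈ xs i<)

nth-< : ∀ {xs} → AllPairs _<_ xs → ∀ {i j} → i < j → j < length xs → nth xs i < nth xs j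
nth-< {x ∷ xs} (x< ∷ _) {zero} {suc j} _ (s≤s j<) = All.lookup x< (nth-∈ xs j<)
nth-< {x ∷ xs} (_ ∷ ascending) {suc i} {suc j} (s≤s i<j) (s≤s j<) = nth-< ascending i<j j<

nth-injective : ∀ {xs} → AllPairs _<_ xs → ∀ {i j} → i < length xs → j < length xs → nth xs i ≡ nth xs j → i ≡ j
nth-injective ascending {i} {j} i< j< eq with <-cmp i j
... | tri< i<j _ _ = ⊥-elim (<⇒≢ (nth-< ascending i<j j<) eq)
... | tri≈ _ i≡j _ = i≡j
... | tri> _ _ j<i = ⊥-elim (<⇒≢ (nth-< ascending j<i i<) (sym eq))

ascending-length : ∀ {lo hi xs} → AllPairs _<_ xs → All (λ x → lo ≤ x × x < hi) xs → lo ≤ hi → length xs + lo ≤ hi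
ascending-length {xs = []} _ _ lo≤hi = lo≤hi
ascending-length {lo} {hi} {x ∷ xs} (x< ∷ ascending) ((lo≤x , x<hi) ∷ bounds) _ = begin
  suc (length xs + lo)  ≡⟨ +-suc (length xs) lo ⟨
  length xs + suc lo    ≤⟨ +-monoʳ-≤ (length xs) (s≤s lo≤x) ⟩
  length xs + suc x     ≤⟨ ascending-length ascending (All.zipWith (λ (x<y , _ , y<hi) → x<y , y<hi) (x< , bounds)) x<hi ⟩
  hi                    ∎
  where open ≤-Reasoning

-- An item (π , j) is the j-th window of k consecutive members of F on the chain π;
-- its marks at levels below k are those members, its mark at level k is the set of size H.
module Windows {n : ℕ} (F : List (Subset n)) (F! : Unique F) (k : ℕ) (1≤k : 1 ≤ k)
  (lo H s : ℕ) (sizes : ∀ {A} → A ∈ₗ F → lo ≤ ∣ A ∣ × 2 + ∣ A ∣ ≤ H) (H≤n : H ≤ n) (H≤lo+s : H ≤ lo + s)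
        (lo≤H : lo ≤ H) where

  open import Data.List.Membership.DecPropositional (_≟ₛ_ {n}) using (_∈?_)
  open import Data.List.Relation.Unary.Unique.Propositional.Properties using (upTo⁺)
  open import Data.List.Relation.Unary.Unique.DecPropositional.Properties (_≟ₛ_ {n}) using (deduplicate-!)
  open import Data.List.Relation.Unary.AllPairs.Properties using (applyUpTo⁺₁; filter⁺)

  inF? : ∀ π i → Dec (at π i ∈ₗ F)
  inF? π i = at π i ∈? F

  positions : Perm n → List ℕ
  positions π = filter (inF? π) (upTo (suc n))

  ascending : ∀ π → AllPairs _<_ (positions π)
  ascending π = filter⁺ (inF? π) (applyUpTo⁺₁ id (suc n) (λ i<j _ → i<j))

  position-∈ : ∀ {π i} → i ∈ₗ positions π → i ≤ n × at π i ∈ₗ F × ∣ at π i ∣ ≡ i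
  position-∈ {π} {i} i∈ with ∈-filter⁻ (inF? π) {xs = upTo (suc n)} i∈
  ... | i∈upTo , A∈F = i≤n , A∈F , ∣at∣ π i≤n
    where
    i≤n : i ≤ n
    i≤n = ≤-pred (∈-upTo⁻ i∈upTo)

  Item : Set
  Item = Perm n × ℕ

  -- A chain with N members of F has N + 1 - k windows, and none if N < k. The truncation can only
  -- raise the value, so lower bounds may ignore it.
  windows : Perm n → ℕ
  windows π = suc (length (positions π)) ∸ k

  items : List Item
  items = concatMap (λ π → map (π ,_) (upTo (windows π))) (perms n)

  ∑-items : ∀ f → ∑ items f ≡ ∑ (perms n) (λ π → ∑ (upTo (windows π)) (λ j → f (π , j)))
  ∑-items f = trans (∑-concatMap (λ π → map (π ,_) (upTo (windows π))) (perms n) f)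
                    (∑-cong (perms n) λ π → ∑-map (π ,_) (upTo (windows π)) f)

  posn : Item → ℕ → ℕ
  posn (π , j) l with l <? k
  ... | yes _ = nth (positions π) (j + l)
  ... | no _ = H

  mark : Item → ℕ → Subset n
  mark w l = at (proj₁ w) (posn w l)

  posn-< : ∀ {π j l} → l < k → posn (π , j) l ≡ nth (positions π) (j + l)
  posn-< {l = l} l<k with l <? k
  ... | yes _ = refl
  ... | no l≮k = ⊥-elim (l≮k l<k)

  posn-top : ∀ w → posn w k ≡ H
  posn-top w with k <? k
  ... | yes k<k = ⊥-elim (<-irrefl refl k<k)
  ... | no _ = refl

  window-< : ∀ {π j l} → j < windows π → l < k → j + l < length (positions π)
  window-< {π} {j} {l} j< l<k = ≤-pred (begin-strict
    suc (j + l)                           ≡⟨ +-suc j l ⟨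
    j + suc l                             ≤⟨ +-monoʳ-≤ j l<k ⟩
    j + k                                 <⟨ +-monoˡ-< k j< ⟩
    windows π + k                         ≡⟨ m∸n+n≡m (<⇒≤ (m∸n≢0⇒n<m {suc (length (positions π))} {k} (m<n⇒n≢0 j<))) ⟩
    suc (length (positions π))            ∎)
    where open ≤-Reasoning

  ∈-items : ∀ {π j} → (π , j) ∈ₗ items → j < windows π
  ∈-items w∈ with ∈-concatMap⁻ (λ π → map (π ,_) (upTo (windows π))) {xs = perms n} w∈
  ... | here' = go here'
    where
    go : ∀ {πs π j} → Any.Any (λ π' → (π , j) ∈ₗ map (π' ,_) (upTo (windows π'))) πs → j < windows π
    go (here w∈map) with ∈-map⁻ _ w∈map
    ... | j , j∈ , refl = ∈-upTo⁻ j∈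
    go (there a) = go a

  posn-low : ∀ {w l} → w ∈ₗ items → l < k → posn w l ∈ₗ positions (proj₁ w)
  posn-low {π , j} {l} w∈ l<k = subst (_∈ₗ positions π) (sym (posn-< l<k)) (nth-∈ (positions π) (window-< (∈-items w∈) l<k))

  posn≤n : ∀ {w l} → w ∈ₗ items → posn w l ≤ n
  posn≤n {w} {l} w∈ with l <? k in eq
  ... | yes l<k = subst (_≤ n) (posn-< l<k) (proj₁ (position-∈ (posn-low w∈ l<k)))
  ... | no _ = H≤n

  ∣mark∣ : ∀ {w l} → w ∈ₗ items → ∣ mark w l ∣ ≡ posn w l
  ∣mark∣ {w} w∈ = ∣at∣ (proj₁ w) (posn≤n w∈)

  mark-∈ : ∀ {w l} → w ∈ₗ items → l < k → mark w l ∈ₗ F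
  mark-∈ w∈ l<k = proj₁ (proj₂ (position-∈ (posn-low w∈ l<k)))

  posn-bounds : ∀ {w l} → w ∈ₗ items → l < k → lo ≤ posn w l × 2 + posn w l ≤ H
  posn-bounds w∈ l<k = subst (λ a → lo ≤ a × 2 + a ≤ H) (∣mark∣ w∈) (sizes (mark-∈ w∈ l<k))

  posn-mono : ∀ {w l l'} → w ∈ₗ items → l < l' → l' ≤ k → posn w l < posn w l'
  posn-mono {w@(π , j)} {l} {l'} w∈ l<l' l'≤k with m≤n⇒m<n∨m≡n l'≤k
  ... | inj₁ l'<k = subst₂ _<_ (sym (posn-< (<-trans l<l' l'<k))) (sym (posn-< l'<k))
                      (nth-< (ascending π) (+-monoʳ-< j l<l') (window-< (∈-items w∈) l'<k))
  ... | inj₂ refl = subst (posn w l <_) (sym (posn-top w)) (<⇒≤ (proj₂ (posn-bounds w∈ l<l')))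

  Incident : Item → ℕ × Subset n → Set
  Incident w (l , A) = l ≤ k × mark w l ≡ A

  incident? : ∀ w v → Dec (Incident w v)
  incident? w (l , A) = (l ≤? k) ×-dec (mark w l ≟ₛ A)

  -- The place of A among the members of F on a chain determines j, so each chain through A has at
  -- most one window with A at level l.
  low-count : ∀ {l} A o → l < k →
    ∑ items (λ w → [ incident? w (l , A) ×-dec hits? o (proj₁ w) ]) ≤ cnt (λ π → through? A π ×-dec hits? o π)
  low-count {l} A o l<k = ≤-trans (≤-reflexive (∑-items _)) (∑-mono (perms n) λ π →
    ∑-unique (λ j → incident? (π , j) (l , A) ×-dec hits? o π) (through? A π ×-dec hits? o π)
      (upTo⁺ (windows π))
      (λ j∈ j'∈ ((_ , eq) , _) ((_ , eq') , _) → +-cancelʳ-≡ l _ _ (nth-injective (ascending π)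
        (window-< (∈-upTo⁻ j∈) l<k) (window-< (∈-upTo⁻ j'∈) l<k)
        (trans (nth≡ π (∈-upTo⁻ j∈) eq) (sym (nth≡ π (∈-upTo⁻ j'∈) eq')))))
      (λ j∈ ((_ , eq) , h) → subst (λ i → at π i ≡ A) (trans (posn-< l<k) (nth≡ π (∈-upTo⁻ j∈) eq)) eq , h))
    where
    nth≡ : ∀ π {j} → j < windows π → mark (π , j) l ≡ A → nth (positions π) (j + l) ≡ ∣ A ∣
    nth≡ π {j} j< eq = trans (sym (proj₂ (proj₂ (position-∈ {π} (nth-∈ (positions π) (window-< j< l<k))))))
                             (cong ∣_∣ (trans (cong (at π) (sym (posn-< l<k))) eq))

  windows≤s : ∀ π → windows π ≤ s
  windows≤s π = ≤-trans (∸-monoʳ-≤ (suc (length (positions π))) 1≤k) (+-cancelʳ-≤ lo _ _ (≤-trans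
    (ascending-length (ascending π) (All.tabulate λ {i} i∈ → bounds i∈) lo≤H)
    (≤-trans H≤lo+s (≤-reflexive (+-comm lo s)))))
    where
    bounds : ∀ {i} → i ∈ₗ positions π → lo ≤ i × i < H
    bounds i∈ = let (_ , A∈F , size) = position-∈ i∈
                    (lower , upper) = sizes A∈F in
      subst (lo ≤_) size lower , <⇒≤ (subst (λ a → 2 + a ≤ H) size upper)

  -- All windows of a chain share its set of size H, and there are at most s of them because the
  -- members of F on it have distinct sizes from lo to below H.
  top-count : ∀ A o → ∑ items (λ w → [ incident? w (k , A) ×-dec hits? o (proj₁ w) ])
              ≤ s * cnt (λ π → through? A π ×-dec hits? o π)
  top-count A o = begin
    ∑ items (λ w → [ incident? w (k , A) ×-dec hits? o (proj₁ w) ])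
      ≡⟨ ∑-items _ ⟩
    ∑ (perms n) (λ π → ∑ (upTo (windows π)) (λ j → [ incident? (π , j) (k , A) ×-dec hits? o π ]))
      ≤⟨ ∑-mono (perms n) (λ π → ∑-mono (upTo (windows π)) λ j → []-mono (incident? (π , j) (k , A) ×-dec hits? o π)
           (through? A π ×-dec hits? o π) λ ((_ , eq) , h) → through π j eq , h) ⟩
    ∑ (perms n) (λ π → ∑ (upTo (windows π)) (λ _ → [ through? A π ×-dec hits? o π ]))
      ≤⟨ ∑-mono (perms n) (λ π → ≤-trans (≤-reflexive (∑-const (upTo (windows π)) _))
           (*-monoˡ-≤ _ (≤-trans (≤-reflexive (length-upTo (windows π))) (windows≤s π)))) ⟩
    ∑ (perms n) (λ π → s * [ through? A π ×-dec hits? o π ])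
      ≡⟨ ∑-*ˡ (perms n) _ s ⟩
    s * cnt (λ π → through? A π ×-dec hits? o π) ∎
    where
    open ≤-Reasoning
    open import Data.List.Properties using (length-upTo)
    through : ∀ π j → mark (π , j) k ≡ A → Through A π
    through π j eq = trans (cong (at π) (trans (cong ∣_∣ (trans (sym eq) at-H)) (∣at∣ π H≤n))) (trans (sym at-H) eq)
      where
      at-H : mark (π , j) k ≡ at π H
      at-H = cong (at π) (posn-top (π , j))

  -- Double counting of pairs of a set of F and a chain through it; a chain with N members satisfies
  -- N + 1 ≤ windows + k.
  enough-items : ∑ F chains + n ! ≤ length items + k * n !
  enough-items = begin
    ∑ F chains + n !                                   ≡⟨ cong₂ _+_
          (∑-swap F (perms n) (λ A π → [ through? A π ])) (sym (trans (∑-length (perms n)) (length-perms n))) ⟩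
    ∑ (perms n) (λ π → ∑ F (λ A → [ through? A π ])) + ∑ (perms n) (λ _ → 1)
                                                       ≡⟨ ∑-+ (perms n) _ _ ⟨
    ∑ (perms n) (λ π → ∑ F (λ A → [ through? A π ]) + 1) ≤⟨ ∑-mono (perms n) bound ⟩
    ∑ (perms n) (λ π → ∑ (upTo (windows π)) (λ _ → 1) + k) ≡⟨ ∑-+ (perms n) _ _ ⟩
    ∑ (perms n) (λ π → ∑ (upTo (windows π)) (λ _ → 1)) + ∑ (perms n) (λ _ → k)
                                                       ≡⟨ cong₂ _+_ (trans (sym (∑-items (λ _ → 1)))
                                                             (∑-length items)) (trans (∑-const (perms n) k)
                                                                   (trans (cong (_* k) (length-perms n)) (*-comm (n !) k))) ⟩
    length items + k * n !                             ∎
    where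
    open ≤-Reasoning
    open import Data.List.Properties using (length-upTo)
    members : ∀ π → ∑ F (λ A → [ through? A π ]) ≤ length (positions π)
    members π = begin
      ∑ F (λ A → [ through? A π ])
        ≤⟨ ∑-mono F (λ A → ∑-∈ (λ i → [ at π i ≟ₛ A ]) (∈-upTo⁺ (s≤s (∣p∣≤n A)))) ⟩
      ∑ F (λ A → ∑ (upTo (suc n)) (λ i → [ at π i ≟ₛ A ]))
        ≡⟨ ∑-swap F (upTo (suc n)) (λ A i → [ at π i ≟ₛ A ]) ⟩
      ∑ (upTo (suc n)) (λ i → ∑ F (λ A → [ at π i ≟ₛ A ]))
        ≤⟨ ∑-mono (upTo (suc n)) (λ i → ∑-unique (λ A → at π i ≟ₛ A) (inF? π i) F!
             (λ _ _ eq eq' → trans (sym eq) eq') (λ A∈ eq → subst (_∈ₗ F) (sym eq) A∈)) ⟩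
      ∑ (upTo (suc n)) (λ i → [ inF? π i ])
        ≡⟨ length-filter (inF? π) (upTo (suc n)) ⟨
      length (positions π) ∎
      where open import Data.Fin.Subset.Properties using (∣p∣≤n)
    bound : ∀ π → ∑ F (λ A → [ through? A π ]) + 1 ≤ ∑ (upTo (windows π)) (λ _ → 1) + k
    bound π = begin
      ∑ F (λ A → [ through? A π ]) + 1         ≡⟨ +-comm _ 1 ⟩
      suc (∑ F (λ A → [ through? A π ]))       ≤⟨ s≤s (members π) ⟩
      suc (length (positions π))               ≤⟨ m≤n+m∸n _ k ⟩
      k + windows π                            ≡⟨ +-comm k _ ⟩
      windows π + k                            ≡⟨ cong (_+ k)
            (trans (∑-length (upTo (windows π))) (length-upTo (windows π))) ⟨
      ∑ (upTo (windows π)) (λ _ → 1) + k       ∎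

  -- Without repetitions, so that each chain is charged for only one set of size H in `∑-tops`.
  tops : List (Subset n)
  tops = deduplicate _≟ₛ_ (map (λ π → at π H) (perms n))
    where open import Data.List using (deduplicate)

  ∈-tops : ∀ {A} → A ∈ₗ tops → ∣ A ∣ ≡ H
  ∈-tops A∈ with ∈-map⁻ (λ π → at π H) (∈-deduplicate⁻ _≟ₛ_ (map (λ π → at π H) (perms n)) A∈)
  ... | π , _ , refl = ∣at∣ π H≤n

  ∑-tops : ∑ tops chains ≤ n !
  ∑-tops = begin
    ∑ tops chains                                       ≤⟨ ∑-mono-∈ tops
          (λ A∈ → ∑-mono (perms n) λ π → []-mono (through? _ π) (at π H ≟ₛ _) (subst (λ a → at π a ≡ _) (∈-tops A∈))) ⟩
    ∑ tops (λ A → cnt (λ π → at π H ≟ₛ A))              ≡⟨ ∑-swap tops (perms n) (λ A π → [ at π H ≟ₛ A ]) ⟩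
    ∑ (perms n) (λ π → ∑ tops (λ A → [ at π H ≟ₛ A ]))  ≤⟨ ∑-mono (perms n) (λ π → ∑-unique (λ A → at π H ≟ₛ A) (yes tt)
                                                             (deduplicate-! (map (λ π → at π H) (perms n)))
                                                                   (λ _ _ eq eq' → trans (sym eq) eq') (λ _ _ → tt)) ⟩
    ∑ (perms n) (λ _ → 1)                               ≡⟨ trans (∑-length (perms n)) (length-perms n) ⟩
    n !                                                 ∎
    where open ≤-Reasoning

  -- A set of F may be hopeless at one level and useful at another, so pruning treats each pair of a
  -- level and a set separately.
  vertices : List (ℕ × Subset n)
  vertices = concatMap (λ l → map (l ,_) F) (upTo k) ++ map (k ,_) tops

  ∈-perms : ∀ {n} (π : Perm n) → π ∈ₗ perms n
  ∈-perms {zero} tt = here refl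
  ∈-perms {suc n} (j , π) = ∈-concatMap⁺ (λ j → map (j ,_) (perms n)) (go (∈-allFin j))
    where
    go : ∀ {js} → j ∈ₗ js → Any.Any (λ j' → (j , π) ∈ₗ map (j' ,_) (perms n)) js
    go (here refl) = here (∈-map⁺ (j ,_) (∈-perms π))
    go (there j∈) = there (go j∈)

  incident-vertex : ∀ {w v} → w ∈ₗ items → Incident w v → v ∈ₗ vertices
  incident-vertex {w} {l , _} w∈ (l≤k , refl) with m≤n⇒m<n∨m≡n l≤k
  ... | inj₁ l<k = ∈-++⁺ˡ (∈-concatMap⁺ (λ l → map (l ,_) F) (go (∈-upTo⁺ l<k)))
    where
    go : ∀ {ls} → l ∈ₗ ls → Any.Any (λ l' → (l , mark w l) ∈ₗ map (l' ,_) F) ls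
    go (here refl) = here (∈-map⁺ (l ,_) (mark-∈ w∈ l<k))
    go (there l∈) = there (go l∈)
  ... | inj₂ refl = ∈-++⁺ʳ _ (∈-map⁺ (k ,_) (∈-deduplicate⁺ _≟ₛ_
        (subst (λ i → at (proj₁ w) i ∈ₗ map (λ π → at π H) (perms n)) (sym (posn-top w))
              (∈-map⁺ (λ π → at π H) (∈-perms (proj₁ w))))))

  cost : ℕ → ℕ → ℕ × Subset n → ℕ
  cost c c' (l , A) with l <? k
  ... | yes _ = c * chains A
  ... | no _ = c' * chains A

  ∑-cost : ∀ c c' → ∑ vertices (cost c c') ≤ k * (c * ∑ F chains) + c' * n !
  ∑-cost c c' = begin
    ∑ vertices (cost c c')  ≡⟨ ∑-++ (concatMap (λ l → map (l ,_) F) (upTo k)) _ _ ⟩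
    ∑ (concatMap (λ l → map (l ,_) F) (upTo k)) (cost c c') + ∑ (map (k ,_) tops) (cost c c')
      ≡⟨ cong₂ _+_ (trans (∑-concatMap _ (upTo k) _) (∑-cong (upTo k) λ l → ∑-map (l ,_) F _)) (∑-map (k ,_) tops _) ⟩
    ∑ (upTo k) (λ l → ∑ F (λ A → cost c c' (l , A))) + ∑ tops (λ A → cost c c' (k , A))
      ≤⟨ +-mono-≤ (∑-mono-∈ (upTo k) (λ l∈ → ≤-trans (∑-mono F λ A → low (∈-upTo⁻ l∈)) (≤-reflexive (∑-*ˡ F chains c))))
                  (≤-trans (∑-mono tops λ A → top) (≤-trans (≤-reflexive (∑-*ˡ tops chains c')) (*-monoʳ-≤ c' ∑-tops))) ⟩
    ∑ (upTo k) (λ _ → c * ∑ F chains) + c' * n !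
      ≡⟨ cong (_+ c' * n !) (trans (∑-const (upTo k) _) (cong (_* (c * ∑ F chains)) (length-upTo k))) ⟩
    k * (c * ∑ F chains) + c' * n ! ∎
    where
    open ≤-Reasoning
    open import Data.List.Properties using (length-upTo)
    low : ∀ {l A} → l < k → cost c c' (l , A) ≤ c * chains A
    low {l} l<k with l <? k
    ... | yes _ = ≤-refl
    ... | no l≮k = ⊥-elim (l≮k l<k)
    top : ∀ {A} → cost c c' (k , A) ≤ c' * chains A
    top with k <? k
    ... | yes k<k = ⊥-elim (<-irrefl refl k<k)
    ... | no _ = ≤-refl

-- Avoidable obstacles

pos-injective : ∀ {n} (π : Perm n) {x y} → pos π x ≡ pos π y → x ≡ y
pos-injective {suc n} (j , π) {zero} {zero} _ = refl
pos-injective {suc n} (j , π) {zero} {suc y} eq = ⊥-elim (bump-≢ (toℕ j) (pos π y) eq)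
pos-injective {suc n} (j , π) {suc x} {zero} eq = ⊥-elim (bump-≢ (toℕ j) (pos π x) (sym eq))
pos-injective {suc n} (j , π) {suc x} {suc y} eq = cong suc (pos-injective π
  (trans (sym (unbump-bump (toℕ j) (pos π x))) (trans (cong (unbump (toℕ j)) eq) (unbump-bump (toℕ j) (pos π y)))))

diffs : ∀ {n} → Subset n → Subset n → List (Fin n)
diffs [] [] = []
diffs (inside ∷ A) (outside ∷ B) = zero ∷ map suc (diffs A B)
diffs (inside ∷ A) (inside ∷ B) = map suc (diffs A B)
diffs (outside ∷ A) (_ ∷ B) = map suc (diffs A B)

diffs⇒ : ∀ {n} (A B : Subset n) {x} → x ∈ₗ diffs A B → x ∈ A × ¬ x ∈ B
diffs⇒ (inside ∷ A) (outside ∷ B) (here refl) = here , λ ()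
diffs⇒ (inside ∷ A) (outside ∷ B) (there x∈) with ∈-map⁻ suc x∈
... | y , y∈ , refl = let (y∈A , y∉B) = diffs⇒ A B y∈ in there y∈A , λ { (there y∈B) → y∉B y∈B }
diffs⇒ (inside ∷ A) (inside ∷ B) x∈ with ∈-map⁻ suc x∈
... | y , y∈ , refl = let (y∈A , y∉B) = diffs⇒ A B y∈ in there y∈A , λ { (there y∈B) → y∉B y∈B }
diffs⇒ (outside ∷ A) (_ ∷ B) x∈ with ∈-map⁻ suc x∈
... | y , y∈ , refl = let (y∈A , y∉B) = diffs⇒ A B y∈ in there y∈A , λ { (there y∈B) → y∉B y∈B }

diffs⇐ : ∀ {n} (A B : Subset n) {x} → x ∈ A → ¬ x ∈ B → x ∈ₗ diffs A B
diffs⇐ (inside ∷ A) (outside ∷ B) here _ = here refl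
diffs⇐ (inside ∷ A) (inside ∷ B) here x∉ = ⊥-elim (x∉ here)
diffs⇐ (inside ∷ A) (outside ∷ B) (there x∈) x∉ = there (∈-map⁺ suc (diffs⇐ A B x∈ (x∉ ∘ there)))
diffs⇐ (inside ∷ A) (inside ∷ B) (there x∈) x∉ = ∈-map⁺ suc (diffs⇐ A B x∈ (x∉ ∘ there))
diffs⇐ (outside ∷ A) (_ ∷ B) (there x∈) x∉ = ∈-map⁺ suc (diffs⇐ A B x∈ (x∉ ∘ there))

diffs! : ∀ {n} (A B : Subset n) → Unique (diffs A B)
diffs! [] [] = []
diffs! (inside ∷ A) (outside ∷ B) = All.tabulate
      (λ x∈ → λ { refl → case ∈-map⁻ suc x∈ of λ () }) ∷ map⁺ Fin.suc-injective (diffs! A B)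
  where open import Data.List.Relation.Unary.Unique.Propositional.Properties using (map⁺)
diffs! (inside ∷ A) (inside ∷ B) = map⁺ Fin.suc-injective (diffs! A B)
  where open import Data.List.Relation.Unary.Unique.Propositional.Properties using (map⁺)
diffs! (outside ∷ A) (_ ∷ B) = map⁺ Fin.suc-injective (diffs! A B)
  where open import Data.List.Relation.Unary.Unique.Propositional.Properties using (map⁺)

diffs-length≥ : ∀ {n} (A B : Subset n) → ∣ A ∣ ≤ length (diffs A B) + ∣ B ∣
diffs-length≥ [] [] = z≤n
diffs-length≥ (inside ∷ A) (outside ∷ B) = s≤s
      (subst (λ l → ∣ A ∣ ≤ l + ∣ B ∣) (sym (length-map suc (diffs A B))) (diffs-length≥ A B))
  where open import Data.List.Properties using (length-map)
diffs-length≥ (inside ∷ A) (inside ∷ B) = subst (suc ∣ A ∣ ≤_) (sym (+-suc _ ∣ B ∣))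
  (s≤s (subst (λ l → ∣ A ∣ ≤ l + ∣ B ∣) (sym (length-map suc (diffs A B))) (diffs-length≥ A B)))
  where open import Data.List.Properties using (length-map)
diffs-length≥ (outside ∷ A) (b ∷ B) = ≤-trans
      (subst (λ l → ∣ A ∣ ≤ l + ∣ B ∣) (sym (length-map suc (diffs A B))) (diffs-length≥ A B))
  (+-monoʳ-≤ (length (map suc (diffs A B))) (size b))
  where
  open import Data.List.Properties using (length-map)
  size : ∀ b → ∣ B ∣ ≤ ∣ b ∷ B ∣
  size inside = n≤1+n _
  size outside = ≤-refl

diffs-length≤ : ∀ {n} (A B : Subset n) → B ⊆ A → length (diffs A B) + ∣ B ∣ ≤ ∣ A ∣
diffs-length≤ [] [] _ = z≤n
diffs-length≤ (inside ∷ A) (outside ∷ B) B⊆A = s≤s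
      (subst (λ l → l + ∣ B ∣ ≤ ∣ A ∣) (sym (length-map suc (diffs A B))) (diffs-length≤ A B (drop-∷-⊆ B⊆A)))
  where
  open import Data.List.Properties using (length-map)
  open import Data.Fin.Subset.Properties using (drop-∷-⊆)
diffs-length≤ (inside ∷ A) (inside ∷ B) B⊆A = subst (_≤ suc ∣ A ∣) (sym (+-suc _ ∣ B ∣))
  (s≤s (subst (λ l → l + ∣ B ∣ ≤ ∣ A ∣) (sym (length-map suc (diffs A B))) (diffs-length≤ A B (drop-∷-⊆ B⊆A))))
  where
  open import Data.List.Properties using (length-map)
  open import Data.Fin.Subset.Properties using (drop-∷-⊆)
diffs-length≤ (outside ∷ A) (inside ∷ B) B⊆A = case B⊆A here of λ ()
diffs-length≤ (outside ∷ A) (outside ∷ B) B⊆A = subst (λ l → l + ∣ B ∣ ≤ ∣ A ∣)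
      (sym (length-map suc (diffs A B))) (diffs-length≤ A B (drop-∷-⊆ B⊆A))
  where
  open import Data.List.Properties using (length-map)
  open import Data.Fin.Subset.Properties using (drop-∷-⊆)

-- The sets reached after i and after i + 1 steps differ in size, so some element enters in between.
pos-surjective : ∀ {n} (π : Perm n) {i} → i < n → ∃ λ x → pos π x ≡ i
pos-surjective {n} π {i} i<n = pick (diffs (at π (suc i)) (at π i)) refl
  where
  pick : ∀ ds → diffs (at π (suc i)) (at π i) ≡ ds → ∃ λ x → pos π x ≡ i
  pick [] eq = ⊥-elim (<-irrefl refl (subst₂ (λ a l → a ≤ length l + ∣ at π i ∣) (∣at∣ π i<n) eq
    (diffs-length≥ (at π (suc i)) (at π i)) ⟨≤⟩ ∣at∣ π (<⇒≤ i<n)))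
    where
    _⟨≤⟩_ : ∀ {a b c} → a ≤ b → b ≡ c → a ≤ c
    a≤b ⟨≤⟩ refl = a≤b
  pick (x ∷ _) eq = let (x∈ , x∉) = diffs⇒ (at π (suc i)) (at π i) (subst (x ∈ₗ_) (sym eq) (here refl)) in
    x , ≤-antisym (≤-pred (∈-at⇒ π x∈)) (≮⇒≥ (x∉ ∘ ∈-at⇐ π))

range : ℕ → ℕ → List ℕ
range a b = map (a +_) (upTo (b ∸ a))

∈-range⁺ : ∀ {a b i} → a ≤ i → i < b → i ∈ₗ range a b
∈-range⁺ {a} {b} {i} a≤i i<b = subst (_∈ₗ range a b) (m+[n∸m]≡n a≤i) (∈-map⁺ (a +_) (∈-upTo⁺ (∸-monoˡ-< i<b a≤i)))

∈-range⁻ : ∀ {a b i} → i ∈ₗ range a b → a ≤ i × i < b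
∈-range⁻ {a} {b} i∈ with ∈-map⁻ (a +_) i∈
... | j , j∈ , refl = m≤m+n a j , ≤-trans (+-monoʳ-< a (∈-upTo⁻ j∈))
      (≤-reflexive (m+[n∸m]≡n (<⇒≤ (m∸n≢0⇒n<m {b} {a} (m<n⇒n≢0 (∈-upTo⁻ j∈))))))

length-range : ∀ a b → length (range a b) ≡ b ∸ a
length-range a b = trans (length-map (a +_) (upTo (b ∸ a))) (length-upTo (b ∸ a))
  where open import Data.List.Properties using (length-map; length-upTo)

_⊑_ : ∀ {n} → Subset n → Subset n → Set
A ⊑ B = ∀ x → x ∈ A → x ∈ B

-- P holds on all chains through A except for a share of at most E / c: the exceptions are covered
-- by at most E events of probability at most 1 / c each.
record Avoidable {n : ℕ} (c : ℕ) (A : Subset n) (E : ℕ) (P : Perm n → Set) : Set where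
  constructor avoiding
  field
    events : List (Event n)
    rare   : All (Rare c A) events
    few    : length events ≤ E
    avoid  : ∀ π → Through A π → ¬ Hits events π → P π

always : ∀ {n c E} {A : Subset n} {P : Perm n → Set} → (∀ π → Through A π → P π) → Avoidable c A E P
always p = avoiding [] [] z≤n λ π th _ → p π th

both : ∀ {n c E E'} {A : Subset n} {P P' : Perm n → Set} →
       Avoidable c A E P → Avoidable c A E' P' → Avoidable c A (E + E') (λ π → P π × P' π)
both {E = E} {E'} (avoiding o rare few avoid) (avoiding o' rare' few' avoid') = avoiding
  (o ++ o') (All-++⁺ rare rare') (subst (_≤ E + E') (sym (length-++ o)) (+-mono-≤ few few'))
  (λ π th ¬hits → avoid π th (¬hits ∘ Any-++⁺ˡ) , avoid' π th (¬hits ∘ Any-++⁺ʳ o))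
  where
  open import Data.List.Properties using (length-++)
  open import Data.List.Relation.Unary.All.Properties using () renaming (++⁺ to All-++⁺)
  open import Data.List.Relation.Unary.Any.Properties using () renaming (++⁺ˡ to Any-++⁺ˡ; ++⁺ʳ to Any-++⁺ʳ)

every : ∀ {n c E} {A : Subset n} {X : Set} {P : X → Perm n → Set} (xs : List X) →
        (∀ {x} → x ∈ₗ xs → Avoidable c A E (P x)) →
        Avoidable c A (length xs * E) (λ π → ∀ x → x ∈ₗ xs → P x π)
every [] _ = always λ π th x ()
every (x ∷ xs) f with both (f (here refl)) (every xs (f ∘ there))
... | avoiding o rare few avoid = avoiding o rare few
  λ π th ¬hits → λ { _ (here refl) → proj₁ (avoid π th ¬hits) ; x (there x∈) → proj₂ (avoid π th ¬hits) x x∈ }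

-- Each property below excludes an unwanted inclusion between an old set S and the set at a position
-- b of a chain through A.
module Separation {n : ℕ} (A : Subset n) (q s lo H : ℕ) (H≤n : H ≤ n) (H≤lo+s : H ≤ lo + s) where

  open import Data.List.Properties using (length-map)
  open import Data.Fin.Subset.Properties using (_⊆?_)

  a : ℕ
  a = ∣ A ∣

  ∈A⇒ : ∀ (π : Perm n) {x} → Through A π → x ∈ A → pos π x < a
  ∈A⇒ π {x} th x∈ = ∈-at⇒ π (subst (x ∈_) (sym th) x∈)

  ∈A⇐ : ∀ (π : Perm n) {x} → Through A π → pos π x < a → x ∈ A
  ∈A⇐ π {x} th lt = subst (x ∈_) th (∈-at⇐ π lt)

  ∉at : ∀ (π : Perm n) x {i} → i ≤ pos π x → ¬ x ∈ at π i
  ∉at π x i≤ x∈ = <⇒≱ (∈-at⇒ π x∈) i≤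

  gap≤s : ∀ {b c} → lo ≤ b → c ≤ H → c ∸ b ≤ s
  gap≤s {b} {c} lo≤b c≤H = m≤n+o⇒m∸n≤o c b (≤-trans c≤H (≤-trans H≤lo+s (+-monoˡ-≤ s lo≤b)))

  range≤s : ∀ {b c} → lo ≤ b → c ≤ H → length (range b c) ≤ s
  range≤s {b} {c} lo≤b c≤H = subst (_≤ s) (sym (length-range b c)) (gap≤s lo≤b c≤H)

  diffs≤s : ∀ (B S : Subset n) → S ⊆ B → lo ≤ ∣ S ∣ → ∣ B ∣ ≤ H → length (diffs B S) ≤ s
  diffs≤s B S S⊆B lo≤ ≤H = ≤-trans (m+n≤o⇒m≤o∸n (length (diffs B S)) (diffs-length≤ B S S⊆B)) (gap≤s lo≤ ≤H)

  empty-diffs : ∀ (B S : Subset n) → diffs B S ≡ [] → B ⊑ S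
  empty-diffs B S eq x x∈ with x ∈? S
    where open import Data.Fin.Subset.Properties using (_∈?_)
  ... | yes x∈S = x∈S
  ... | no x∉S = case subst (x ∈ₗ_) eq (diffs⇐ B S x∈ x∉S) of λ ()

  module Upward (lo≤a : lo ≤ a) (a<H : a < H) (q≤ : q ≤ n ∸ a) where

    unlikely : ∀ {x i} → ¬ x ∈ A → a ≤ i → i < H → Rare q A (single x i)
    unlikely x∉ a≤i i<H = at-most (step-outside A q x∉ a≤i (<-≤-trans i<H H≤n) q≤)

    -- If x ∈ S lies outside A, then S can fit below layer H only if x enters at one of the at most
    -- s steps from A to H.
    keep-out : ∀ S → Avoidable q A s (λ π → ∀ b → b ≤ H → S ⊑ at π b → S ⊑ A)
    keep-out S with diffs S A in eq
    ... | [] = always λ π th b b≤H S⊆ → empty-diffs S A eq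
    ... | x ∷ _ = avoiding
                (map (single x) (range a H))
                (All.tabulate (λ e∈ → case ∈-map⁻ (single x) e∈ of λ
                    { (i , i∈ , refl) → unlikely x∉ (proj₁ (∈-range⁻ i∈)) (proj₂ (∈-range⁻ {a} i∈)) }))
                (subst (_≤ s) (sym (length-map (single x) (range a H))) (range≤s lo≤a ≤-refl))
                (λ π th ¬hits b b≤H S⊆ → ⊥-elim (¬hits (lose
                    (∈-map⁺ (single x) (∈-range⁺ (≮⇒≥ (x∉ ∘ ∈A⇐ π th)) (<-≤-trans (∈-at⇒ π (S⊆ _ x∈)) b≤H))) refl)))
      where
      x∈×x∉ : x ∈ S × ¬ x ∈ A
      x∈×x∉ = diffs⇒ S A (subst (x ∈ₗ_) (sym eq) (here refl))
      x∈ = proj₁ x∈×x∉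
      x∉ = proj₂ x∈×x∉

    -- The element that enters right after A would have to lie in S but not in A. If A ⊆ S there are
    -- at most s such elements; otherwise nothing above A fits into S.
    escape : ∀ S → ∣ S ∣ ≤ H → Avoidable q A s (λ π → ∀ b → a < b → ¬ at π b ⊑ S)
    escape S S≤H with A ⊆? S
    ... | no A⊈S = always λ π th b a<b ⊆S → A⊈S λ x∈ → ⊆S _ (∈-at⇐ π (<-trans (∈A⇒ π th x∈) a<b))
    ... | yes A⊆S = avoiding
                (map (λ y → single y a) (diffs S A))
                (All.tabulate (λ e∈ → case ∈-map⁻ (λ y → single y a) e∈ of λ
                      { (y , y∈ , refl) → unlikely (proj₂ (diffs⇒ S A y∈)) ≤-refl a<H }))
                (subst (_≤ s) (sym (length-map (λ y → single y a) (diffs S A))) (diffs≤s S A A⊆S lo≤a S≤H))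
                (λ π th ¬hits b a<b ⊆S → let (y , eq) = pos-surjective π (<-≤-trans a<H H≤n) in
                      ¬hits (lose (∈-map⁺ (λ y → single y a) (diffs⇐ S A
                        (⊆S y (∈-at⇐ π (subst (_< b) (sym eq) a<b)))
                        (λ y∈A → <-irrefl eq (∈A⇒ π th y∈A)))) eq))

    upward : (𝒮 : List (Subset n)) → (∀ {S} → S ∈ₗ 𝒮 → ∣ S ∣ ≤ H) →
             Avoidable q A (length 𝒮 * (s + s)) (λ π → ∀ S → S ∈ₗ 𝒮 →
               (∀ b → b ≤ H → S ⊑ at π b → S ⊑ A) × (∀ b → a < b → ¬ at π b ⊑ S))
    upward 𝒮 sizes = every 𝒮 λ {S} S∈ → both (keep-out S) (escape S (sizes S∈))

  module Downward (lo<a : lo < a) (a≤H : a ≤ H) (q≤ : q ≤ a) where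

    unlikely : ∀ {x i} → x ∈ A → i < a → Rare q A (single x i)
    unlikely x∈ i<a = at-most (step-inside A q x∈ i<a q≤)

    -- Dual to `keep-out`: an element of A outside S would have to enter at a step between lo and A.
    keep-in : ∀ S → Avoidable q A s (λ π → ∀ b → lo ≤ b → at π b ⊑ S → A ⊑ S)
    keep-in S with diffs A S in eq
    ... | [] = always λ π th b lo≤b ⊆S → empty-diffs A S eq
    ... | x ∷ _ = avoiding
                (map (single x) (range lo a))
                (All.tabulate (λ e∈ → case ∈-map⁻ (single x) e∈ of λ
                    { (i , i∈ , refl) → unlikely x∈ (proj₂ (∈-range⁻ {lo} i∈)) }))
                (subst (_≤ s) (sym (length-map (single x) (range lo a))) (range≤s ≤-refl a≤H))
                (λ π th ¬hits b lo≤b ⊆S → ⊥-elim (¬hits (lose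
                    (∈-map⁺ (single x) (∈-range⁺ (≤-trans lo≤b (≮⇒≥ (x∉ ∘ ⊆S _ ∘ ∈-at⇐ π))) (∈A⇒ π th x∈))) refl)))
      where
      x∈×x∉ : x ∈ A × ¬ x ∈ S
      x∈×x∉ = diffs⇒ A S (subst (x ∈ₗ_) (sym eq) (here refl))
      x∈ = proj₁ x∈×x∉
      x∉ = proj₂ x∈×x∉

    -- Dual to `escape`, with the last element that enters A, at step a - 1: it is missing from
    -- every smaller set of the chain, hence from S.
    drop : ∀ S → lo ≤ ∣ S ∣ → Avoidable q A s (λ π → ∀ b → b < a → ¬ S ⊑ at π b)
    drop S lo≤S with S ⊆? A
    ... | no S⊈A = always λ π th b b<a S⊆ → S⊈A λ x∈ → ∈A⇐ π th (<-trans (∈-at⇒ π (S⊆ _ x∈)) b<a)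
    ... | yes S⊆A = avoiding
                (map (λ y → single y (pred a)) (diffs A S))
                (All.tabulate (λ e∈ → case ∈-map⁻ (λ y → single y (pred a)) e∈ of λ
                      { (y , y∈ , refl) → unlikely (proj₁ (diffs⇒ A S y∈)) pred<a }))
                (subst (_≤ s) (sym (length-map (λ y → single y (pred a)) (diffs A S))) (diffs≤s A S S⊆A lo≤S a≤H))
                (λ π th ¬hits b b<a S⊆ → let (y , eq) = pos-surjective π (<-≤-trans pred<a (≤-trans a≤H H≤n)) in
                      ¬hits (lose (∈-map⁺ (λ y → single y (pred a)) (diffs⇐ A S
                        (∈A⇐ π th (subst (_< a) (sym eq) pred<a))
                        (λ y∈S → ∉at π y (subst (_ ≤_) (sym eq) (<⇒≤pred b<a)) (S⊆ _ y∈S)))) eq))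
      where
      pred<a : pred a < a
      pred<a = ≤-reflexive (suc-pred a {{>-nonZero (≤-trans (s≤s z≤n) lo<a)}})

    downward : (𝒮 : List (Subset n)) → (∀ {S} → S ∈ₗ 𝒮 → lo ≤ ∣ S ∣) →
               Avoidable q A (length 𝒮 * (s + s)) (λ π → ∀ S → S ∈ₗ 𝒮 →
                 (∀ b → lo ≤ b → at π b ⊑ S → A ⊑ S) × (∀ b → b < a → ¬ S ⊑ at π b))
    downward 𝒮 sizes = every 𝒮 λ {S} S∈ → both (keep-in S) (drop S (sizes S∈))

  -- Chains below the top mark carry up to s windows, so single steps are not rare enough;
  -- but the sets involved are at least two layers below, and two steps can be prescribed.
  module Top (a≡H : a ≡ H) (q<a : q < a) (2≤a : 2 ≤ a) where

    unlikely : ∀ {x x' i i'} → x ∈ A → x' ∈ A → x ≢ x' → i < a → i' < a → i ≢ i' → Rare (q * q) A (pair x i x' i')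
    unlikely x∈ x'∈ x≢x' i<a i'<a i≢i' = at-most (step-inside₂ A q x∈ x'∈ x≢x' i<a i'<a i≢i' q<a)

    length-pairs : ∀ {X Y Z : Set} (f : X → List Y) (g : X → Y → Z) (xs : List X) {E E'} → length xs ≤ E' →
          (∀ x → length (f x) ≤ E) →
                   length (concatMap (λ x → map (g x) (f x)) xs) ≤ E' * E
    length-pairs f g xs {E} {E'} xs≤ f≤ = ≤-trans (go xs) (*-monoˡ-≤ E xs≤)
      where
      open import Data.List.Properties using (length-++)
      go : ∀ xs → length (concatMap (λ x → map (g x) (f x)) xs) ≤ length xs * E
      go [] = z≤n
      go (x ∷ xs) = ≤-trans (≤-reflexive (length-++ (map (g x) (f x))))
        (+-mono-≤ (≤-trans (≤-reflexive (length-map (g x) (f x))) (f≤ x)) (go xs))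

    ∈-pairs⁺ : ∀ {X Y Z : Set} (f : X → List Y) (g : X → Y → Z) {xs x y} → x ∈ₗ xs → y ∈ₗ f x →
               g x y ∈ₗ concatMap (λ x → map (g x) (f x)) xs
    ∈-pairs⁺ f g (here refl) y∈ = ∈-++⁺ˡ (∈-map⁺ (g _) y∈)
    ∈-pairs⁺ f g (there x∈) y∈ = ∈-++⁺ʳ _ (∈-pairs⁺ f g x∈ y∈)

    All-pairs : ∀ {X Y Z : Set} {R : Z → Set} (f : X → List Y) (g : X → Y → Z) (xs : List X) →
                (∀ {x y} → x ∈ₗ xs → y ∈ₗ f x → R (g x y)) → All R (concatMap (λ x → map (g x) (f x)) xs)
    All-pairs f g [] _ = []
    All-pairs {R = R} f g (x ∷ xs) r = All-++⁺ (All.tabulate λ e∈ → case ∈-map⁻ (g x) e∈ of λ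
        { (y , y∈ , eq) → subst R (sym eq) (r (here refl) y∈) })
      (All-pairs f g xs (r ∘ there))
      where open import Data.List.Relation.Unary.All.Properties using () renaming (++⁺ to All-++⁺)

    length-others : ∀ {X : Set} {P : X → Set} (P? : ∀ x → Dec (P x)) xs {E} → length xs ≤ E → length (filter P? xs) ≤ E
    length-others P? xs = ≤-trans (length-filter≤ P? xs)
      where open import Data.List.Properties using () renaming (length-filter to length-filter≤)

    -- A set at least two smaller than A misses two elements of A, and both would have to enter
    -- between lo and A, at one of at most s² pairs of distinct steps. The case S ≡ A is there
    -- because the image of m is itself one of the old sets.
    keep-in₂ : ∀ S → S ≡ A ⊎ 2 + ∣ S ∣ ≤ a → Avoidable (q * q) A (s * s) (λ π → ∀ b → lo ≤ b → at π b ⊑ S → A ⊑ S)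
    keep-in₂ S (inj₁ refl) = always λ π th b lo≤b ⊆S x x∈ → x∈
    keep-in₂ S (inj₂ S<a) with diffs A S in eq | diffs! A S
    ... | [] | _ = always λ π th b lo≤b ⊆S → empty-diffs A S eq
    ... | _ ∷ [] | _ = ⊥-elim (<⇒≱ S<a (subst (λ ds → a ≤ length ds + ∣ S ∣) eq (diffs-length≥ A S)))
    ... | x ∷ x' ∷ _ | (x≢x' ∷ _) ∷ _ = avoiding
        (concatMap (λ i → map (g i) (f i)) (range lo a))
        (All-pairs f g (range lo a) (λ i∈ i'∈ → let (i'∈range , i≢i') = ∈-filter⁻ _ {xs = range lo a} i'∈ in
          unlikely (proj₁ x∈×x∉) (proj₁ x'∈×x'∉) x≢x' (proj₂ (∈-range⁻ {lo} i∈)) (proj₂ (∈-range⁻ {lo} i'∈range)) i≢i'))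
        (length-pairs f g (range lo a) (range≤s ≤-refl (≤-reflexive a≡H))
              (λ i → length-others _ (range lo a) (range≤s ≤-refl (≤-reflexive a≡H))))
        (λ π th ¬hits b lo≤b ⊆S → ⊥-elim (¬hits (lose
          (∈-pairs⁺ f g (in-range th lo≤b ⊆S x∈×x∉)
                (∈-filter⁺ _ (in-range th lo≤b ⊆S x'∈×x'∉) (x≢x' ∘ pos-injective π {x} {x'})))
          (refl , refl))))
      where
      f : ℕ → List ℕ
      f i = filter (λ i' → ¬? (i ≟ i')) (range lo a)
      g : ℕ → ℕ → Event n
      g i i' = pair x i x' i'
      x∈×x∉ : x ∈ A × ¬ x ∈ S
      x∈×x∉ = diffs⇒ A S (subst (x ∈ₗ_) (sym eq) (here refl))
      x'∈×x'∉ : x' ∈ A × ¬ x' ∈ S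
      x'∈×x'∉ = diffs⇒ A S (subst (x' ∈ₗ_) (sym eq) (there (here refl)))
      in-range : ∀ {π b y} → Through A π → lo ≤ b → at π b ⊑ S → y ∈ A × ¬ y ∈ S → pos π y ∈ₗ range lo a
      in-range {π} th lo≤b ⊆S (y∈ , y∉) = ∈-range⁺ (≤-trans lo≤b (≮⇒≥ (y∉ ∘ ⊆S _ ∘ ∈-at⇐ π))) (∈A⇒ π th y∈)

    -- Two layers below A the last two elements of A are missing. If S fits there, both are among
    -- the at most s elements of A outside S.
    drop₂ : ∀ S → lo ≤ ∣ S ∣ → Avoidable (q * q) A (s * s) (λ π → ∀ b → 2 + b ≤ a → ¬ S ⊑ at π b)
    drop₂ S lo≤S with S ⊆? A
    ... | no S⊈A = always λ π th b b<a S⊆ → S⊈A λ x∈ → ∈A⇐ π th (<-trans (∈-at⇒ π (S⊆ _ x∈)) (<⇒≤ b<a))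
    ... | yes S⊆A = avoiding
        (concatMap (λ y → map (g y) (f y)) (diffs A S))
        (All-pairs f g (diffs A S) (λ y∈ y'∈ → let (y'∈diffs , y≢y') = ∈-filter⁻ _ {xs = diffs A S} y'∈ in
          unlikely (proj₁ (diffs⇒ A S y∈)) (proj₁ (diffs⇒ A S y'∈diffs)) y≢y' i<a i'<a i≢i'))
        (length-pairs f g (diffs A S) small (λ y → length-others _ (diffs A S) small))
        (λ π th ¬hits b b+2≤a S⊆ →
          let (y , eq) = pos-surjective π (<-≤-trans i<a a≤n)
              (y' , eq') = pos-surjective π (<-≤-trans i'<a a≤n)
              b≤i' = ≤-pred (≤-pred (subst (2 + b ≤_) (sym 2+i'≡a) b+2≤a)) in
          ¬hits (lose (∈-pairs⁺ f g
            (diffs⇐ A S (∈A⇐ π th (subst (_< a) (sym eq) i<a))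
                  (λ y∈S → ∉at π y (subst (b ≤_) (sym eq) (m≤n⇒m≤1+n b≤i')) (S⊆ _ y∈S)))
            (∈-filter⁺ _ (diffs⇐ A S (∈A⇐ π th (subst (_< a) (sym eq') i'<a))
                  (λ y∈S → ∉at π y' (subst (b ≤_) (sym eq') b≤i') (S⊆ _ y∈S)))
              (λ y≡y' → i≢i' (trans (sym eq) (trans (cong (pos π) y≡y') eq')))))
            (eq , eq')))
      where
      i' = a ∸ 2
      i = suc i'
      2+i'≡a : 2 + i' ≡ a
      2+i'≡a = m+[n∸m]≡n 2≤a
      i<a : i < a
      i<a = ≤-reflexive 2+i'≡a
      i'<a : i' < a
      i'<a = <⇒≤ i<a
      i≢i' : i ≢ i'
      i≢i' = 1+n≢n
      a≤n : a ≤ n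
      a≤n = ≤-trans (≤-reflexive a≡H) H≤n
      small : length (diffs A S) ≤ s
      small = diffs≤s A S S⊆A lo≤S (≤-reflexive a≡H)
      f : Fin n → List (Fin n)
      f y = filter (λ y' → ¬? (y Fin.≟ y')) (diffs A S)
      g : Fin n → Fin n → Event n
      g y y' = pair y i y' i'

    downward₂ : (𝒮 : List (Subset n)) → (∀ {S} → S ∈ₗ 𝒮 → lo ≤ ∣ S ∣ × (S ≡ A ⊎ 2 + ∣ S ∣ ≤ a)) →
                Avoidable (q * q) A (length 𝒮 * (s * s + s * s)) (λ π → ∀ S → S ∈ₗ 𝒮 →
                  (∀ b → lo ≤ b → at π b ⊑ S → A ⊑ S) × (∀ b → 2 + b ≤ a → ¬ S ⊑ at π b))
    downward₂ 𝒮 sizes = every 𝒮 λ {S} S∈ → both (keep-in₂ S (proj₂ (sizes S∈))) (drop₂ S (proj₁ (sizes S∈)))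

-- Embedding the tree

update : ∀ {t} {X : Set} → (Fin t → X) → Fin t → X → Fin t → X
update g q w r with r Fin.≟ q
... | yes _ = w
... | no _ = g r

update-same : ∀ {t} {X : Set} (g : Fin t → X) q w → update g q w q ≡ w
update-same g q w with q Fin.≟ q
... | yes _ = refl
... | no q≢q = ⊥-elim (q≢q refl)

update-other : ∀ {t} {X : Set} (g : Fin t → X) q w {r} → r ≢ q → update g q w r ≡ g r
update-other g q w {r} r≢q with r Fin.≟ q
... | yes r≡q = ⊥-elim (r≢q r≡q)
... | no _ = refl

module Embedding {n : ℕ} (F : List (Subset n)) (F! : Unique F) (k : ℕ) (1≤k : 1 ≤ k)
  (lo H s : ℕ) (sizes : ∀ {A} → A ∈ₗ F → lo ≤ ∣ A ∣ × 2 + ∣ A ∣ ≤ H) (H≤n : H ≤ n) (H≤lo+s : H ≤ lo + s) (lo≤H : lo ≤ H)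
  (q T : ℕ) (q≤lo : q ≤ lo) (q+H≤n : q + H ≤ n)
  {t : ℕ} (_≼_ : Fin t → Fin t → Set) (po : IsPartialOrder _≡_ _≼_) (noCyc : ¬ FinPoset.Cycle _≼_)
  (m : Fin t) (ℓ : Fin t → ℕ) (ℓ-m : ℓ m ≡ k) (ℓ-< : ∀ p → p ≢ m → ℓ p < k)
  (ℓ-mono : ∀ p q → p ≼ q × p ≢ q → ℓ p < ℓ q) where

  open Windows F F! k 1≤k lo H s sizes H≤n H≤lo+s lo≤H
  open TreeOrder _≼_ po noCyc m using (Build; root; grow)
  open IsPartialOrder po using () renaming (refl to ≼-refl; trans to ≼-trans)

  -- Numbers of events to avoid in one choice: there are at most T old sets, each excluded by two
  -- properties with at most s events, or s * s events at the top.
  E₁ E₂ : ℕ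
  E₁ = T * (s + s)
  E₂ = T * (s * s + s * s)

  -- Bounds q * q times the number of harmful windows at a vertex. Below the top a share E₁ / q of
  -- the chains is harmful, with one window each; at the top a share E₂ / (q * q), with up to s
  -- windows each.
  budget : ℕ × Subset n → ℕ
  budget = cost (q * E₁) (s * E₂)

  module Within (𝒞 : List Item) (⊆items : ∀ {w} → w ∈ₗ 𝒞 → w ∈ₗ items) (sums : ∀ f → ∑ 𝒞 f ≤ ∑ items f) where

    Bad : Set
    Bad = ∃ λ v → (∃ λ w → w ∈ₗ 𝒞 × Incident w v) × (q * q) * ∑ 𝒞 (λ w → [ incident? w v ]) ≤ budget v

    Found : ℕ → Subset n → (Perm n → Set) → Set
    Found l A P = ∃ λ w → w ∈ₗ 𝒞 × mark w l ≡ A × P (proj₁ w)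

    ℓ≤k : ∀ p → ℓ p ≤ k
    ℓ≤k p with p Fin.≟ m
    ... | yes refl = ≤-reflexive ℓ-m
    ... | no p≢m = <⇒≤ (ℓ-< p p≢m)

    -- Either some surviving window through the same mark avoids all events, or all of them are hit.
    -- In the second case the bound on hit windows is a bound on all windows at this vertex, which
    -- can then be discarded.
    choose : ∀ {w l} rate E P → w ∈ₗ 𝒞 → l ≤ k →
             (∀ o → rate * cnt (λ π → through? (mark w l) π ×-dec hits? o π) ≤ E * chains (mark w l) →
                q * q * ∑ items (λ w' → [ incident? w' (l , mark w l) ×-dec hits? o (proj₁ w') ]) ≤ budget (l , mark w l)) →
             Avoidable rate (mark w l) E P → Found l (mark w l) P ⊎ Bad
    choose {w} {l} rate E P w∈ l≤k within-budget (avoiding o rare few avoid)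
      with Any.any? (λ w' → incident? w' (l , mark w l) ×-dec ¬? (hits? o (proj₁ w'))) 𝒞
    ... | yes found = let (w' , w'∈ , (_ , eq) , ¬hits) = find found in
      inj₁ (w' , w'∈ , eq , avoid (proj₁ w')
            (trans (cong (at (proj₁ w')) (trans (sym (cong ∣_∣ eq)) (∣mark∣ (⊆items w'∈)))) eq) ¬hits)
      where open import Data.List.Membership.Propositional using (find)
    ... | no none = inj₂ ((l , A) , (w , w∈ , l≤k , refl) , (begin
      q * q * ∑ 𝒞 (λ w' → [ incident? w' (l , A) ])                            ≤⟨ *-monoʳ-≤ (q * q) (∑-mono-∈ 𝒞 all-hit) ⟩
      q * q * ∑ 𝒞 (λ w' → [ incident? w' (l , A) ×-dec hits? o (proj₁ w') ])     ≤⟨ *-monoʳ-≤ (q * q) (sums _) ⟩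
      q * q * ∑ items (λ w' → [ incident? w' (l , A) ×-dec hits? o (proj₁ w') ]) ≤⟨ within-budget o
            (≤-trans (hits-count rate A o rare) (*-monoˡ-≤ (chains A) few)) ⟩
      budget (l , A)                                                           ∎))
      where
      open ≤-Reasoning
      A = mark w l
      all-hit : ∀ {w'} → w' ∈ₗ 𝒞 → [ incident? w' (l , A) ] ≤ [ incident? w' (l , A) ×-dec hits? o (proj₁ w') ]
      all-hit {w'} w'∈ = []-mono (incident? w' (l , A)) (incident? w' (l , A) ×-dec hits? o (proj₁ w')) λ inc →
        inc , decidable-stable (hits? o (proj₁ w')) λ ¬hits → none (lose w'∈ (inc , ¬hits))

    choose-low : ∀ {w l} P → w ∈ₗ 𝒞 → l < k → Avoidable q (mark w l) E₁ P → Found l (mark w l) P ⊎ Bad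
    choose-low {w} {l} P w∈ l<k = choose q E₁ P w∈ (<⇒≤ l<k) λ o le → begin
      q * q * ∑ items (λ w' → [ incident? w' (l , A) ×-dec hits? o (proj₁ w') ]) ≤⟨ *-monoʳ-≤ (q * q) (low-count A o l<k) ⟩
      q * q * cnt (λ π → through? A π ×-dec hits? o π)    ≡⟨ *-assoc q q _ ⟩
      q * (q * cnt (λ π → through? A π ×-dec hits? o π))  ≤⟨ *-monoʳ-≤ q le ⟩
      q * (E₁ * chains A)                                 ≡⟨ *-assoc q E₁ _ ⟨
      q * E₁ * chains A                                   ≡⟨ cost-low l<k ⟨
      budget (l , A)                                      ∎
      where
      open ≤-Reasoning
      A = mark w l
      cost-low : ∀ {l A} → l < k → budget (l , A) ≡ q * E₁ * chains A
      cost-low {l} l<k with l <? k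
      ... | yes _ = refl
      ... | no l≮k = ⊥-elim (l≮k l<k)

    choose-top : ∀ {w} P → w ∈ₗ 𝒞 → Avoidable (q * q) (mark w k) E₂ P → Found k (mark w k) P ⊎ Bad
    choose-top {w} P w∈ = choose (q * q) E₂ P w∈ ≤-refl λ o le → begin
      q * q * ∑ items (λ w' → [ incident? w' (k , A) ×-dec hits? o (proj₁ w') ]) ≤⟨ *-monoʳ-≤ (q * q) (top-count A o) ⟩
      q * q * (s * cnt (λ π → through? A π ×-dec hits? o π)) ≡⟨ x∙yz≈y∙xz (q * q) s _ ⟩
      s * (q * q * cnt (λ π → through? A π ×-dec hits? o π)) ≤⟨ *-monoʳ-≤ s le ⟩
      s * (E₂ * chains A)                                 ≡⟨ *-assoc s E₂ _ ⟨
      s * E₂ * chains A                                   ≡⟨ cost-top ⟨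
      budget (k , A)                                      ∎
      where
      open ≤-Reasoning
      open import Algebra.Properties.CommutativeSemigroup *-commutativeSemigroup using (x∙yz≈y∙xz)
      A = mark w k
      cost-top : ∀ {A} → budget (k , A) ≡ s * E₂ * chains A
      cost-top with k <? k
      ... | yes k<k = ⊥-elim (<-irrefl refl k<k)
      ... | no _ = refl

    -- The image of p is the mark of its window at its level. Different vertices may use windows on
    -- different chains, so the order is recorded for the images and not read off from one chain.
    Embedded : List (Fin t) → Set
    Embedded D = Σ (Fin t → Item) λ g → (∀ {p} → p ∈ₗ D → g p ∈ₗ 𝒞) ×
      (∀ {p r} → p ∈ₗ D → r ∈ₗ D → (p ≼ r → mark (g p) (ℓ p) ⊑ mark (g r) (ℓ r)) ×
            (mark (g p) (ℓ p) ⊑ mark (g r) (ℓ r) → p ≼ r))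

    extend : ∀ {D q w} ((g , _) : Embedded D) → q ∉ₗ D → w ∈ₗ 𝒞 →
             (∀ {r} → r ∈ₗ D → let S = mark (g r) (ℓ r) ; X = mark w (ℓ q) in
                ((q ≼ r → X ⊑ S) × (X ⊑ S → q ≼ r)) × ((r ≼ q → S ⊑ X) × (S ⊑ X → r ≼ q))) →
             Embedded (q ∷ D)
    extend {D} {q} {w} (g , g∈ , order) q∉ w∈ new = g' , g'∈ , order'
      where
      g' : Fin t → Item
      g' = update g q w
      old : ∀ {r} → r ∈ₗ D → g' r ≡ g r
      old r∈ = update-other g q w λ { refl → q∉ r∈ }
      g'∈ : ∀ {p} → p ∈ₗ q ∷ D → g' p ∈ₗ 𝒞
      g'∈ (here refl) = subst (_∈ₗ 𝒞) (sym (update-same g q w)) w∈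
      g'∈ (there p∈) = subst (_∈ₗ 𝒞) (sym (old p∈)) (g∈ p∈)
      order' : ∀ {p r} → p ∈ₗ q ∷ D → r ∈ₗ q ∷ D →
        (p ≼ r → mark (g' p) (ℓ p) ⊑ mark (g' r) (ℓ r)) × (mark (g' p) (ℓ p) ⊑ mark (g' r) (ℓ r) → p ≼ r)
      order' (here refl) (here refl) = (λ _ _ → id) , λ _ → ≼-refl
      order' (here refl) (there r∈) rewrite update-same g q w | old r∈ = proj₁ (new r∈)
      order' (there p∈) (here refl) rewrite update-same g q w | old p∈ = proj₂ (new p∈)
      order' (there p∈) (there r∈) rewrite old p∈ | old r∈ = order p∈ r∈

    posn-lower : ∀ {w l} → w ∈ₗ items → l ≤ k → lo ≤ posn w l
    posn-lower {w} w∈ l≤k with m≤n⇒m<n∨m≡n l≤k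
    ... | inj₁ l<k = proj₁ (posn-bounds w∈ l<k)
    ... | inj₂ refl = subst (lo ≤_) (sym (posn-top w)) lo≤H

    posn-upper : ∀ {w l} → w ∈ₗ items → l ≤ k → posn w l ≤ H
    posn-upper {w} w∈ l≤k with m≤n⇒m<n∨m≡n l≤k
    ... | inj₁ l<k = <⇒≤ (<⇒≤ (proj₂ (posn-bounds w∈ l<k)))
    ... | inj₂ refl = ≤-reflexive (posn-top w)

    images : List (Fin t) → (Fin t → Item) → List (Subset n)
    images D g = map (λ r → mark (g r) (ℓ r)) D

    ∈-images : ∀ {D g r} → r ∈ₗ D → mark (g r) (ℓ r) ∈ₗ images D g
    ∈-images {g = g} r∈ = ∈-map⁺ (λ r → mark (g r) (ℓ r)) r∈

    -- The window chosen for q' has the mark A, the image of p, at the level of p. So the image X of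
    -- q' lies on a common chain with A, and strict monotonicity of ℓ puts it on the correct side.
    module Step {D : List (Fin t)} (D≤T : length D ≤ T) (emb : Embedded D) {p q' : Fin t} (p∈ : p ∈ₗ D) (q'∉ : q' ∉ₗ D) where

      g : Fin t → Item
      g = proj₁ emb

      g∈ : ∀ {r} → r ∈ₗ D → g r ∈ₗ items
      g∈ r∈ = ⊆items (proj₁ (proj₂ emb) r∈)

      order : ∀ {p r} → p ∈ₗ D → r ∈ₗ D → (p ≼ r → mark (g p) (ℓ p) ⊑ mark (g r) (ℓ r)) ×
            (mark (g p) (ℓ p) ⊑ mark (g r) (ℓ r) → p ≼ r)
      order = proj₂ (proj₂ emb)

      A : Subset n
      A = mark (g p) (ℓ p)

      lower : ∀ {S} → S ∈ₗ images D g → lo ≤ ∣ S ∣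
      lower S∈ with ∈-map⁻ (λ r → mark (g r) (ℓ r)) S∈
      ... | r , r∈ , refl = subst (lo ≤_) (sym (∣mark∣ (g∈ r∈))) (posn-lower (g∈ r∈) (ℓ≤k r))

      upper : ∀ {S} → S ∈ₗ images D g → ∣ S ∣ ≤ H
      upper S∈ with ∈-map⁻ (λ r → mark (g r) (ℓ r)) S∈
      ... | r , r∈ , refl = subst (_≤ H) (sym (∣mark∣ (g∈ r∈))) (posn-upper (g∈ r∈) (ℓ≤k r))

      small : ∀ e → length (images D g) * e ≤ T * e
      small e = *-monoˡ-≤ e (≤-trans (≤-reflexive (length-map (λ r → mark (g r) (ℓ r)) D)) D≤T)
        where open import Data.List.Properties using (length-map)

      widen : ∀ {c E E' P} → E ≤ E' → Avoidable c A E P → Avoidable c A E' P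
      widen E≤E' (avoiding o rare few avoid) = avoiding o rare (≤-trans few E≤E') avoid

      lo≤A : lo ≤ ∣ A ∣
      lo≤A = lower (∈-images {D} {g} p∈)

      A≤H : ∣ A ∣ ≤ H
      A≤H = upper (∈-images {D} {g} p∈)

      ∣A∣ : ∀ {w} → w ∈ₗ 𝒞 → mark w (ℓ p) ≡ A → posn w (ℓ p) ≡ ∣ A ∣
      ∣A∣ w∈ eq = trans (sym (∣mark∣ (⊆items w∈))) (cong ∣_∣ eq)

      -- An old vertex below q' is below p, so its image S satisfies S ⊑ A ⊑ X. Conversely S ⊑ X
      -- gives S ⊑ A by `keep-out`, and X lies in no old set by `escape`.
      step-up : p ≼ q' × p ≢ q' → (∀ {r} → r ∈ₗ D → r ≼ q' → r ≼ p) → (∀ {r} → r ∈ₗ D → ¬ q' ≼ r) →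
                Embedded (q' ∷ D) ⊎ Bad
      step-up p≺q' below none-above = map₁ place (choose-low _ (proj₁ (proj₂ emb) p∈) ℓp<k
          (widen (small (s + s)) (upward (images D g) upper)))
        where
        open import Data.Sum using (map₁)
        ℓp<k : ℓ p < k
        ℓp<k = <-≤-trans (ℓ-mono p q' p≺q') (ℓ≤k q')
        a<H : ∣ A ∣ < H
        a<H = subst (_< H) (sym (∣mark∣ (g∈ p∈))) (<⇒≤ (proj₂ (posn-bounds (g∈ p∈) ℓp<k)))
        open Separation A q s lo H H≤n H≤lo+s
        open Upward lo≤A a<H (m+n≤o⇒m≤o∸n q (≤-trans (+-monoʳ-≤ q A≤H) q+H≤n))
        place : Found (ℓ p) A (λ π → ∀ S → S ∈ₗ images D g →
                  (∀ b → b ≤ H → S ⊑ at π b → S ⊑ A) × (∀ b → ∣ A ∣ < b → ¬ at π b ⊑ S)) → Embedded (q' ∷ D)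
        place (w , w∈ , eq , separated) = extend emb q'∉ w∈ λ {r} r∈ →
            let (keep-out , escape) = separated _ (∈-images {D} {g} r∈)
                (to , from) = order r∈ p∈ in
            ((λ q'≼r → ⊥-elim (none-above r∈ q'≼r)) , λ X⊑S → ⊥-elim (escape b a<b X⊑S)) ,
            (λ r≼q' x x∈ → A⊑X x (to (below r∈ r≼q') x x∈)) ,
            (λ S⊑X → ≼-trans (from (keep-out b (posn-upper (⊆items w∈) (ℓ≤k q')) S⊑X)) (proj₁ p≺q'))
          where
          b : ℕ
          b = posn w (ℓ q')
          a<b : ∣ A ∣ < b
          a<b = subst (_< b) (∣A∣ w∈ eq) (posn-mono (⊆items w∈) (ℓ-mono p q' p≺q') (ℓ≤k q'))
          A⊑X : A ⊑ mark w (ℓ q')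
          A⊑X x x∈ = at-mono (proj₁ w) (<⇒≤ (posn-mono (⊆items w∈) (ℓ-mono p q' p≺q') (ℓ≤k q'))) (subst (x ∈_) (sym eq) x∈)

      -- The order-theoretic half shared by `step-down` and `step-top`, which differ only in how
      -- they find a chain that separates.
      finish-down : q' ≼ p × q' ≢ p → (∀ {r} → r ∈ₗ D → q' ≼ r → p ≼ r) → (∀ {r} → r ∈ₗ D → ¬ r ≼ q') →
        ∀ {w} → w ∈ₗ 𝒞 → mark w (ℓ p) ≡ A →
        (∀ S → S ∈ₗ images D g → (mark w (ℓ q') ⊑ S → A ⊑ S) × ¬ S ⊑ mark w (ℓ q')) → Embedded (q' ∷ D)
      finish-down q'≺p above none-below {w} w∈ eq separated = extend emb q'∉ w∈ λ {r} r∈ →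
          let (keep-in , drop) = separated _ (∈-images {D} {g} r∈)
              (to , from) = order p∈ r∈ in
          ((λ q'≼r x x∈ → to (above r∈ q'≼r) x (X⊑A x x∈)) , λ X⊑S → ≼-trans (proj₁ q'≺p) (from (keep-in X⊑S))) ,
          (λ r≼q' → ⊥-elim (none-below r∈ r≼q')) , λ S⊑X → ⊥-elim (drop S⊑X)
        where
        X⊑A : mark w (ℓ q') ⊑ A
        X⊑A x x∈ = subst (x ∈_) eq (at-mono (proj₁ w) (<⇒≤ (posn-mono (⊆items w∈) (ℓ-mono q' p q'≺p) (ℓ≤k p))) x∈)

      step-down : p ≢ m → q' ≼ p × q' ≢ p → (∀ {r} → r ∈ₗ D → q' ≼ r → p ≼ r) → (∀ {r} → r ∈ₗ D → ¬ r ≼ q') →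
                  Embedded (q' ∷ D) ⊎ Bad
      step-down p≢m q'≺p above none-below = map₁ place (choose-low _ (proj₁ (proj₂ emb) p∈) (ℓ-< p p≢m)
          (widen (small (s + s)) (downward (images D g) lower)))
        where
        open import Data.Sum using (map₁)
        lo<a : lo < ∣ A ∣
        lo<a = ≤-<-trans (posn-lower (g∈ p∈) (ℓ≤k q'))
              (subst (posn (g p) (ℓ q') <_) (sym (∣mark∣ (g∈ p∈))) (posn-mono (g∈ p∈) (ℓ-mono q' p q'≺p) (ℓ≤k p)))
        open Separation A q s lo H H≤n H≤lo+s
        open Downward lo<a A≤H (≤-trans q≤lo lo≤A)
        place : Found (ℓ p) A (λ π → ∀ S → S ∈ₗ images D g →
                  (∀ b → lo ≤ b → at π b ⊑ S → A ⊑ S) × (∀ b → b < ∣ A ∣ → ¬ S ⊑ at π b)) → Embedded (q' ∷ D)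
        place (w , w∈ , eq , separated) = finish-down q'≺p above none-below w∈ eq λ S S∈ →
          proj₁ (separated S S∈) (posn w (ℓ q')) (posn-lower (⊆items w∈) (ℓ≤k q')) ,
          proj₂ (separated S S∈) (posn w (ℓ q'))
                (subst (posn w (ℓ q') <_) (∣A∣ w∈ eq) (posn-mono (⊆items w∈) (ℓ-mono q' p q'≺p) (ℓ≤k p)))

      -- Here A has size H, and every other old image belongs to F, at least two layers below. This
      -- is the gap that the obstacles with two prescribed steps require.
      step-top : p ≡ m → q' ≼ p × q' ≢ p → (∀ {r} → r ∈ₗ D → q' ≼ r → p ≼ r) → (∀ {r} → r ∈ₗ D → ¬ r ≼ q') →
                 Embedded (q' ∷ D) ⊎ Bad
      step-top p≡m q'≺p above none-below = map₁ place (choose-top _ (proj₁ (proj₂ emb) p∈)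
          (subst (λ B → Avoidable (q * q) B E₂ Separated) A≡
                (widen (small (s * s + s * s)) (downward₂ (images D g) bounds))))
        where
        open import Data.Sum using (map₁)
        ℓp≡k : ℓ p ≡ k
        ℓp≡k = trans (cong ℓ p≡m) ℓ-m
        A≡ : A ≡ mark (g p) k
        A≡ = cong (mark (g p)) ℓp≡k
        Separated : Perm n → Set
        Separated π = ∀ S → S ∈ₗ images D g → (∀ b → lo ≤ b → at π b ⊑ S → A ⊑ S) × (∀ b → 2 + b ≤ ∣ A ∣ → ¬ S ⊑ at π b)
        ℓq'<k : ℓ q' < k
        ℓq'<k = ℓ-< q' (λ q'≡m → proj₂ q'≺p (trans q'≡m (sym p≡m)))
        a≡H : ∣ A ∣ ≡ H
        a≡H = trans (∣mark∣ (g∈ p∈)) (trans (cong (posn (g p)) ℓp≡k) (posn-top (g p)))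
        room : 2 + lo ≤ ∣ A ∣
        room = ≤-trans (+-monoʳ-≤ 2 (proj₁ (posn-bounds (g∈ p∈) ℓq'<k)))
              (≤-trans (proj₂ (posn-bounds (g∈ p∈) ℓq'<k)) (≤-reflexive (sym a≡H)))
        bounds : ∀ {S} → S ∈ₗ images D g → lo ≤ ∣ S ∣ × (S ≡ A ⊎ 2 + ∣ S ∣ ≤ ∣ A ∣)
        bounds {S} S∈ with ∈-map⁻ (λ r → mark (g r) (ℓ r)) S∈
        ... | r , r∈ , refl with r Fin.≟ m
        ... | yes r≡m = lower S∈ , inj₁ (cong (λ r → mark (g r) (ℓ r)) (trans r≡m (sym p≡m)))
        ... | no r≢m = lower S∈ , inj₂ (≤-trans (≤-reflexive (cong (2 +_) (∣mark∣ (g∈ r∈))))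
              (≤-trans (proj₂ (posn-bounds (g∈ r∈) (ℓ-< r r≢m))) (≤-reflexive (sym a≡H))))
        open Separation A q s lo H H≤n H≤lo+s
        open Top a≡H (≤-trans (s≤s q≤lo) (<⇒≤ room)) (≤-trans (s≤s (s≤s z≤n)) room)
        place : Found k (mark (g p) k) Separated → Embedded (q' ∷ D)
        place (w , w∈ , eq , separated) = finish-down q'≺p above none-below w∈ eq' λ S S∈ →
            proj₁ (separated S S∈) (posn w (ℓ q')) (posn-lower (⊆items w∈) (ℓ≤k q')) ,
            proj₂ (separated S S∈) (posn w (ℓ q')) (≤-trans (proj₂ (posn-bounds (⊆items w∈) ℓq'<k)) (≤-reflexive (sym a≡H)))
          where
          eq' : mark w (ℓ p) ≡ A
          eq' = trans (cong (mark w) ℓp≡k) (trans eq (sym A≡))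

    embed : ∀ {D w₀} → w₀ ∈ₗ 𝒞 → Build D → length D ≤ T → Embedded D ⊎ Bad
    embed {w₀ = w₀} w₀∈ root _ = inj₁ ((λ _ → w₀) ,
          (λ _ → w₀∈) , λ { (here refl) (here refl) → (λ _ _ → id) , λ _ → ≼-refl })
    embed w₀∈ (grow {p = p} B _ p∈ q'∉ att) D≤T with embed w₀∈ B (<⇒≤ D≤T)
    ... | inj₂ bad = inj₂ bad
    ... | inj₁ emb with att
    ... | inj₁ (p≺q' , below , none-above) = Step.step-up (<⇒≤ D≤T) emb p∈ q'∉ p≺q' below none-above
    ... | inj₂ (q'≺p , above , none-below) with p Fin.≟ m
    ... | yes p≡m = Step.step-top (<⇒≤ D≤T) emb p∈ q'∉ p≡m q'≺p above none-below
    ... | no p≢m = Step.step-down (<⇒≤ D≤T) emb p∈ q'∉ p≢m q'≺p above none-below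

-- The final estimate and the theorem

weigh : ∀ b k q s T S n! items A B → 1 ≤ n! →
        b * S ≤ B * n! → A + k * b * n! ≤ b * items + k * b * n! → n! ≤ A →
        (k * T * 2 * B + 2 * b * T) * (q * s + s * (s * s)) < q * q →
        k * ((q * (T * (s + s))) * S) + s * (T * (s * s + s * s)) * n! < q * q * items
-- Multiplied by b, the total cost is at most (2kTB · q s + 2bT · s³) · n!, whereas b · q² · items
-- is at least q² · n!. The two coefficients add up to the factor in `sparse`.
weigh b k q s T S n! items A B pos bS≤ enough n!≤A sparse = *-cancelˡ-< b _ _ (begin-strict
  b * (k * ((q * (T * (s + s))) * S) + s * (T * (s * s + s * s)) * n!)   ≡⟨ split b k q s T S n! ⟩
  k * T * 2 * (q * s) * (b * S) + 2 * b * T * (s * (s * s)) * n!         ≤⟨ +-monoˡ-≤ _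
        (*-monoʳ-≤ (k * T * 2 * (q * s)) bS≤) ⟩
  k * T * 2 * (q * s) * (B * n!) + 2 * b * T * (s * (s * s)) * n!        ≡⟨ gather (k * T * 2) (q * s) B n!
        (2 * b * T) (s * (s * s)) ⟩
  (k * T * 2 * B * (q * s) + 2 * b * T * (s * (s * s))) * n!             ≤⟨ *-monoˡ-≤ n! (+-mono-≤
                                                                              (*-monoʳ-≤ (k * T * 2 * B)
                                                                                    (m≤m+n (q * s) (s * (s * s))))
                                                                              (*-monoʳ-≤ (2 * b * T)
                                                                                    (m≤n+m (s * (s * s)) (q * s)))) ⟩
  (k * T * 2 * B * X + 2 * b * T * X) * n!                               ≡⟨ cong (_* n!)
        (*-distribʳ-+ X (k * T * 2 * B) (2 * b * T)) ⟨
  (k * T * 2 * B + 2 * b * T) * X * n!                                   <⟨ *-monoˡ-< n! {{>-nonZero pos}} sparse ⟩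
  q * q * n!                                                             ≤⟨ *-monoʳ-≤ (q * q)
        (≤-trans n!≤A (+-cancelʳ-≤ (k * b * n!) _ _ enough)) ⟩
  q * q * (b * items)                                                    ≡⟨ swap (q * q) b items ⟩
  b * (q * q * items)                                                    ∎)
  where
  open ≤-Reasoning
  X : ℕ
  X = q * s + s * (s * s)
  split : ∀ b k q s T S N → b * (k * ((q * (T * (s + s))) * S) + s * (T * (s * s + s * s)) * N)
        ≡ k * T * 2 * (q * s) * (b * S) + 2 * b * T * (s * (s * s)) * N
  split = solve-∀
  gather : ∀ a x B N c y → a * x * (B * N) + c * y * N ≡ (a * B * x + c * y) * N
  gather = solve-∀
  swap : ∀ a b c → a * (b * c) ≡ b * (a * c)
  swap = solve-∀

-- Every set lies on at least n! / C(n, n/2) chains, so the lower bound on the size of the family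
-- becomes one on its incidences with chains.
dense : ∀ {n} a b k (F : List (Subset n)) → (k * b + a) * (n C (n / 2)) ≤ b * length F + b * (n C (n / 2)) →
        (k * b + a) * n ! ≤ b * ∑ F chains + b * n !
dense {n} a b k F large = begin
  (k * b + a) * n !               ≡⟨ cong ((k * b + a) *_) n!≡ ⟨
  (k * b + a) * (x * h)           ≡⟨ *-assoc (k * b + a) x h ⟨
  (k * b + a) * x * h             ≤⟨ *-monoˡ-≤ h large ⟩
  (b * length F + b * x) * h      ≡⟨ distribute b (length F) x h ⟩
  b * (length F * h) + b * (x * h) ≡⟨ cong₂ (λ y z → b * y + b * z) (sym (∑-const F h)) n!≡ ⟩
  b * ∑ F (λ _ → h) + b * n !     ≤⟨ +-monoˡ-≤ (b * n !) (*-monoʳ-≤ b (∑-mono F middle≤chains)) ⟩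
  b * ∑ F chains + b * n !        ∎
  where
  open ≤-Reasoning
  x h : ℕ
  x = n C (n / 2)
  h = (n / 2) ! * (n ∸ n / 2) !
  n!≡ : x * h ≡ n !
  n!≡ = binomial-product (m/n≤m n 2)
  distribute : ∀ b l x h → (b * l + b * x) * h ≡ b * (l * h) + b * (x * h)
  distribute = solve-∀

theorem2p1 : (t k : ℕ) (_≼_ : Fin t → Fin t → Set) → IsPartialOrder _≡_ _≼_ →
    FinPoset.IsTreePoset _≼_ → FinPoset.HasHeight _≼_ (suc k) →
    (m : Fin t) → FinPoset.Maximal _≼_ m → FinPoset.EveryChainContains _≼_ (suc k) m →
    (a b : ℕ) → 1 ≤ a → 1 ≤ b →
    Σ ℕ λ n₀ → (n : ℕ) → n₀ ≤ n →
    (𝓕 : List (Subset n)) → Unique 𝓕 → All (InBtilde n) 𝓕 →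
    (k * b + a) * (n C (n / 2)) ≤ b * length 𝓕 + b * (n C (n / 2)) →
    Σ (Fin t → Subset n) λ G →
    IsStrongCopyMinus _≼_ m 𝓕 G × AvoidsDownUnion _≼_ m G
-- For k = 0 every one-element chain contains m, so m is the only element and there is nothing to
-- embed.
theorem2p1 t zero _≼_ po _ _ m _ every a b _ _ = 0 , λ n _ 𝓕 _ _ _ → (λ _ → Data.Fin.Subset.⊥) ,
  ( (λ p p≢m → ⊥-elim (p≢m (single-point p)))
  , (λ p _ p≢m → ⊥-elim (p≢m (single-point p)))
  , (λ p _ p≢m → ⊥-elim (p≢m (single-point p))))
  , λ p p⋠m → ⊥-elim (p⋠m (subst (p ≼_) (single-point p) (IsPartialOrder.refl po)))
  where
  import Data.Fin.Subset
  single-point : ∀ p → p ≡ m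
  single-point p = proj₂ (every ((λ _ → p) , (λ { {zero} {zero} _ → refl }) , λ _ _ → inj₁ (IsPartialOrder.refl po)))
theorem2p1 t k@(suc _) _≼_ po (_ , connected , noCyc) _ m maximal every a b 1≤a 1≤b =
  proj₁ (scale (1 + 33 * K)) , λ n n₀≤n 𝓕 𝓕! 𝓕⊆ large →
    let (z , K≤z , y⁵≤n , near) = proj₂ (scale (1 + 33 * K)) n n₀≤n
    in find-copy n 𝓕 𝓕! 𝓕⊆ large (layers K≤z y⁵≤n near)
  where
  open IsPartialOrder po using () renaming (refl to ≼-refl; antisym to ≼-antisym)
  module Order = TreeOrder _≼_ po noCyc m
  ordering = Order.build-order connected
  D = proj₁ ordering
  build = proj₁ (proj₂ ordering)
  all∈ = proj₂ (proj₂ (proj₂ ordering))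
  -- Once the construction has reached all of T, the whole order is decidable.
  level = Levels.levels _≼_ po (λ x y → proj₁ (proj₂ (proj₂ ordering)) (all∈ x) (all∈ y)) k m maximal every
  ℓ = proj₁ level
  T B K : ℕ
  T = length D
  -- Thinning leaves b · `∑ F chains` ≤ B · n!, the last b being the overshoot by one set; K then
  -- collects the coefficients of the two losses in `weigh`.
  B = k * b + a + b
  K = k * T * 2 * B + 2 * b * T

  find-copy : ∀ n (𝓕 : List (Subset n)) → Unique 𝓕 → All (InBtilde n) 𝓕 →
    (k * b + a) * (n C (n / 2)) ≤ b * length 𝓕 + b * (n C (n / 2)) → Layers n K →
    Σ (Fin t → Subset n) λ G → IsStrongCopyMinus _≼_ m 𝓕 G × AvoidsDownUnion _≼_ m G
  find-copy n 𝓕 𝓕! 𝓕⊆ large lay = prune items incident? budget (q * q) attempt vertices incident-vertex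
    (≤-<-trans (∑-cost (q * E₁) (s * E₂)) (weigh b k q s T (∑ F chains) (n !) (length items) (a * n !) B
          (1≤n! n) bS≤ enough (m≤n*m (n !) a {{>-nonZero 1≤a}}) sparse))
    where
    open Layers lay
    thinned = thin chains b (b * n !) ((k * b + a) * n !) (n !) chains≤n! 𝓕 (dense a b k 𝓕 large)
    F : List (Subset n)
    F = proj₁ thinned
    F⊆ : ∀ {A} → A ∈ₗ F → A ∈ₗ 𝓕
    F⊆ = proj₁ (proj₂ thinned)
    F! : Unique F
    F! = proj₁ (proj₂ (proj₂ thinned)) 𝓕!
    bS≤ : b * ∑ F chains ≤ B * n !
    bS≤ = ≤-trans (proj₂ (proj₂ (proj₂ (proj₂ thinned)))) (≤-reflexive (sym (*-distribʳ-+ (n !) (k * b + a) b)))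
    H≤n : H ≤ n
    H≤n = ≤-trans (m≤n+m H q) q+H≤n
    F-sizes : ∀ {A} → A ∈ₗ F → lo ≤ ∣ A ∣ × 2 + ∣ A ∣ ≤ H
    F-sizes {A} A∈ = sizes A (All.lookup 𝓕⊆ (F⊆ A∈))
    open Windows F F! k (s≤s z≤n) lo H s F-sizes H≤n H≤lo+s lo≤H
    open Embedding F F! k (s≤s z≤n) lo H s F-sizes H≤n H≤lo+s lo≤H q T q≤lo q+H≤n _≼_ po noCyc m ℓ
      (proj₁ (proj₂ level)) (proj₁ (proj₂ (proj₂ level))) (proj₂ (proj₂ (proj₂ level)))

    enough : a * n ! + k * b * n ! ≤ b * length items + k * b * n !
    enough = begin
      a * n ! + k * b * n !               ≡⟨ trans (+-comm (a * n !) _) (sym (*-distribʳ-+ (n !) (k * b) a)) ⟩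
      (k * b + a) * n !                   ≤⟨ proj₁ (proj₂ (proj₂ (proj₂ thinned))) ⟩
      b * ∑ F chains + b * n !            ≡⟨ *-distribˡ-+ b _ _ ⟨
      b * (∑ F chains + n !)              ≤⟨ *-monoʳ-≤ b enough-items ⟩
      b * (length items + k * n !)        ≡⟨ *-distribˡ-+ b (length items) _ ⟩
      b * length items + b * (k * n !)    ≡⟨ cong (b * length items +_)
            (trans (sym (*-assoc b k (n !))) (cong (_* n !) (*-comm b k))) ⟩
      b * length items + k * b * n !      ∎
      where open ≤-Reasoning

    Goal : Set
    Goal = Σ (Fin t → Subset n) λ G → IsStrongCopyMinus _≼_ m 𝓕 G × AvoidsDownUnion _≼_ m G

    attempt : ∀ 𝒞 → (∀ {w} → w ∈ₗ 𝒞 → w ∈ₗ items) → (∀ f → ∑ 𝒞 f ≤ ∑ items f) → (∃ λ w → w ∈ₗ 𝒞) →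
              Goal ⊎ ∃ λ v → (∃ λ w → w ∈ₗ 𝒞 × Incident w v) × (q * q) * ∑ 𝒞 (λ w → [ incident? w v ]) ≤ budget v
    attempt 𝒞 ⊆items sums (w₀ , w₀∈) = map₁ copy (Here.embed w₀∈ build ≤-refl)
      where
      open import Data.Sum using (map₁)
      module Here = Within 𝒞 ⊆items sums
      copy : Here.Embedded D → Goal
      copy (g , g∈ , order) = G
        , ( (λ p p≢m → F⊆ (mark-∈ (⊆items (g∈ (all∈ p))) (proj₁ (proj₂ (proj₂ level)) p p≢m)))
          , (λ p r _ _ eq → ≼-antisym (reflect p r λ x x∈ → subst (x ∈_) eq x∈)
                (reflect r p λ x x∈ → subst (x ∈_) (sym eq) x∈))
          , (λ p r _ _ → (λ p≼r {x} → preserve p r p≼r x) , λ Gp⊆Gr → reflect p r λ x x∈ → Gp⊆Gr x∈))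
        , λ p p⋠m covered → p⋠m (reflect p m λ x x∈ → let (d , d≼m , _ , x∈Gd) = covered x x∈ in preserve d m d≼m x x∈Gd)
        where
        G : Fin t → Subset n
        G p = mark (g p) (ℓ p)
        preserve : ∀ p r → p ≼ r → G p ⊑ G r
        preserve p r = proj₁ (order (all∈ p) (all∈ r))
        reflect : ∀ p r → G p ⊑ G r → p ≼ r
        reflect p r = proj₂ (order (all∈ p) (all∈ r))
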